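{- Let $w\in W_B^n$, $m\ge2$, and let $\boldsymbol A=(s_1\boldsymbol a_1)(s_2\boldsymbol a_2)\cdots(s_m\boldsymbol a_m)\in U_m^\pm(w)$. The odd Kashiwara operator $\tilde e_{\bar1}^F$ acts on $\boldsymbol A$ as follows; if $\tilde e_{\bar1}^F\boldsymbol A\neq\mathbf0$, it changes only the first two factors. (1) If the concatenation $\boldsymbol a_1\boldsymbol a_2$ is not unimodal: let $\boldsymbol a_2'$ be $\boldsymbol a_2$ with its first letter removed and $\boldsymbol a_1'$ the word obtained by appending that letter to $\boldsymbol a_1$. If $\boldsymbol a_1'$ is unimodal, then $\tilde e_{\bar1}^F\boldsymbol A=(s_1\boldsymbol a_1')(s_2\boldsymbol a_2')(s_3\boldsymbol a_3)\cdots$; otherwise $\tilde e_{\bar1}^F\boldsymbol A=\mathbf0$. (2) If $\boldsymbol a_1\boldsymbol a_2$ is unimodal: if $\boldsymbol a_2=\emptyset$, or $s_1\ne0$ and $s_2=+$, then $\tilde e_{\bar1}^F\boldsymbol A=\mathbf0$. Otherwise $\tilde e_{\bar1}^F\boldsymbol A=(s_1'\boldsymbol a_1')(s_2'\boldsymbol a_2')(s_3\boldsymbol a_3)\cdots$ with $\boldsymbol a_1',\boldsymbol a_2'$ as in (1) and: when $\boldsymbol a_1=\emptyset$, $(s_1',s_2')=(s_2,0)$ if $|\boldsymbol a_2|=1$ and $(s_2,+)$ if $|\boldsymbol a_2|\ge2$; when $\boldsymbol a_1\neq\emptyset$, $(s_1',s_2')=(s_1,0)$ if $|\boldsymbol a_2|=1$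 and $(s_1,+)$ if $|\boldsymbol a_2|\ge2$.
   Context: Type $B$: $W_B^n$ is generated by $s_0,\dots,s_{n-1}$ (signed permutations, $s_0$ changes the sign of the first entry, $s_i$ swaps positions $i,i+1$); a word $a_1\cdots a_l$ over $\{0,\dots,n-1\}$ is a reduced word of $w$ if $w=s_{a_1}\cdots s_{a_l}$ with $l$ minimal. A word $a_1\cdots a_l$ is unimodal if $a_1>\dots>a_k<a_{k+1}<\dots<a_l$ for some $k$ ($a_1\cdots a_k$ is its decreasing part $R_\downarrow$, the rest its increasing part $R_\uparrow$); the empty word is unimodal. A signed unimodal factorization with $m$ factors of a reduced word $\boldsymbol a$ of $w$ is $\boldsymbol A=(s_1\boldsymbol a_1)\cdots(s_m\boldsymbol a_m)$ with $\boldsymbol a_1\cdots\boldsymbol a_m=\boldsymbol a$, each $\boldsymbol a_i$ unimodal (possibly empty), and $s_i=0$ if $\boldsymbol a_i$ is empty, $s_i\in\{+,-\}$ otherwise; $U_m^\pm(w)$ is the set of all these; $|\boldsymbol a|$ is the number of letters. Shifted diagram $S(\lambda)=\{(i,j):1\le i\le l(\lambda),\ i\le j\le\lambda_i+i-1\}$ for a strict partition $\lambda$ (row $i$, column $j$, row 1 on top; main diagonal $\{(i,i)\}$). A standard decomposition tableau of $w$ of shape $\lambda$ is a filling of $S(\lambda)$ whose rows $P_i$ satisfy: $P_lP_{l-1}\cdots P_1$ is a reduced word of $w$ and $P_i$ is a unimodal subword of maximum length of $P_{i+1}P_i$. Kra\'skiewicz insertion of a letter $a$: let $R$ be the first row.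 If $Ra$ is unimodal, append $a$ to $R$ and stop. Otherwise let $b$ be the smallest element of $R_\uparrow$ with $b\ge a$. If $a=0$ and $R$ contains $101$ as a subsequence, leave $R$ unchanged and insert $0$ into the next row. Otherwise: if $b\ne a$, put $a$ in $b$'s position, $c=b$; if $b=a$, leave $R_\uparrow$, $c=a+1$. Let $d$ be the largest element of $R_\downarrow$ with $d\le c$; if $d\ne c$ put $c$ in $d$'s place, $a'=d$; if $d=c$ leave $R_\downarrow$, $a'=c-1$. Insert $a'$ into the next row likewise. A signed primed tableau of shape $\lambda$ is a filling of $S(\lambda)$ with letters $1'<1<2'<\dots<m'<m$, weakly increasing along rows and columns, with at most one $i'$ per row and one $i$ per column for each $i$. Primed Kra\'skiewicz insertion $\mathrm{KR}'(\boldsymbol A)=(P,T)$: from $(\emptyset,\emptyset)$, for $i=1,\dots,m$ insert the letters of $\boldsymbol a_i$ left to right into $P$ by Kra\'skiewicz insertion; let $(x_1,y_1),\dots,(x_r,y_r)$ be the new boxes (row, column) in order of creation; there is $k$ with $x_1<\dots<x_k\ge\dots\ge x_r$ and $y_1\ge\dots\ge y_k<\dots<y_r$; add to $T$ boxes $(x_1,y_1),\dots,(x_{k-1},y_{k-1})$ filled with $i'$, $(x_{k+1},y_{k+1}),\dots,(x_r,y_r)$ filled with $i$, and $(x_k,y_k)$ filled with $i'$ if $s_i=-$, $i$ if $s_i=+$. $\mathrm{KR}'$ is a bijection from $U_m^\pm(w)$ onto pairs (standard decomposition tableau of $w$, signed primed tableau) of the same shape. Odd operator: $\tilde e_{\bar1}^F=\mathrm{KR}'^{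 -1}\circ(\mathrm{Id},\tilde e_{\bar1}^{\pm P})\circ\mathrm{KR}'$, where $\tilde e_{\bar1}^{\pm P}T=\mathrm{PR}\circ\tilde e_{\bar1}^P\circ\mathrm{DPR}(T)$ with $\mathrm{DPR}$ removing primes on the main diagonal and $\mathrm{PR}$ restoring them at the same diagonal positions, and $\tilde e_{\bar1}^PT=P_{HM}(\tilde e_{\bar1}\mathrm{HM}^{ -1}(T,Q_\lambda))$ for any fixed standard shifted Young tableau $Q_\lambda$ of shape $\lambda$ (independent of $Q_\lambda$; $\mathbf0$ maps to $\mathbf 0$). Here $\mathrm{HM}$ is semistandard shifted mixed insertion of a word over $\{1,\dots,m\}$: insert $x$ into the first row bumping the leftmost entry strictly greater than $x$ (or append $x$ and stop); a bumped off-diagonal unprimed entry is inserted into the next row in the same way, a bumped off-diagonal primed entry is inserted into the next column to the right bumping the topmost entry strictly greater (or appended at the bottom), a bumped diagonal entry $a$ becomes $a'$ and is inserted into the column to the right; the recording tableau stores the step number in the new box; $\mathrm{HM}(\boldsymbol b)=(P_{HM}(\boldsymbol b),Q)$ is a bijection onto pairs (primed tableau, standard shifted tableau) of equal shape, where a primed tableau is a signed primed tableau with no primes on the main diagonal. On words, $\tilde e_{\bar1}$ changes the leftmost $2$ to $1$ if no $1$ precedes it, and is $\mathbf0$ if there is no $2$ or a $1$ precedes the leftmost $2$. -}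

module Defs where

open import Data.Nat using (ℕ; zero; suc; _+_; _*_; _∸_; _≤_; _<_; _>_; _≡ᵇ_; _<ᵇ_; _≤ᵇ_)
open import Data.Bool using (Bool; true; false; if_then_else_; _∧_; _∨_; not)
open import Data.Integer as ℤ using (ℤ; +_)
open import Data.List using (List; []; _∷_; _++_; _∷ʳ_; length; take; drop; foldl; map; concatMap; upTo)
open import Data.List.Relation.Unary.All using (All)
open import Data.List.Relation.Unary.Linked using (Linked)
open import Data.Maybe using (Maybe; just; nothing; fromMaybe)
open import Data.Product using (Σ; _×_; _,_; proj₁; proj₂)
open import Data.Sum using (_⊎_)
open import Relation.Binary.PropositionalEquality using (_≡_; _≢_)

-- Type B Coxeter group W_B^n as signed permutations in one-line notation
-- (a list [w(1),...,w(n)] of integers).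

-- right multiplication by s_i:  s_0 negates the first entry,
-- s_i (i ≥ 1) swaps positions i and i+1 (1-indexed).
swapAt : ℕ → List ℤ → List ℤ
swapAt zero    (x ∷ y ∷ xs) = y ∷ x ∷ xs
swapAt zero    xs           = xs
swapAt (suc i) (x ∷ xs)     = x ∷ swapAt i xs
swapAt (suc i) []           = []

applyGen : ℕ → List ℤ → List ℤ
applyGen zero    []       = []
applyGen zero    (x ∷ xs) = ℤ.- x ∷ xs
applyGen (suc i) xs       = swapAt i xs

identityB : ℕ → List ℤ
identityB n = map (λ k → + suc k) (upTo n)

evalWord : ℕ → List ℕ → List ℤ
evalWord n a = foldl (λ u i → applyGen i u) (identityB n) a

IsReducedWord : ℕ → List ℤ → List ℕ → Set
IsReducedWord n w a =
  All (_< n) a × evalWord n a ≡ w ×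
  ((b : List ℕ) → All (_< n) b → evalWord n b ≡ w → length a ≤ length b)

Unimodal : List ℕ → Set
Unimodal a = Σ ℕ λ k → k ≤ length a × Linked _>_ (take k a) × Linked _<_ (drop (k ∸ 1) a)

-- boolean version used inside the insertion algorithms:
-- split into R↓ (longest strictly decreasing prefix, containing the minimum) and R↑
decPartGo : ℕ → List ℕ → List ℕ × List ℕ
decPartGo x []       = x ∷ [] , []
decPartGo x (y ∷ xs) =
  if y <ᵇ x then (x ∷ proj₁ (decPartGo y xs) , proj₂ (decPartGo y xs))
  else (x ∷ [] , y ∷ xs)

decPart : List ℕ → List ℕ × List ℕ
decPart []       = [] , []
decPart (x ∷ xs) = decPartGo x xs

incᵇ : List ℕ → Bool
incᵇ []           = true
incᵇ (x ∷ [])     = true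
incᵇ (x ∷ y ∷ xs) = (x <ᵇ y) ∧ incᵇ (y ∷ xs)

lastL : List ℕ → List ℕ
lastL []           = []
lastL (x ∷ [])     = x ∷ []
lastL (x ∷ y ∷ xs) = lastL (y ∷ xs)

unimodalᵇ : List ℕ → Bool
unimodalᵇ a = let (d , u) = decPart a in incᵇ (lastL d ++ u)

data Sign : Set where
  szero splus sminus : Sign

Factor : Set
Factor = Sign × List ℕ

ValidFactor : Factor → Set
ValidFactor (s , a) = Unimodal a × ((a ≡ [] × s ≡ szero) ⊎ (a ≢ [] × s ≢ szero))

InU : ℕ → List ℤ → ℕ → List Factor → Set
InU n w m A = length A ≡ m × All ValidFactor A × IsReducedWord n w (concatMap proj₂ A)

-- generic list helpers (rows are 0-indexed internally)

nth : {A : Set} → List A → ℕ → Maybe A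
nth []       _       = nothing
nth (x ∷ xs) zero    = just x
nth (x ∷ xs) (suc i) = nth xs i

setNth : {A : Set} → List A → ℕ → A → List A
setNth []       _       _ = []
setNth (x ∷ xs) zero    a = a ∷ xs
setNth (x ∷ xs) (suc i) a = x ∷ setNth xs i a

appendRow : {A : Set} → List (List A) → ℕ → A → List (List A)
appendRow []       zero    a = (a ∷ []) ∷ []
appendRow []       (suc r) a = [] ∷ appendRow [] r a
appendRow (R ∷ Rs) zero    a = (R ∷ʳ a) ∷ Rs
appendRow (R ∷ Rs) (suc r) a = R ∷ appendRow Rs r a

rowAt : {A : Set} → List (List A) → ℕ → List A
rowAt T r = fromMaybe [] (nth T r)

replaceAt : {A : Set} → List (List A) → ℕ → ℕ → A → List (List A)
replaceAt T r j a = setNth T r (setNth (rowAt T r) j a)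

-- Kraśkiewicz insertion.  Tableau P = list of rows P_1, P_2, ...
-- (row i occupies columns i .. i+|P_i|-1 of the shifted diagram).

subseqᵇ : List ℕ → List ℕ → Bool
subseqᵇ []       _        = true
subseqᵇ (p ∷ ps) []       = false
subseqᵇ (p ∷ ps) (x ∷ xs) = if p ≡ᵇ x then subseqᵇ ps xs else subseqᵇ (p ∷ ps) xs

-- in R↑ (increasing): b = smallest element ≥ a.  Returns (new R↑, c).
bumpUp : List ℕ → ℕ → List ℕ × ℕ
bumpUp []       a = [] , suc a      -- not reached for reduced words
bumpUp (b ∷ bs) a with a ≤ᵇ b
... | true  = if b ≡ᵇ a then (b ∷ bs , suc a) else (a ∷ bs , b)
... | false = let (bs' , c) = bumpUp bs a in (b ∷ bs' , c)

-- in R↓ (decreasing): d = largest element ≤ c.  Returns (new R↓, a').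
bumpDown : List ℕ → ℕ → List ℕ × ℕ
bumpDown []       c = [] , c         -- not reached for reduced words
bumpDown (d ∷ ds) c with d ≤ᵇ c
... | true  = if d ≡ᵇ c then (d ∷ ds , c ∸ 1) else (c ∷ ds , d)
... | false = let (ds' , a') = bumpDown ds c in (d ∷ ds' , a')

bumpRow : List ℕ → ℕ → List ℕ × ℕ
bumpRow R a =
  let (d , u)   = decPart R
      (u' , c)  = bumpUp u a
      (d' , a') = bumpDown d c
  in (d' ++ u' , a')

-- returns the new tableau and the (0-indexed) row of the new box
krIns : List (List ℕ) → ℕ → List (List ℕ) × ℕ
krIns []       a = (a ∷ []) ∷ [] , 0
krIns (R ∷ Rs) a with unimodalᵇ (R ∷ʳ a)
... | true  = (R ∷ʳ a) ∷ Rs , 0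
... | false with (a ≡ᵇ 0) ∧ subseqᵇ (1 ∷ 0 ∷ 1 ∷ []) R
...   | true  = let (Rs' , r) = krIns Rs 0 in (R ∷ Rs' , suc r)
...   | false = let (R' , a') = bumpRow R a
                    (Rs' , r) = krIns Rs a'
                in (R' ∷ Rs' , suc r)

krInsWord : List (List ℕ) → List ℕ → List (List ℕ) × List ℕ
krInsWord P []       = P , []
krInsWord P (a ∷ as) =
  let (P₁ , r)  = krIns P a
      (P₂ , rs) = krInsWord P₁ as
  in (P₂ , r ∷ rs)

-- Primed letters 1' < 1 < 2' < 2 < ...

data PL : Set where
  primed plain : ℕ → PL

code : PL → ℕ
code (primed i) = 2 * i
code (plain i)  = suc (2 * i)

prime : PL → PL
prime (primed i) = primed i
prime (plain i)  = primed i

unprime : PL → PL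
unprime (primed i) = plain i
unprime (plain i)  = plain i

isPrimed : PL → Bool
isPrimed (primed _) = true
isPrimed (plain _)  = false

Tab : Set
Tab = List (List PL)

incPrefixLen : List ℕ → ℕ
incPrefixLen []           = 0
incPrefixLen (x ∷ [])     = 1
incPrefixLen (x ∷ y ∷ ys) = if x <ᵇ y then suc (incPrefixLen (y ∷ ys)) else 1

signLabel : ℕ → Sign → PL
signLabel i sminus = primed i
signLabel i splus  = plain i
signLabel i szero  = plain i   -- not reached: factor with sign 0 is empty

mkLabels : ℕ → Sign → ℕ → ℕ → List ℕ → List PL
mkLabels i s k pos []       = []
mkLabels i s k pos (_ ∷ xs) =
  (if pos <ᵇ k then primed i else if pos ≡ᵇ k then signLabel i s else plain i)
  ∷ mkLabels i s k (suc pos) xs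

addLabels : Tab → List PL → List ℕ → Tab
addLabels T (l ∷ ls) (x ∷ xs) = addLabels (appendRow T x l) ls xs
addLabels T _        _        = T

KR'go : ℕ → List Factor → List (List ℕ) × Tab → List (List ℕ) × Tab
KR'go i []             st      = st
KR'go i ((s , a) ∷ fs) (P , T) =
  let (P' , xs) = krInsWord P a
  in KR'go (suc i) fs (P' , addLabels T (mkLabels i s (incPrefixLen xs) 1 xs) xs)

KR' : List Factor → List (List ℕ) × Tab
KR' A = KR'go 1 A ([] , [])

-- Semistandard shifted mixed insertion HM (as an inductive relation).
-- rows/columns 0-indexed; row r occupies columns r .. r+|row r|-1.

firstGreater : List PL → PL → Maybe ℕ
firstGreater []       y = nothing
firstGreater (e ∷ es) y with code y <ᵇ code e
... | true  = just 0
... | false = Data.Maybe.map suc (firstGreater es y)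

colGo : Tab → ℕ → ℕ → List PL
colGo []       i c = []
colGo (R ∷ Rs) i c with i ≤ᵇ c
... | false = []
... | true with nth R (c ∸ i)
...   | just e  = e ∷ colGo Rs (suc i) c
...   | nothing = []

colEntries : Tab → ℕ → List PL
colEntries T c = colGo T 0 c

mutual
  data RowIns : Tab → ℕ → PL → Tab → Set where
    rowApp  : ∀ {T r y} → firstGreater (rowAt T r) y ≡ nothing → r ≤ length T →
              RowIns T r y (appendRow T r y)
    rowDiag : ∀ {T r y z T'} → firstGreater (rowAt T r) y ≡ just 0 →
              nth (rowAt T r) 0 ≡ just z →
              ColIns (replaceAt T r 0 y) (suc r) (prime z) T' → RowIns T r y T'
    rowUn   : ∀ {T r y j v T'} → firstGreater (rowAt T r) y ≡ just (suc j) →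
              nth (rowAt T r) (suc j) ≡ just (plain v) →
              RowIns (replaceAt T r (suc j) y) (suc r) (plain v) T' → RowIns T r y T'
    rowPr   : ∀ {T r y j v T'} → firstGreater (rowAt T r) y ≡ just (suc j) →
              nth (rowAt T r) (suc j) ≡ just (primed v) →
              ColIns (replaceAt T r (suc j) y) (suc (r + suc j)) (primed v) T' → RowIns T r y T'

  data ColIns : Tab → ℕ → PL → Tab → Set where
    colApp  : ∀ {T c y h} → firstGreater (colEntries T c) y ≡ nothing →
              length (colEntries T c) ≡ h → h ≤ length T → h + length (rowAt T h) ≡ c →
              ColIns T c y (appendRow T h y)
    colDiag : ∀ {T c y i z T'} → firstGreater (colEntries T c) y ≡ just i → i ≡ c →
              nth (colEntries T c) i ≡ just z →
              ColIns (replaceAt T i (c ∸ i) y) (suc c) (prime z) T' → ColIns T c y T'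
    colUn   : ∀ {T c y i v T'} → firstGreater (colEntries T c) y ≡ just i → i ≢ c →
              nth (colEntries T c) i ≡ just (plain v) →
              RowIns (replaceAt T i (c ∸ i) y) (suc i) (plain v) T' → ColIns T c y T'
    colPr   : ∀ {T c y i v T'} → firstGreater (colEntries T c) y ≡ just i → i ≢ c →
              nth (colEntries T c) i ≡ just (primed v) →
              ColIns (replaceAt T i (c ∸ i) y) (suc c) (primed v) T' → ColIns T c y T'

-- HMfrom T b T' : inserting the word b (letters 1..m) into T gives T'.
-- P_HM(b) = T  iff  HMfrom [] b T.
data HMfrom : Tab → List ℕ → Tab → Set where
  hmDone : ∀ {T} → HMfrom T [] T
  hmStep : ∀ {T x xs T' T''} → RowIns T 0 (plain x) T' → HMfrom T' xs T'' → HMfrom T (x ∷ xs) T''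

eOdd : List ℕ → Maybe (List ℕ)
eOdd []       = nothing
eOdd (x ∷ xs) =
  if x ≡ᵇ 1 then nothing
  else if x ≡ᵇ 2 then just (1 ∷ xs)
  else Data.Maybe.map (x ∷_) (eOdd xs)

-- DPR: remove primes on the main diagonal (first entry of each row)
DPR : Tab → Tab
DPR = map λ { [] → [] ; (e ∷ es) → unprime e ∷ es }

headPrimed : List PL → Bool
headPrimed []      = false
headPrimed (d ∷ _) = isPrimed d

PR : Tab → Tab → Tab
PR (R ∷ Rs) ((e ∷ es) ∷ Rs') = ((if headPrimed R then prime e else e) ∷ es) ∷ PR Rs Rs'
PR _ T' = T'

-- ẽ^F_{1bar} A ≡ res, as a relation (res = nothing means 𝟎).
-- ẽ^{±P} T = PR(P_HM(ẽ_{1bar} b)) where b = HM^{-1}(DPR T, Q) for a standard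
-- shifted tableau Q (result independent of Q), and ẽ^F = KR'^{-1} ∘ (Id, ẽ^{±P}) ∘ KR'.
data EF (n : ℕ) (w : List ℤ) (m : ℕ) (A : List Factor) : Maybe (List Factor) → Set where
  isZero : (b : List ℕ) → HMfrom [] b (DPR (proj₂ (KR' A))) → eOdd b ≡ nothing →
           EF n w m A nothing
  isJust : (B : List Factor) (b b' : List ℕ) (T' : Tab) →
           HMfrom [] b (DPR (proj₂ (KR' A))) → eOdd b ≡ just b' → HMfrom [] b' T' →
           InU n w m B →
           KR' B ≡ (proj₁ (KR' A) , PR (proj₂ (KR' A)) T') →
           EF n w m A (just B)

newSign₁ : List ℕ → Sign → Sign → Sign
newSign₁ []      s₁ s₂ = s₂
newSign₁ (_ ∷ _) s₁ s₂ = s₁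

newSign₂ : List ℕ → Sign
newSign₂ []      = szero
newSign₂ (_ ∷ _) = splus

{-# OPTIONS --safe #-}

-- Removing the primes of the diagonal, the odd operator on words changes the recording tableau in
-- one entry of its first row: 2 at the head becomes 1, or a 2′ after at least one 1 becomes 1. This
-- is seen by inserting b and ẽ b side by side: from the changed letter on, the two tableaux differ in
-- that single entry, which no later bump touches without moving the 2′ one box to the right.
-- Every tableau is some P_HM(b), because mixed insertion can be undone box by box.
--
-- It remains to locate the 2′ in the first row of the recording tableau of KR′.  The first factor
-- fills the first row; the boxes of the second one lie in rows x₁ < … < x_k ≥ … ≥ x_r, so the first
-- row contains a 2′ beyond the first factor only if the first letter x of a₂ is appended to the first
-- row, that is if a₁x is unimodal, and then this letter joins the first factor.
--
-- The rows of the boxes are controlled row by row: a bump preserves the group element, the letters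
-- bumped out of a row by a unimodal word form a unimodal word, and the appended letters are at most
-- the first one and a final segment.  That the shapes are strict partitions follows from an invariant
-- of consecutive rows that counts the entries above and below a given value.
module Submission where

open import Defs
open import Data.Nat
open import Data.Nat.Properties
open import Data.Integer using (ℤ)
import Data.Integer.Properties as ℤ
open import Data.Bool using (Bool; true; false; _∧_; if_then_else_)
open import Data.Bool.Properties using (T-≡)
open import Data.List
  using (List; []; _∷_; _++_; _∷ʳ_; length; map; foldl; concatMap; take; drop; replicate; upTo; initLast; _∷ʳ′_)
open import Data.List.Properties
open import Data.List.Relation.Unary.All as All using (All; []; _∷_)
import Data.List.Relation.Unary.All.Properties as All
open import Data.List.Relation.Unary.Any as Any using (Any; here; there; any?)
import Data.List.Relation.Unary.Any.Properties as Any
open import Data.List.Relation.Unary.AllPairs as AllPairs using (AllPairs; []; _∷_)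
import Data.List.Relation.Unary.AllPairs.Properties as AllPairs
open import Data.List.Relation.Unary.Linked using (Linked; []; [-]; _∷_)
open import Data.List.Membership.Propositional using (_∈_; find)
open import Data.List.Membership.Propositional.Properties using (∈-++⁺ˡ; ∈-++⁺ʳ; ∈-++⁻)
open import Data.Maybe as Maybe using (Maybe; just; nothing; fromMaybe)
open import Data.Maybe.Properties using (just-injective)
open import Data.Product using (∃; ∃₂; _×_; _,_; proj₁; proj₂)
open import Data.Sum as Sum using (_⊎_; inj₁; inj₂; [_,_]′)
open import Data.Empty using (⊥-elim)
open import Data.Unit using (⊤; tt)
open import Function using (_∘_; Equivalence)
open import Relation.Nullary using (¬_; yes; no; contradiction)
open import Relation.Binary using (tri<; tri≈; tri>)
open import Relation.Binary.PropositionalEquality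

-- Coxeter relations of type B

-- Reducedness enters only as `Red`: no sequence of the moves below leads to two equal adjacent
-- letters. In this form it passes to factors and along moves, so every row receives it for the
-- letters bumped into it. It supplies the neighbours `suc a` and `c ∸ 1` that a keeping bump
-- requires, and it separates consecutive bumped letters.
--
-- The obstacle is the shape. Mixed insertion is undone on genuine shifted tableaux, so the boxes
-- recorded by `KR'` must be shown to form a strict partition. Maximality of a row among the
-- unimodal subwords of two rows speaks about all subwords; `▹` replaces it by inequalities between
-- counts, whose change under a bump can be computed.
--
-- The inverse of `KR'` is never evaluated: the claimed result is inserted too, and both recording
-- tableaux are followed in parallel, by the scheme that also serves for mixed insertion: two first
-- rows with different small prefixes and a common remainder. The threshold 5 is the code of the
-- letter 2 (`1`, `2'`, `2`, `3'` have codes 3, 4, 5, 6).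

Far : ℕ → ℕ → Set
Far i j = 2 + i ≤ j ⊎ 2 + j ≤ i

Far-sym : ∀ {i j} → Far i j → Far j i
Far-sym = Sum.swap

infix 4 _~_

-- A single direction of each relation is included only where the other one is never needed.
data _~_ : List ℕ → List ℕ → Set where
  ~refl   : ∀ {a} → a ~ a
  ~trans  : ∀ {a b c} → a ~ b → b ~ c → a ~ c
  ~cons   : ∀ x {a b} → a ~ b → x ∷ a ~ x ∷ b
  ~far    : ∀ {i j} q → Far i j → i ∷ j ∷ q ~ j ∷ i ∷ q
  ~braid↑ : ∀ i q → suc i ∷ suc (suc i) ∷ suc i ∷ q ~ suc (suc i) ∷ suc i ∷ suc (suc i) ∷ q
  ~braid↓ : ∀ i q → suc (suc i) ∷ suc i ∷ suc (suc i) ∷ q ~ suc i ∷ suc (suc i) ∷ suc i ∷ q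
  ~quad   : ∀ q → 1 ∷ 0 ∷ 1 ∷ 0 ∷ q ~ 0 ∷ 1 ∷ 0 ∷ 1 ∷ q

~reflexive : ∀ {a b} → a ≡ b → a ~ b
~reflexive refl = ~refl

~++ˡ : ∀ p {a b} → a ~ b → p ++ a ~ p ++ b
~++ˡ []      r = r
~++ˡ (x ∷ p) r = ~cons x (~++ˡ p r)

~++ʳ : ∀ {a b} c → a ~ b → a ++ c ~ b ++ c
~++ʳ c ~refl         = ~refl
~++ʳ c (~trans r s)  = ~trans (~++ʳ c r) (~++ʳ c s)
~++ʳ c (~cons x r)   = ~cons x (~++ʳ c r)
~++ʳ c (~far q f)    = ~far (q ++ c) f
~++ʳ c (~braid↑ i q) = ~braid↑ i (q ++ c)
~++ʳ c (~braid↓ i q) = ~braid↓ i (q ++ c)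
~++ʳ c (~quad q)     = ~quad (q ++ c)

~moveˡ : ∀ {i} xs q → All (Far i) xs → xs ++ i ∷ q ~ i ∷ xs ++ q
~moveˡ []       q []       = ~refl
~moveˡ (x ∷ xs) q (f ∷ fs) = ~trans (~cons x (~moveˡ xs q fs)) (~far (xs ++ q) (Far-sym f))

~move-last : ∀ {i} xs → All (Far i) xs → xs ∷ʳ i ~ i ∷ xs
~move-last {i} xs fs = ~trans (~moveˡ xs [] fs) (~reflexive (cong (i ∷_) (++-identityʳ xs)))

act : List ℤ → ℕ → List ℤ
act u i = applyGen i u

swapAt-length : ∀ i u → length (swapAt i u) ≡ length u
swapAt-length zero    []          = refl
swapAt-length zero    (x ∷ [])    = refl
swapAt-length zero    (x ∷ y ∷ u) = refl
swapAt-length (suc i) []          = refl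
swapAt-length (suc i) (x ∷ u)     = cong suc (swapAt-length i u)

act-length : ∀ i u → length (act u i) ≡ length u
act-length zero    []      = refl
act-length zero    (x ∷ u) = refl
act-length (suc i) u       = swapAt-length i u

swapAt-involutive : ∀ i u → swapAt i (swapAt i u) ≡ u
swapAt-involutive zero    []          = refl
swapAt-involutive zero    (x ∷ [])    = refl
swapAt-involutive zero    (x ∷ y ∷ u) = refl
swapAt-involutive (suc i) []          = refl
swapAt-involutive (suc i) (x ∷ u)     = cong (x ∷_) (swapAt-involutive i u)

act-involutive : ∀ i u → act (act u i) i ≡ u
act-involutive zero    []      = refl
act-involutive zero    (x ∷ u) = cong (_∷ u) (ℤ.neg-involutive x)
act-involutive (suc i) u       = swapAt-involutive i u

swapAt-far : ∀ i j u → 2 + i ≤ j → swapAt i (swapAt j u) ≡ swapAt j (swapAt i u)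
swapAt-far zero    (suc (suc j)) []          _ = refl
swapAt-far zero    (suc (suc j)) (x ∷ [])    _ = refl
swapAt-far zero    (suc (suc j)) (x ∷ y ∷ u) _ = refl
swapAt-far (suc i) (suc j)       []          _ = refl
swapAt-far (suc i) (suc j)       (x ∷ u)     p = cong (x ∷_) (swapAt-far i j u (s≤s⁻¹ p))
swapAt-far zero    (suc zero)    u           (s≤s ())

act-far : ∀ i j u → 2 + i ≤ j → act (act u i) j ≡ act (act u j) i
act-far zero    (suc (suc j)) []      _ = refl
act-far zero    (suc (suc j)) (x ∷ u) _ = refl
act-far zero    (suc zero)    u       (s≤s ())
act-far (suc i) (suc j)       u       p = sym (swapAt-far i j u (s≤s⁻¹ p))

swapAt-braid : ∀ i u → 3 + i ≤ length u →
  swapAt i (swapAt (suc i) (swapAt i u)) ≡ swapAt (suc i) (swapAt i (swapAt (suc i) u))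
swapAt-braid zero    (x ∷ y ∷ z ∷ u) _ = refl
swapAt-braid zero    (x ∷ [])        (s≤s ())
swapAt-braid zero    (x ∷ y ∷ [])    (s≤s (s≤s ()))
swapAt-braid (suc i) (x ∷ u)         p = cong (x ∷_) (swapAt-braid i u (s≤s⁻¹ p))

act-quad : ∀ u → 2 ≤ length u →
  act (act (act (act u 1) 0) 1) 0 ≡ act (act (act (act u 0) 1) 0) 1
act-quad (x ∷ y ∷ u) _ = refl
act-quad (x ∷ [])    (s≤s ())

-- Out of range `applyGen` is the identity, and a braid relation with one generator out of range
-- fails. The bound on the letters is therefore carried along with the equality of the actions.
~-eval : ∀ {n a b} → a ~ b → All (_< n) a →
  All (_< n) b × (∀ u → length u ≡ n → foldl act u a ≡ foldl act u b)
~-eval ~refl bd = bd , λ _ _ → refl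
~-eval (~trans r s) bd with ~-eval r bd
... | bd′ , f with ~-eval s bd′
... | bd″ , g = bd″ , λ u l → trans (f u l) (g u l)
~-eval (~cons x r) (px ∷ bd) with ~-eval r bd
... | bd′ , f = px ∷ bd′ , λ u l → f (act u x) (trans (act-length x u) l)
~-eval (~far {i} {j} q f) (pi ∷ pj ∷ bd) = pj ∷ pi ∷ bd , λ u _ → cong (λ v → foldl act v q) (go f u)
  where
  go : Far i j → ∀ u → act (act u i) j ≡ act (act u j) i
  go (inj₁ p) u = act-far i j u p
  go (inj₂ p) u = sym (act-far j i u p)
-- The letter `suc i` acts as `swapAt i`, so the bound on the larger letter, `suc (suc i) < n`, is
-- exactly the length `3 + i` that `swapAt-braid` asks for.
~-eval (~braid↑ i q) (p ∷ p′ ∷ _ ∷ bd) = p′ ∷ p ∷ p′ ∷ bd , λ u l →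
  cong (λ v → foldl act v q) (swapAt-braid i u (subst (3 + i ≤_) (sym l) p′))
~-eval (~braid↓ i q) (p′ ∷ p ∷ _ ∷ bd) = p ∷ p′ ∷ p ∷ bd , λ u l →
  cong (λ v → foldl act v q) (sym (swapAt-braid i u (subst (3 + i ≤_) (sym l) p′)))
~-eval (~quad q) (p₁ ∷ p₀ ∷ _ ∷ _ ∷ bd) = p₀ ∷ p₁ ∷ p₀ ∷ p₁ ∷ bd , λ u l →
  cong (λ v → foldl act v q) (act-quad u (subst (2 ≤_) (sym l) p₁))

~-length : ∀ {a b} → a ~ b → length a ≡ length b
~-length ~refl         = refl
~-length (~trans r s)  = trans (~-length r) (~-length s)
~-length (~cons x r)   = cong suc (~-length r)
~-length (~far q f)    = refl
~-length (~braid↑ i q) = refl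
~-length (~braid↓ i q) = refl
~-length (~quad q)     = refl

-- Words from which no square can be reached

Red : List ℕ → Set
Red w = ∀ p i q → ¬ (w ~ p ++ i ∷ i ∷ q)

Red-~ : ∀ {a b} → a ~ b → Red a → Red b
Red-~ r red p i q s = red p i q (~trans r s)

Red-++ʳ : ∀ x {y} → Red (x ++ y) → Red y
Red-++ʳ x red p i q s = red (x ++ p) i q
  (~trans (~++ˡ x s) (~reflexive (sym (++-assoc x p (i ∷ i ∷ q)))))

Red-++ˡ : ∀ {x} y → Red (x ++ y) → Red x
Red-++ˡ y red p i q s = red p i (q ++ y)
  (~trans (~++ʳ y s) (~reflexive (++-assoc p (i ∷ i ∷ q) y)))

-- Generators are involutions and moves keep the length, so deleting a square reached by moves would
-- leave a shorter word of the same group element.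
reduced⇒Red : ∀ {n w a} → IsReducedWord n w a → Red a
reduced⇒Red {n} {w} {a} (bd , ev , minimal) p i q r =
  <⇒≱ shorter (minimal (p ++ q) bd′ ev′)
  where
  bdE : All (_< n) (p ++ i ∷ i ∷ q)
  bdE = proj₁ (~-eval r bd)
  bd′ : All (_< n) (p ++ q)
  bd′ = All.++⁺ (All.++⁻ˡ p bdE) (All.tail (All.tail (All.++⁻ʳ p bdE)))
  idLen : length (identityB n) ≡ n
  idLen = trans (length-map _ (upTo n)) (length-upTo n)
  ev′ : evalWord n (p ++ q) ≡ w
  ev′ = begin
    foldl act (identityB n) (p ++ q)
      ≡⟨ foldl-++ act (identityB n) p q ⟩
    foldl act (foldl act (identityB n) p) q
      ≡⟨ cong (λ v → foldl act v q) (act-involutive i _) ⟨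
    foldl act (foldl act (identityB n) p) (i ∷ i ∷ q)
      ≡⟨ foldl-++ act (identityB n) p (i ∷ i ∷ q) ⟨
    foldl act (identityB n) (p ++ i ∷ i ∷ q)
      ≡⟨ proj₂ (~-eval r bd) (identityB n) idLen ⟨
    foldl act (identityB n) a
      ≡⟨ ev ⟩
    w ∎
    where open ≡-Reasoning
  shorter : length (p ++ q) < length a
  shorter = begin-strict
    length (p ++ q)            ≡⟨ length-++ p ⟩
    length p + length q        <⟨ +-monoʳ-< (length p) (m<n+m (length q) {2} z<s) ⟩
    length p + (2 + length q)  ≡⟨ length-++ p ⟨
    length (p ++ i ∷ i ∷ q)    ≡⟨ ~-length r ⟨
    length a                   ∎
    where open ≤-Reasoning

-- Boolean comparisons

<ᵇ-true : ∀ {m n} → m < n → (m <ᵇ n) ≡ true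
<ᵇ-true p = Equivalence.to T-≡ (<⇒<ᵇ p)

<ᵇ-false : ∀ {m n} → n ≤ m → (m <ᵇ n) ≡ false
<ᵇ-false {m} {n} p with m <ᵇ n in eq
... | false = refl
... | true  = contradiction p (<⇒≱ (<ᵇ⇒< m n (Equivalence.from T-≡ eq)))

≤ᵇ-true : ∀ {m n} → m ≤ n → (m ≤ᵇ n) ≡ true
≤ᵇ-true p = Equivalence.to T-≡ (≤⇒≤ᵇ p)

≤ᵇ-false : ∀ {m n} → n < m → (m ≤ᵇ n) ≡ false
≤ᵇ-false {suc m} p = <ᵇ-false (s≤s⁻¹ p)

≡ᵇ-true : ∀ m → (m ≡ᵇ m) ≡ true
≡ᵇ-true m = Equivalence.to T-≡ (≡⇒≡ᵇ m m refl)

≡ᵇ-false : ∀ {m n} → m ≢ n → (m ≡ᵇ n) ≡ false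
≡ᵇ-false {m} {n} p with m ≡ᵇ n in eq
... | false = refl
... | true  = contradiction (≡ᵇ⇒≡ m n (Equivalence.from T-≡ eq)) p

-- Unimodal rows

-- row E e U is the unimodal word E e U with minimum e, so that R↓ = E e and R↑ = U.
data Row : Set where
  row : List ℕ → ℕ → List ℕ → Row

word : Row → List ℕ
word (row E e U) = E ++ e ∷ U

data NF : Row → Set where
  nf : ∀ {E e U} → AllPairs _>_ E → All (e <_) E → All (e <_) U → AllPairs _<_ U → NF (row E e U)

-- The bump in `R↑`. `ukeep` asks for `suc a` right behind `a`: if it were missing, the inserted `a`
-- would commute back through the larger letters and meet the first `a`, against `Red`.
data UIns : List ℕ → ℕ → List ℕ → ℕ → Set where
  urep  : ∀ {a b U} → a < b → UIns (b ∷ U) a (a ∷ U) b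
  ukeep : ∀ {a U} → UIns (a ∷ suc a ∷ U) a (a ∷ suc a ∷ U) (suc a)
  unext : ∀ {a c x U U′} → x < a → UIns U a U′ c → UIns (x ∷ U) a (x ∷ U′) c

-- The bump in `R↓`. `dkeep` is limited to positive letters, where it is a braid. The pair 1, 0
-- obeys a relation of length four instead and is left to `s101`.
data DIns : List ℕ → ℕ → List ℕ → ℕ → Set where
  drep  : ∀ {c d D} → d < c → DIns (d ∷ D) c (c ∷ D) d
  dkeep : ∀ {y D} → DIns (suc (suc y) ∷ suc y ∷ D) (suc (suc y)) (suc (suc y) ∷ suc y ∷ D) (suc y)
  dnext : ∀ {c d x D D′} → c < x → DIns D c D′ d → DIns (x ∷ D) c (x ∷ D′) d

-- Kraśkiewicz bumps, sorted by where the minimum of the new row comes from: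
-- the inserted letter (inc₁), the head of the new R↑ (inc₂), or the old minimum (mid).
-- After inc₁ and inc₂ the bumped letters of a decreasing input increase.
data Step : Row → ℕ → Row → ℕ → Set where
  s101 : ∀ E U → Step (row (E ∷ʳ 1) 0 (1 ∷ U)) 0 (row (E ∷ʳ 1) 0 (1 ∷ U)) 0
  inc₁ : ∀ {E e c U a D d} → a ≤ e → All (a <_) D → DIns (E ∷ʳ e) c D d →
         Step (row E e (c ∷ U)) a (row D a U) d
  inc₂ : ∀ {E e U a c u U′} → e < a → All (c <_) E → UIns U a (u ∷ U′) c →
         Step (row E e U) a (row (E ∷ʳ c) u U′) e
  mid  : ∀ {E e U a c U′ E′ d} → e < a → Any (_≤ c) E → UIns U a U′ c →
         DIns (E ∷ʳ e) c (E′ ∷ʳ e) d →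
         Step (row E e U) a (row E′ e U′) d

data App : Row → ℕ → Row → Set where
  appUp : ∀ {E e U a} → All (_< a) (e ∷ U) → App (row E e U) a (row E e (U ∷ʳ a))
  appDn : ∀ {E e a} → a < e → App (row E e []) a (row (E ∷ʳ e) a [])

sorted-∷ʳ : ∀ {E e} → AllPairs _>_ E → All (e <_) E → AllPairs _>_ (E ∷ʳ e)
sorted-∷ʳ pE aE = AllPairs.++⁺ pE ([] ∷ []) (All.map (_∷ []) aE)

NF-dec : ∀ {E e U} → NF (row E e U) → AllPairs _>_ (E ∷ʳ e)
NF-dec (nf pE aE _ _) = sorted-∷ʳ pE aE

a<c : ∀ {U a U′ c} → UIns U a U′ c → a < c
a<c (urep p)    = p
a<c ukeep       = n<1+n _
a<c (unext _ i) = a<c i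

d<c : ∀ {D c D′ d} → DIns D c D′ d → d < c
d<c (drep p)    = p
d<c dkeep       = n<1+n _
d<c (dnext _ i) = d<c i

c∈U : ∀ {U a U′ c} → UIns U a U′ c → c ∈ U
c∈U (urep _)    = here refl
c∈U ukeep       = there (here refl)
c∈U (unext _ i) = there (c∈U i)

a∈U′ : ∀ {U a U′ c} → UIns U a U′ c → a ∈ U′
a∈U′ (urep _)    = here refl
a∈U′ ukeep       = here refl
a∈U′ (unext _ i) = there (a∈U′ i)

c∈D′ : ∀ {D c D′ d} → DIns D c D′ d → c ∈ D′
c∈D′ (drep _)    = here refl
c∈D′ dkeep       = here refl
c∈D′ (dnext _ i) = there (c∈D′ i)

d∈D : ∀ {D c D′ d} → DIns D c D′ d → d ∈ D
d∈D (drep _)    = here refl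
d∈D dkeep       = there (here refl)
d∈D (dnext _ i) = there (d∈D i)

UIns-All : ∀ {P : ℕ → Set} {U a U′ c} → UIns U a U′ c → P a → All P U → All P U′
UIns-All (urep _)    pa (_ ∷ ps)  = pa ∷ ps
UIns-All ukeep       pa ps        = ps
UIns-All (unext _ i) pa (px ∷ ps) = px ∷ UIns-All i pa ps

DIns-All : ∀ {P : ℕ → Set} {D c D′ d} → DIns D c D′ d → P c → All P D → All P D′
DIns-All (drep _)    pc (_ ∷ ps)  = pc ∷ ps
DIns-All dkeep       pc ps        = ps
DIns-All (dnext _ i) pc (px ∷ ps) = px ∷ DIns-All i pc ps

UIns-sorted : ∀ {U a U′ c} → UIns U a U′ c → AllPairs _<_ U → AllPairs _<_ U′
UIns-sorted (urep p)    (q ∷ s) = All.map (<-trans p) q ∷ s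
UIns-sorted ukeep       s       = s
UIns-sorted (unext p i) (q ∷ s) = UIns-All i p q ∷ UIns-sorted i s

DIns-sorted : ∀ {D c D′ d} → DIns D c D′ d → AllPairs _>_ D → AllPairs _>_ D′
DIns-sorted (drep p)    (q ∷ s) = All.map (λ r → <-trans r p) q ∷ s
DIns-sorted dkeep       s       = s
DIns-sorted (dnext p i) (q ∷ s) = DIns-All i p q ∷ DIns-sorted i s

AllPairs-∷ʳ⁻ : ∀ {R : ℕ → ℕ → Set} E {e} → AllPairs R (E ∷ʳ e) → AllPairs R E × All (λ x → R x e) E
AllPairs-∷ʳ⁻ []      _       = [] , []
AllPairs-∷ʳ⁻ (x ∷ E) (p ∷ s) with AllPairs-∷ʳ⁻ E s | All.∷ʳ⁻ p
... | s′ , q | p′ , r = p′ ∷ s′ , r ∷ q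

Step-NF : ∀ {R a R′ d} → NF R → Step R a R′ d → NF R′
Step-NF h (s101 _ _) = h
Step-NF h@(nf pE aE (e<c ∷ _) (c<U ∷ pU)) (inc₁ a≤e aD i) =
  nf (DIns-sorted i (NF-dec h)) aD
     (All.map (<-trans (≤-<-trans a≤e e<c)) c<U) pU
Step-NF (nf pE aE aU pU) (inc₂ e<a cE i) with UIns-sorted i pU
... | u< ∷ pU′ = nf (sorted-∷ʳ pE cE) (All.∷ʳ⁺ (All.map (<-trans u<c) cE) u<c) u< pU′
  where
  head≤ : ∀ {U a u U′ c} → UIns U a (u ∷ U′) c → u ≤ a
  head≤ (urep _)    = ≤-refl
  head≤ ukeep       = ≤-refl
  head≤ (unext p _) = <⇒≤ p
  u<c = ≤-<-trans (head≤ i) (a<c i)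
Step-NF h@(nf pE aE aU pU) (mid e<a _ i j) with AllPairs-∷ʳ⁻ _ (DIns-sorted j (NF-dec h))
... | pE′ , aE′ = nf pE′ aE′ (UIns-All i e<a aU) (UIns-sorted i pU)

App-NF : ∀ {R a R′} → NF R → App R a R′ → NF R′
App-NF (nf pE aE aU pU) (appUp (e<a ∷ U<a)) =
  nf pE aE (All.∷ʳ⁺ aU e<a) (AllPairs.++⁺ pU ([] ∷ []) (All.map (_∷ []) U<a))
App-NF h@(nf pE aE aU pU) (appDn a<e) = nf (NF-dec h) (All.∷ʳ⁺ (All.map (<-trans a<e) aE) a<e) [] []

App-word : ∀ {R a R′} → App R a R′ → word R′ ≡ word R ∷ʳ a
App-word (appUp {E} {e} {U} {a} _) = sym (++-assoc E (e ∷ U) (a ∷ []))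
App-word (appDn {E} {e} {a} _)     = refl

far-> : ∀ {x y z} → x < y → y < z → Far x z
far-> p q = inj₁ (≤-trans (s≤s p) q)

far-< : ∀ {x y z} → x < y → y < z → Far z x
far-< p q = inj₂ (≤-trans (s≤s p) q)

-- The inserted letter commutes leftwards to its place, and the displaced one from there to the
-- front. `ukeep` costs one braid, which is available only between positive letters; hence `0 < a`.
UIns-~ : ∀ {U a U′ c} → 0 < a → UIns U a U′ c → AllPairs _<_ U → U ∷ʳ a ~ c ∷ U′
UIns-~ {a = a} _ (urep {b = b} {U} a<b) (b<U ∷ _) =
  ~cons b (~move-last U (All.map (far-> a<b) b<U))
UIns-~ {a = suc a} _ (ukeep {U = U}) ((_ ∷ _) ∷ (<U ∷ _)) =
  ~trans (~cons _ (~cons _ (~move-last U (All.map (far-> (n<1+n _)) <U))))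
         (~braid↑ a U)
UIns-~ 0<a (unext {x = x} {U} {U′} x<a i) (_ ∷ s) =
  ~trans (~cons x (UIns-~ 0<a i s)) (~far U′ (far-> x<a (a<c i)))

DIns-~ : ∀ {D c D′ d} → DIns D c D′ d → AllPairs _>_ D → D ∷ʳ c ~ d ∷ D′
DIns-~ (drep {c} {d} {D} d<c) (D<d ∷ _) =
  ~cons d (~move-last D (All.map (λ p → far-< p d<c) D<d))
DIns-~ (dkeep {y} {D}) (_ ∷ (D<y ∷ _)) =
  ~trans (~cons _ (~cons _ (~move-last D (All.map (λ p → far-< p ≤-refl) D<y))))
         (~braid↓ y D)
DIns-~ (dnext {x = x} {D} {D′} c<x i) (_ ∷ s) =
  ~trans (~cons x (DIns-~ i s)) (~far D′ (far-< (d<c i) c<x))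

DIns-last : ∀ {E e c} → e < c → All (c <_) E → DIns (E ∷ʳ e) c (E ∷ʳ c) e
DIns-last e<c []        = drep e<c
DIns-last e<c (p ∷ ps) = dnext p (DIns-last e<c ps)

bump-~ : ∀ {E e U a U′ c D d} → U ∷ʳ a ~ c ∷ U′ → E ∷ʳ e ∷ʳ c ~ d ∷ D →
  (E ++ e ∷ U) ∷ʳ a ~ d ∷ D ++ U′
bump-~ {E} {e} {U} {a} {U′} {c} {D} {d} r s =
  ~trans (~reflexive (trans (++-assoc E (e ∷ U) (a ∷ [])) (sym (++-assoc E (e ∷ []) (U ∷ʳ a)))))
  (~trans (~++ˡ (E ∷ʳ e) r)
  (~trans (~reflexive (sym (++-assoc (E ∷ʳ e) (c ∷ []) U′)))
          (~++ʳ U′ s)))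

Step-~ : ∀ {R a R′ d} → NF R → Step R a R′ d → word R ∷ʳ a ~ d ∷ word R′
Step-~ (nf pE aE aU (1<U ∷ _)) (s101 E U) with AllPairs-∷ʳ⁻ E pE
... | _ , 1<E =
  -- The inserted 0 passes `U` and completes 1010, which becomes 0101; the leading 0 then passes
  -- `E`, whose letters all exceed 1.
  ~trans (~reflexive (trans (++-assoc (E ∷ʳ 1) _ _) (++-assoc E _ _)))
  (~trans (~++ˡ E (~trans (~cons 1 (~cons 0 (~cons 1 (~move-last U (All.map inj₁ 1<U)))))
                         (~quad U)))
  (~trans (~moveˡ E _ (All.map inj₁ 1<E))
          (~reflexive (cong (0 ∷_) (sym (++-assoc E _ _))))))
Step-~ h@(nf _ _ (e<c ∷ _) (c<U ∷ _)) (inc₁ {E} {U = U} {a} a≤e _ i) =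
  bump-~ {E} (~cons _ (~move-last U (All.map (far-> (≤-<-trans a≤e e<c)) c<U)))
             (DIns-~ i (NF-dec h))
Step-~ h@(nf _ _ _ pU) (inc₂ {E} e<a cE i) =
  bump-~ {E} (UIns-~ (≤-<-trans z≤n e<a) i pU) (DIns-~ (DIns-last (<-trans e<a (a<c i)) cE) (NF-dec h))
Step-~ h@(nf _ _ _ pU) (mid {E} {E′ = E′} e<a _ i j) =
  ~trans (bump-~ {E} (UIns-~ (≤-<-trans z≤n e<a) i pU) (DIns-~ j (NF-dec h)))
         (~reflexive (cong (_ ∷_) (++-assoc E′ _ _)))

-- The insertion algorithm on rows

lastL-∷ʳ : ∀ E e → lastL (E ∷ʳ e) ≡ e ∷ []
lastL-∷ʳ []          e = refl
lastL-∷ʳ (x ∷ [])    e = refl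
lastL-∷ʳ (x ∷ y ∷ E) e = lastL-∷ʳ (y ∷ E) e

-- Stated for an arbitrary tail `W`, because `unimodalᵇ` must also be evaluated on a row followed by
-- a letter that does not fit.
decPart-NF : ∀ E {e} W → AllPairs _>_ (E ∷ʳ e) → (∀ {w W′} → W ≡ w ∷ W′ → e ≤ w) →
  decPart (E ++ e ∷ W) ≡ (E ∷ʳ e , W)
decPart-NF []      []      _ _ = refl
decPart-NF []      (w ∷ W) _ h rewrite <ᵇ-false (h refl) = refl
decPart-NF (x ∷ []) {e} W ((e<x ∷ []) ∷ s) h rewrite <ᵇ-true e<x | decPart-NF [] W s h = refl
decPart-NF (x ∷ y ∷ E) {e} W ((y<x ∷ _) ∷ s) h rewrite <ᵇ-true y<x | decPart-NF (y ∷ E) W s h = refl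

unimodalᵇ-NF : ∀ E {e} W → AllPairs _>_ (E ∷ʳ e) → (∀ {w W′} → W ≡ w ∷ W′ → e ≤ w) →
  unimodalᵇ (E ++ e ∷ W) ≡ incᵇ (e ∷ W)
unimodalᵇ-NF E {e} W s h rewrite decPart-NF E W s h | lastL-∷ʳ E e = refl

incᵇ-sorted : ∀ {L} → AllPairs _<_ L → incᵇ L ≡ true
incᵇ-sorted {[]} _ = refl
incᵇ-sorted {_ ∷ []} _ = refl
incᵇ-sorted {_ ∷ _ ∷ _} ((p ∷ _) ∷ s) = cong₂ _∧_ (<ᵇ-true p) (incᵇ-sorted s)

unimodalᵇ-word : ∀ {R} → NF R → unimodalᵇ (word R) ≡ true
unimodalᵇ-word {row E e U} h@(nf _ _ aU pU) =
  trans (unimodalᵇ-NF E U (NF-dec h) λ { refl → <⇒≤ (All.head aU) }) (incᵇ-sorted (aU ∷ pU))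

∧-falseʳ : ∀ b {c} → c ≡ false → b ∧ c ≡ false
∧-falseʳ true  p = p
∧-falseʳ false p = refl

incᵇ-∷ʳ-false : ∀ {a} x L → All (a ≤_) (x ∷ L) → incᵇ (x ∷ L ∷ʳ a) ≡ false
incᵇ-∷ʳ-false {a} x []      (p ∷ _)  rewrite <ᵇ-false {x} p = refl
incᵇ-∷ʳ-false     x (y ∷ L) (_ ∷ ps) = ∧-falseʳ (x <ᵇ y) (incᵇ-∷ʳ-false y L ps)

UIns-¬inc : ∀ {U a U′ c} → UIns U a U′ c → AllPairs _<_ U → ∀ x → incᵇ (x ∷ U ∷ʳ a) ≡ false
UIns-¬inc (urep {b = b} {U} p) (q ∷ _) x =
  ∧-falseʳ (x <ᵇ b) (incᵇ-∷ʳ-false b U (<⇒≤ p ∷ All.map (λ r → <⇒≤ (<-trans p r)) q))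
UIns-¬inc (ukeep {a} {U}) (q ∷ _) x =
  ∧-falseʳ (x <ᵇ a) (incᵇ-∷ʳ-false a (suc a ∷ U) (≤-refl ∷ All.map <⇒≤ q))
UIns-¬inc (unext {x = y} _ i) (_ ∷ s) x = ∧-falseʳ (x <ᵇ y) (UIns-¬inc i s y)

bumpUp-UIns : ∀ {U a U′ c} → UIns U a U′ c → bumpUp U a ≡ (U′ , c)
bumpUp-UIns (urep p) rewrite ≤ᵇ-true (<⇒≤ p) | ≡ᵇ-false (>⇒≢ p) = refl
bumpUp-UIns (ukeep {a}) rewrite ≤ᵇ-true (≤-refl {a}) | ≡ᵇ-true a = refl
bumpUp-UIns (unext p i) rewrite ≤ᵇ-false p | bumpUp-UIns i = refl

bumpDown-DIns : ∀ {D c D′ d} → DIns D c D′ d → bumpDown D c ≡ (D′ , d)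
bumpDown-DIns (drep p) rewrite ≤ᵇ-true (<⇒≤ p) | ≡ᵇ-false (<⇒≢ p) = refl
bumpDown-DIns (dkeep {y}) rewrite <ᵇ-true (n<1+n y) | ≡ᵇ-true y = refl
bumpDown-DIns (dnext p i) rewrite ≤ᵇ-false p | bumpDown-DIns i = refl

UIns-exists : ∀ {U a} → AllPairs _<_ U → Red (U ∷ʳ a) →
  All (_< a) U ⊎ ∃₂ λ U′ c → UIns U a U′ c
UIns-exists {[]} _ _ = inj₁ []
UIns-exists {x ∷ U} {a} (x<U ∷ s) red with <-cmp x a
... | tri> _ _ p = inj₂ (_ , _ , urep p)
... | tri< p _ _ with UIns-exists s (Red-++ʳ (x ∷ []) red)
...   | inj₁ q           = inj₁ (p ∷ q)
...   | inj₂ (_ , _ , i) = inj₂ (_ , _ , unext p i)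
UIns-exists {x ∷ []} s red | tri≈ _ refl _ = contradiction ~refl (red [] x [])
UIns-exists {x ∷ y ∷ U} ((x<y ∷ _) ∷ (y<U ∷ s)) red | tri≈ _ refl _ with m≤n⇒m<n∨m≡n x<y
... | inj₂ refl = inj₂ (_ , _ , ukeep)
... | inj₁ p    = ⊥-elim (red [] x (y ∷ U ++ []) (~cons x (~moveˡ (y ∷ U) [] (inj₁ p ∷ All.map (λ q → inj₁ (<-trans p q)) y<U))))

-- A kept letter must be followed by its predecessor, since otherwise the incoming equal letter
-- would commute back to it. The exception is 1 followed by 0, where no braid is available; this is
-- the 101 rule.
DIns-exists : ∀ {D c} → AllPairs _>_ D → Red (D ∷ʳ c) → Any (_≤ c) D →
  (∃₂ λ D′ d → DIns D c D′ d) ⊎ (c ≡ 1 × ∃ λ E → D ≡ E ∷ʳ 1 ∷ʳ 0)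
DIns-exists {x ∷ D} {c} (D<x ∷ s) red any with <-cmp x c
... | tri< p _ _ = inj₁ (_ , _ , drep p)
DIns-exists {x ∷ D} (D<x ∷ s) red (here q) | tri> _ _ p = contradiction q (<⇒≱ p)
DIns-exists {x ∷ D} (D<x ∷ s) red (there any) | tri> _ _ p with DIns-exists s (Red-++ʳ (x ∷ []) red) any
... | inj₁ (_ , _ , i)     = inj₁ (_ , _ , dnext p i)
... | inj₂ (r , E , refl) = inj₂ (r , x ∷ E , refl)
DIns-exists {x ∷ []} s red any | tri≈ _ refl _ = contradiction ~refl (red [] x [])
DIns-exists {x ∷ y ∷ D} ((y<x ∷ _) ∷ (D<y ∷ s)) red any | tri≈ _ refl _ with m≤n⇒m<n∨m≡n y<x
... | inj₁ p = ⊥-elim (red [] x (y ∷ D ++ []) (~cons x (~moveˡ (y ∷ D) [] (inj₂ p ∷ All.map (λ q → inj₂ (<-trans (s≤s q) p)) D<y))))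
DIns-exists {x ∷ suc y ∷ D} s red any | tri≈ _ refl _ | inj₂ refl = inj₁ (_ , _ , dkeep)
DIns-exists {x ∷ zero ∷ []} s red any | tri≈ _ refl _ | inj₂ refl = inj₂ (refl , [] , refl)
DIns-exists {x ∷ zero ∷ z ∷ D} (_ ∷ ((() ∷ _) ∷ s)) red any | tri≈ _ refl _ | inj₂ refl

subseqᵇ-pos : ∀ {L} p q → All (0 <_) L → subseqᵇ (p ∷ 0 ∷ q) L ≡ false
subseqᵇ-pos p q []               = refl
subseqᵇ-pos p q (_∷_ {x} px ps) with p ≡ᵇ x
... | false = subseqᵇ-pos p q ps
... | true  = no0 ps
  where
  no0 : ∀ {L} → All (0 <_) L → subseqᵇ (0 ∷ q) L ≡ false
  no0 []                  = refl
  no0 (_∷_ {suc x} _ ps) = no0 ps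

subseqᵇ-1 : ∀ {L} → All (1 <_) L → subseqᵇ (1 ∷ []) L ≡ false
subseqᵇ-1 []                        = refl
subseqᵇ-1 (_∷_ {suc (suc x)} _ ps) = subseqᵇ-1 ps
subseqᵇ-1 (_∷_ {suc zero} (s≤s ()) ps)

subseqᵇ-101 : ∀ E {e U} → NF (row E e U) → subseqᵇ (1 ∷ 0 ∷ 1 ∷ []) (E ++ e ∷ U) ≡ true →
  ∃₂ λ E₁ U₁ → E ≡ E₁ ∷ʳ 1 × e ≡ 0 × U ≡ 1 ∷ U₁
subseqᵇ-101 E {suc e} (nf _ aE aU _) eq
  with () ← trans (sym eq) (subseqᵇ-pos 1 (1 ∷ [])
               (All.++⁺ (All.map (≤-trans (s≤s z≤n)) aE) (z<s ∷ All.map (≤-trans (s≤s z≤n)) aU)))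
subseqᵇ-101 [] {zero} (nf _ _ aU _) eq with () ← trans (sym eq) (subseqᵇ-pos 1 (1 ∷ []) aU)
subseqᵇ-101 (zero ∷ E) {zero} (nf _ (() ∷ _) _ _) eq
subseqᵇ-101 (suc zero ∷ []) {zero} {suc zero ∷ U} _ eq = [] , U , refl , refl , refl
subseqᵇ-101 (suc zero ∷ []) {zero} {suc (suc u) ∷ U} (nf _ _ _ (u<U ∷ _)) eq
  with () ← trans (sym eq) (subseqᵇ-1 (All.map (≤-trans (s≤s z<s)) u<U))
subseqᵇ-101 (suc zero ∷ []) {zero} {zero ∷ U} (nf _ _ (() ∷ _) _) eq
subseqᵇ-101 (suc zero ∷ zero ∷ E) {zero} (nf _ (_ ∷ () ∷ _) _ _) eq
subseqᵇ-101 (suc zero ∷ suc y ∷ E) {zero} (nf ((s≤s () ∷ _) ∷ _) _ _ _) eq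
subseqᵇ-101 (suc (suc x) ∷ E) {zero} (nf (_ ∷ pE) (_ ∷ aE) aU pU) eq with subseqᵇ-101 E (nf pE aE aU pU) eq
... | E₁ , U₁ , refl , refl , refl = suc (suc x) ∷ E₁ , U₁ , refl , refl , refl

subseqᵇ-101⁺ : ∀ {E} U → All (1 <_) E → subseqᵇ (1 ∷ 0 ∷ 1 ∷ []) (E ++ 1 ∷ 0 ∷ 1 ∷ U) ≡ true
subseqᵇ-101⁺ U []                        = refl
subseqᵇ-101⁺ U (_∷_ {suc (suc x)} _ ps) = subseqᵇ-101⁺ U ps
subseqᵇ-101⁺ U (_∷_ {suc zero} (s≤s ()) ps)

BumpEq : List ℕ → ℕ → Row → ℕ → Set
BumpEq w a R′ d =
    (((a ≡ᵇ 0) ∧ subseqᵇ (1 ∷ 0 ∷ 1 ∷ []) w) ≡ true × word R′ ≡ w × d ≡ 0)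
  ⊎ (((a ≡ᵇ 0) ∧ subseqᵇ (1 ∷ 0 ∷ 1 ∷ []) w) ≡ false × bumpRow w a ≡ (word R′ , d))

¬DIns-101 : ∀ E {D d} → All (1 <_) E → ¬ DIns (E ∷ʳ 1 ∷ʳ 0) 1 D d
¬DIns-101 []      []       (drep (s≤s ()))
¬DIns-101 []      []       (dnext (s≤s ()) _)
¬DIns-101 (x ∷ E) (p ∷ ps) (drep q)    = <-asym p q
¬DIns-101 (x ∷ E) (p ∷ ps) (dnext _ i) = ¬DIns-101 E ps i

bumpRow-word : ∀ {E e U a U′ c D d} → NF (row E e U) → UIns U a U′ c → DIns (E ∷ʳ e) c D d →
  bumpRow (E ++ e ∷ U) a ≡ (D ++ U′ , d)
bumpRow-word {E} {U = U} h@(nf _ _ aU _) i j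
  rewrite decPart-NF E U (NF-dec h) (λ { refl → <⇒≤ (All.head aU) }) | bumpUp-UIns i | bumpDown-DIns j = refl

RowStep : Row → ℕ → Set
RowStep R a = (unimodalᵇ (word R ∷ʳ a) ≡ true × ∃ (App R a))
            ⊎ (unimodalᵇ (word R ∷ʳ a) ≡ false × ∃₂ λ R′ d → Step R a R′ d × BumpEq (word R) a R′ d)

-- This is the bump with `a ≡ e` and `c ≡ suc e`. Only a last letter `suc e` of `E` could make
-- `dkeep` retain `e`; then the word ends in `suc e`, `e`, `suc e`, `e`, and a braid produces a
-- square.
DIns-eq : ∀ {E e D d} → All (e <_) E → Red (E ∷ʳ e ∷ʳ suc e ∷ʳ e) → DIns (E ∷ʳ e) (suc e) D d → All (e <_) D
DIns-eq []       red (drep p)    = n<1+n _ ∷ []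
DIns-eq []       red (dnext p _) = contradiction p (<⇒≱ (n<1+n _) ∘ <⇒≤)
DIns-eq (p ∷ []) red (drep q)    = contradiction q (≤⇒≯ p)
DIns-eq (p ∷ []) red (dkeep {y}) = ⊥-elim (red (suc y ∷ 2 + y ∷ []) (suc y) [] (~braid↓ y (suc y ∷ [])))
DIns-eq (p ∷ []) red (dnext q i) = p ∷ DIns-eq [] (Red-++ʳ (_ ∷ []) red) i
DIns-eq (p ∷ _ ∷ _) red (drep q) = contradiction q (≤⇒≯ p)
DIns-eq (p ∷ q ∷ _) red dkeep    = contradiction q (<-irrefl refl)
DIns-eq (p ∷ q@(_ ∷ _)) red (dnext r i) = p ∷ DIns-eq q (Red-++ʳ (_ ∷ []) red) i

-- The bump acts at the first entry that is at most `c`. If there is one in `E`, the minimum `e`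
-- stays where it is.
DIns-∷ʳ : ∀ {E e c D d} → Any (_≤ c) E → DIns (E ∷ʳ e) c D d → ∃ λ E′ → D ≡ E′ ∷ʳ e
DIns-∷ʳ {x ∷ []}    any         (drep {c} _) = c ∷ [] , refl
DIns-∷ʳ {x ∷ []}    any         dkeep        = x ∷ [] , refl
DIns-∷ʳ {x ∷ []}    (here p)    (dnext q i)  = contradiction p (<⇒≱ q)
DIns-∷ʳ {x ∷ y ∷ E} any         (drep {c} _) = c ∷ y ∷ E , refl
DIns-∷ʳ {x ∷ y ∷ E} any         dkeep        = x ∷ y ∷ E , refl
DIns-∷ʳ {x ∷ y ∷ E} (here p)    (dnext q i)  = contradiction p (<⇒≱ q)
DIns-∷ʳ {x ∷ y ∷ E} (there any) (dnext q i) with DIns-∷ʳ {y ∷ E} any i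
... | E′ , refl = x ∷ E′ , refl

all-or-any : ∀ c E → All (c <_) E ⊎ Any (_≤ c) E
all-or-any c []      = inj₁ []
all-or-any c (x ∷ E) with c <? x | all-or-any c E
... | no p  | _      = inj₂ (here (≮⇒≥ p))
... | yes p | inj₁ q = inj₁ (p ∷ q)
... | yes p | inj₂ q = inj₂ (there q)

UIns-head : ∀ {U a U′ c} → All (a <_) U → UIns U a U′ c → ∃ λ V → U ≡ c ∷ V × U′ ≡ a ∷ V
UIns-head _       (urep {U = U} _) = U , refl , refl
UIns-head (p ∷ _) ukeep            = contradiction p (<-irrefl refl)
UIns-head (p ∷ _) (unext q _)      = contradiction p (<-asym q)

-- `Red` removes the inputs on which `bumpUp` or `bumpDown` would run off the end or keep a letter
-- without its neighbour. On the others the tests of `krIns` separate `App` from `Step`.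
rowStep : ∀ {R a} → NF R → Red (word R ∷ʳ a) → RowStep R a
rowStep {row E e U} {a} h@(nf pE aE aU pU) red
  with UIns-exists pU (Red-++ʳ (E ∷ʳ e) (Red-~ (~reflexive
         (trans (++-assoc E (e ∷ U) (a ∷ [])) (sym (++-assoc E (e ∷ []) (U ∷ʳ a))))) red))
... | inj₁ U<a with <-cmp e a
...   | tri< e<a _ _ = inj₁ (trans (cong unimodalᵇ (sym (App-word app))) (unimodalᵇ-word (App-NF h app)) , _ , app)
  where app = appUp {E} (e<a ∷ U<a)
rowStep {row E e []} {a} h red | inj₁ _ | tri≈ _ refl _ =
  ⊥-elim (red E e [] (~reflexive (++-assoc E (e ∷ []) (e ∷ []))))
rowStep {row E e (u ∷ U)} {a} (nf _ _ (e<u ∷ _) _) red | inj₁ (u<a ∷ _) | tri≈ _ refl _ =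
  contradiction u<a (<-asym e<u)
rowStep {row E e []} {a} h red | inj₁ _ | tri> _ _ a<e =
  inj₁ (trans (cong unimodalᵇ (sym (App-word app))) (unimodalᵇ-word (App-NF h app)) , _ , app)
  where app = appDn {E} a<e
rowStep {row E e (u ∷ U)} {a} (nf _ _ (e<u ∷ _) _) red | inj₁ (u<a ∷ _) | tri> _ _ a<e =
  contradiction u<a (<-asym (<-trans a<e e<u))
rowStep {row E e U} {a} h@(nf pE aE aU pU) red | inj₂ (U′ , c , i) = inj₂ (notUni , bump (a ≤? e))
  where
  notUni : unimodalᵇ ((E ++ e ∷ U) ∷ʳ a) ≡ false
  notUni = trans (cong unimodalᵇ (++-assoc E (e ∷ U) (a ∷ [])))
             (trans (unimodalᵇ-NF E (U ∷ʳ a) (NF-dec h) (hd i aU)) (UIns-¬inc i pU e))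
    where
    hd : ∀ {U U′ w W} → UIns U a U′ c → All (e <_) U → U ∷ʳ a ≡ w ∷ W → e ≤ w
    hd (urep _)    (p ∷ _) refl = <⇒≤ p
    hd ukeep       (p ∷ _) refl = <⇒≤ p
    hd (unext _ _) (p ∷ _) refl = <⇒≤ p
  wordEq : (E ++ e ∷ U) ∷ʳ a ≡ (E ∷ʳ e) ++ U ∷ʳ a
  wordEq = trans (++-assoc E (e ∷ U) (a ∷ [])) (sym (++-assoc E (e ∷ []) (U ∷ʳ a)))
  e<c : e < c
  e<c = All.lookup aU (c∈U i)
  bump : _ → ∃₂ λ R′ d → Step (row E e U) a R′ d × BumpEq (E ++ e ∷ U) a R′ d
  bump (no a≰e) = go (all-or-any c E)
    where
    e<a = ≰⇒> a≰e
    redD : Red (E ∷ʳ e ∷ʳ c)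
    redD = Red-++ˡ U′ (Red-~ (~trans (~reflexive wordEq)
             (~trans (~++ˡ (E ∷ʳ e) (UIns-~ (≤-<-trans z≤n e<a) i pU))
                     (~reflexive (sym (++-assoc (E ∷ʳ e) (c ∷ []) U′))))) red)
    test : ((a ≡ᵇ 0) ∧ subseqᵇ (1 ∷ 0 ∷ 1 ∷ []) (E ++ e ∷ U)) ≡ false
    test rewrite ≡ᵇ-false (>⇒≢ (≤-<-trans z≤n e<a)) = refl
    go : _ → _
    go (inj₁ cE) = go′ i
      where
      go′ : ∀ {U′} → UIns U a U′ c → _
      go′ {[]} ()
      go′ {u ∷ U″} i = _ , _ , inc₂ e<a cE i , inj₂ (test , bumpRow-word h i (DIns-last e<c cE))
    go (inj₂ cE) with DIns-exists (NF-dec h) redD (Any.++⁺ˡ cE)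
    ... | inj₂ (refl , _) = contradiction (a<c i) (≤⇒≯ (≤-<-trans z≤n e<a))
    ... | inj₁ (D , d , j) with DIns-∷ʳ {E} cE j
    ...   | E′ , refl = _ , _ , mid e<a cE i j ,
                        inj₂ (test , trans (bumpRow-word h i j) (cong (_, d) (++-assoc E′ (e ∷ []) U′)))
  bump (yes a≤e) with UIns-head (All.map (≤-<-trans a≤e) aU) i
  ... | V , refl , refl = go
    where
    moveA : c ∷ V ∷ʳ a ~ c ∷ a ∷ V
    moveA = ~cons c (~move-last V (All.map (far-> (a<c i)) (AllPairs.head pU)))
    -- `a` commutes with all of `V`, so it can be brought next to `c` and `V` be cut off.
    redE : Red (E ∷ʳ e ∷ʳ c ∷ʳ a)
    redE = Red-++ˡ V (Red-~ (~trans (~reflexive wordEq) (~trans (~++ˡ (E ∷ʳ e) moveA)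
             (~reflexive (trans (sym (++-assoc (E ∷ʳ e) (c ∷ []) (a ∷ V)))
                                (sym (++-assoc (E ∷ʳ e ∷ʳ c) (a ∷ []) V)))))) red)
    -- Were `c` larger than `suc e`, then `a` would commute past `c` as well and meet the equal
    -- letter `e`.
    c≡1+e : a ≡ e → c ≡ suc e
    c≡1+e refl with m≤n⇒m<n∨m≡n e<c
    ... | inj₂ p = sym p
    ... | inj₁ p = ⊥-elim (redE E e (c ∷ []) (~trans
                     (~reflexive (trans (++-assoc (E ∷ʳ e) (c ∷ []) (e ∷ [])) (++-assoc E (e ∷ []) (c ∷ e ∷ []))))
                     (~++ˡ E (~cons e (~far [] (inj₂ p))))))
    go : ∃₂ λ R′ d → Step (row E e (c ∷ V)) a R′ d × BumpEq (E ++ e ∷ c ∷ V) a R′ d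
    go with DIns-exists (NF-dec h) (Red-++ˡ (a ∷ []) redE) (Any.++⁺ʳ E (here (<⇒≤ e<c)))
    ... | inj₂ (refl , E₁ , eq) with ∷ʳ-injective E (E₁ ∷ʳ 1) eq
    ...   | refl , refl with n≤0⇒n≡0 a≤e
    ...     | refl = _ , _ , s101 E₁ V , inj₁ (trans (cong (subseqᵇ (1 ∷ 0 ∷ 1 ∷ [])) (++-assoc E₁ (1 ∷ []) (0 ∷ 1 ∷ V)))
                                                     (subseqᵇ-101⁺ V (proj₂ (AllPairs-∷ʳ⁻ E₁ pE))) , refl , refl)
    go | inj₁ (D , d , j) = _ , _ , inc₁ a≤e aD j , inj₂ (test , bumpRow-word h i j)
      where
      aD : All (a <_) D
      aD with m≤n⇒m<n∨m≡n a≤e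
      ... | inj₁ a<e = DIns-All j (a<c i) (All.∷ʳ⁺ (All.map (<-trans a<e) aE) a<e)
      ... | inj₂ refl with c≡1+e refl
      ...   | refl = DIns-eq aE redE j
      test : ((a ≡ᵇ 0) ∧ subseqᵇ (1 ∷ 0 ∷ 1 ∷ []) (E ++ e ∷ c ∷ V)) ≡ false
      test with subseqᵇ (1 ∷ 0 ∷ 1 ∷ []) (E ++ e ∷ c ∷ V) in eq
      test | false = ∧-falseʳ (a ≡ᵇ 0) refl
      test | true with subseqᵇ-101 E h eq
      ... | E₁ , U₁ , refl , refl , refl = ⊥-elim (¬DIns-101 E₁ (proj₂ (AllPairs-∷ʳ⁻ E₁ pE)) j)

-- The letters bumped out of a row by a unimodal word form a unimodal word

data Up : ℕ → List ℕ → Set where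
  []  : ∀ {x} → Up x []
  _∷_ : ∀ {x y ys} → x < y → Up y ys → Up x (y ∷ ys)

-- `Dn x xs` says that `x ∷ xs` is unimodal, in a form that follows the letters in the order in
-- which they are inserted.
data Dn : ℕ → List ℕ → Set where
  up  : ∀ {x xs} → Up x xs → Dn x xs
  _∷_ : ∀ {x y ys} → y < x → Dn y ys → Dn x (y ∷ ys)

data Pass : Row → List ℕ → Row → List (Maybe ℕ) → Set where
  []   : ∀ {R} → Pass R [] R []
  app  : ∀ {R a R′ us R″ os} → App R a R′ → Pass R′ us R″ os → Pass R (a ∷ us) R″ (nothing ∷ os)
  step : ∀ {R a R′ d us R″ os} → Step R a R′ d → Pass R′ us R″ os → Pass R (a ∷ us) R″ (just d ∷ os)

-- `UpT` and `DnT` describe what comes out of a row after the letter `d`: the bumped letters stay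
-- unimodal, and once a letter has been appended no later one bumps.
data UpT : ℕ → List (Maybe ℕ) → Set where
  end : ∀ {d os} → All (_≡ nothing) os → UpT d os
  _∷_ : ∀ {d d′ os} → d < d′ → UpT d′ os → UpT d (just d′ ∷ os)

data DnT : ℕ → List (Maybe ℕ) → Set where
  up  : ∀ {d os} → UpT d os → DnT d os
  _∷_ : ∀ {d d′ os} → d′ < d → DnT d′ os → DnT d (just d′ ∷ os)

UIns-≤ : ∀ {U a U′ c z} → UIns U a U′ c → AllPairs _<_ U → z ∈ U → a < z → c ≤ z
UIns-≤ (urep _)    (p ∷ _) (here refl) _ = ≤-refl
UIns-≤ (urep _)    (p ∷ _) (there q)   _ = <⇒≤ (All.lookup p q)
UIns-≤ ukeep       _       _           r = r
UIns-≤ (unext p i) _       (here refl) r = contradiction p (<-asym r)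
UIns-≤ (unext p i) (_ ∷ s) (there q)   r = UIns-≤ i s q r

UIns-≤′ : ∀ {U a U′ c z} → UIns U a U′ c → AllPairs _<_ U → z ∈ U′ → a < z → c ≤ z
UIns-≤′ (urep _)    (p ∷ _) (here refl) r = contradiction r (<-irrefl refl)
UIns-≤′ (urep _)    (p ∷ _) (there q)   _ = <⇒≤ (All.lookup p q)
UIns-≤′ ukeep       _       _           r = r
UIns-≤′ (unext p i) _       (here refl) r = contradiction p (<-asym r)
UIns-≤′ (unext p i) (_ ∷ s) (there q)   r = UIns-≤′ i s q r

DIns-≤ : ∀ {D c D′ d z} → DIns D c D′ d → AllPairs _>_ D → z ∈ D → z ≤ c → z ≤ suc d
DIns-≤ (drep _)    _       (here refl) _ = n≤1+n _
DIns-≤ (drep _)    (p ∷ _) (there q)   _ = m≤n⇒m≤1+n (<⇒≤ (All.lookup p q))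
DIns-≤ dkeep       _       _           r = r
DIns-≤ (dnext p i) _       (here refl) r = contradiction p (≤⇒≯ r)
DIns-≤ (dnext p i) (_ ∷ s) (there q)   r = DIns-≤ i s q r

DIns-≤′ : ∀ {D c D′ d z} → DIns D c D′ d → AllPairs _>_ D → z ∈ D′ → z < c → z ≤ d
DIns-≤′ (drep _)    _       (here refl) r = contradiction r (<-irrefl refl)
DIns-≤′ (drep _)    (p ∷ _) (there q)   _ = <⇒≤ (All.lookup p q)
DIns-≤′ dkeep       _       _           r = s≤s⁻¹ r
DIns-≤′ (dnext p i) _       (here refl) r = contradiction p (<-asym r)
DIns-≤′ (dnext p i) (_ ∷ s) (there q)   r = DIns-≤′ i s q r

min≤ : ∀ {E e U x} → NF (row E e U) → x ∈ e ∷ U → e ≤ x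
min≤ h               (here refl) = ≤-refl
min≤ (nf _ _ aU _) (there p)     = <⇒≤ (All.lookup aU p)

-- `c` is the letter handed from `R↑` to `R↓` (for the 101 rule, the letter 1). It now stands in
-- `R↓` and is at most every entry of `R↑` that a larger letter could displace next.
Step-after : ∀ {R a E e U d} → NF R → Step R a (row E e U) d →
  ∃ λ c → d < c × c ∈ E ∷ʳ e × (∀ {z} → z ∈ U → a < z → c ≤ z) × a ∈ e ∷ U
Step-after h (s101 E U) = 1 , z<s , ∈-++⁺ˡ (∈-++⁺ʳ E (here refl)) , (λ _ p → p) , here refl
Step-after (nf _ _ _ (p ∷ _)) (inc₁ _ _ i) =
  _ , d<c i , ∈-++⁺ˡ (c∈D′ i) , (λ q _ → <⇒≤ (All.lookup p q)) , here refl
Step-after (nf _ _ _ pU) (inc₂ {E} e<a _ i) =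
  _ , <-trans e<a (a<c i) , ∈-++⁺ˡ (∈-++⁺ʳ E (here refl)) , (λ q → UIns-≤′ i pU (there q)) , a∈U′ i
Step-after (nf _ _ _ pU) (mid _ _ i j) = _ , d<c j , c∈D′ j , UIns-≤′ i pU , there (a∈U′ i)

Step-before : ∀ {E e U b R d} → NF (row E e U) → Step (row E e U) b R d →
  (b ≡ 0 × d ≡ 0 × 1 ∈ E) ⊎ (∃₂ λ c D → c ∈ U × b < c × DIns (E ∷ʳ e) c D d)
Step-before _ (s101 E U) = inj₁ (refl , refl , ∈-++⁺ʳ E (here refl))
Step-before (nf _ _ (e<c ∷ _) _) (inc₁ b≤e _ i) = inj₂ (_ , _ , here refl , ≤-<-trans b≤e e<c , i)
Step-before _ (inc₂ e<b cE i) = inj₂ (_ , _ , c∈U i , a<c i , DIns-last (<-trans e<b (a<c i)) cE)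
Step-before _ (mid _ _ i j) = inj₂ (_ , _ , c∈U i , a<c i , j)

-- The second bump hands down some `c₂ ≥ c₁`, and `c₁` already stands in `R↓`, so it ejects at least
-- `c₁ ∸ 1`, which is at least `d`. Reducedness supplies `d ≢ d′`.
Step-increasing : ∀ {R a R′ d b R″ d′} → NF R → Step R a R′ d → Step R′ b R″ d′ →
  a < b → d ≢ d′ → d < d′
Step-increasing {R′ = row E e U} h s t a<b d≢d′ with Step-after h s | Step-before (Step-NF h s) t
... | _ | inj₁ (refl , _) = contradiction a<b λ ()
... | c₁ , d<c₁ , c₁∈ , low , _ | inj₂ (c₂ , D , c₂∈ , b<c₂ , i) =
  ≤∧≢⇒< (s≤s⁻¹ (≤-trans d<c₁ (DIns-≤ i (NF-dec (Step-NF h s)) c₁∈ (low c₂∈ (<-trans a<b b<c₂))))) d≢d′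

-- What a bump of type `inc₁` or `inc₂` leaves behind, in a form that a smaller next letter
-- preserves. The entry `z` of `R↓` exceeds the output and is at most all of `R↑`, so the next bump
-- ejects at least `z ∸ 1`.
Inc : Row → ℕ → ℕ → Set
Inc (row E e U) a d = All (a <_) E × a ∈ e ∷ U × (∃ λ z → z ∈ E ∷ʳ e × d < z × All (z ≤_) U)

data IncStep : Row → ℕ → Row → ℕ → Set where
  inc : ∀ {R a R′ d} → Step R a R′ d → Inc R′ a d → IncStep R a R′ d

Inc-inc₁ : ∀ {E e c U a D d} → NF (row E e (c ∷ U)) → All (a <_) D → DIns (E ∷ʳ e) c D d →
  Inc (row D a U) a d
Inc-inc₁ (nf _ _ _ (p ∷ _)) aD i = aD , here refl , _ , ∈-++⁺ˡ (c∈D′ i) , d<c i , All.map <⇒≤ p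

Inc-inc₂ : ∀ {E e U a c u U′} → NF (row E e U) → e < a → All (c <_) E → UIns U a (u ∷ U′) c →
  Inc (row (E ∷ʳ c) u U′) a e
Inc-inc₂ {E} {c = c} (nf _ _ aU pU) e<a cE i with UIns-All i e<a aU | UIns-sorted i pU
... | e<u ∷ _ | u< ∷ _ =
  All.∷ʳ⁺ (All.map (<-trans (a<c i)) cE) (a<c i) , a∈U′ i , _ , ∈-++⁺ʳ (E ∷ʳ c) (here refl) , e<u , All.map <⇒≤ u<

-- `mid` needs an entry of `E` that is at most `c`. But `E` lies above `a₀`, and for a letter
-- smaller than an entry `a₀` of `R↑` the displaced `c` is at most `a₀`.
mid-¬Inc : ∀ {E e U a c U′ a₀ d₀} → AllPairs _<_ U → e < a → Any (_≤ c) E → UIns U a U′ c →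
  Inc (row E e U) a₀ d₀ → ¬ a < a₀
mid-¬Inc pU e<a any i (_  , here refl , _) p = <-asym e<a p
mid-¬Inc pU e<a any i (aE , there q   , _) p = All.All¬⇒¬Any
  (All.map (λ a₀<x x≤c → <⇒≱ a₀<x (≤-trans x≤c (UIns-≤ i pU q p))) aE) any

s101-¬Inc : ∀ E {U a₀ d₀} → Inc (row (E ∷ʳ 1) 0 U) a₀ d₀ → ¬ 0 < a₀
s101-¬Inc E (aE , _) p = contradiction (All.lookup aE (∈-++⁺ʳ E (here refl))) (≤⇒≯ p)

Step-Inc : ∀ {R a d b R″ d′} → NF R → Inc R a d → Step R b R″ d′ →
  b < a → d ≢ d′ → IncStep R b R″ d′ × d < d′
Step-Inc {row E e U} h i t b<a d≢d′ = kind h t , lower i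
  where
  kind : ∀ {R″ d′} → NF (row E e U) → Step (row E e U) _ R″ d′ → IncStep (row E e U) _ R″ d′
  kind h                  (s101 E _)         = contradiction b<a (s101-¬Inc E i)
  kind h                t@(inc₁ _ aD j)      = inc t (Inc-inc₁ h aD j)
  kind h                t@(inc₂ e<a cE j)    = inc t (Inc-inc₂ h e<a cE j)
  kind (nf _ _ _ pU)      (mid e<a any j _)  = contradiction b<a (mid-¬Inc pU e<a any j i)
  lower : Inc (row E e U) _ _ → _ < _
  lower (aE , _ , z , z∈ , d<z , z≤U) with Step-before h t
  ... | inj₁ (refl , refl , 1∈E) = contradiction (All.lookup aE 1∈E) (≤⇒≯ b<a)
  ... | inj₂ (c , D , c∈ , b<c , j) =
    ≤∧≢⇒< (s≤s⁻¹ (≤-trans d<z (DIns-≤ j (NF-dec h) z∈ (All.lookup z≤U c∈)))) d≢d′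

Step-mid : ∀ {R a d E e U b c U′ D d′} → NF R → Step R a (row E e U) d → NF (row E e U) → b < a →
  e < b → Any (_≤ c) E → UIns U b U′ c → DIns (E ∷ʳ e) c D d′ → d′ ≤ d
Step-mid h (s101 _ _)     _               () p any i j
Step-mid h (inc₁ _ aD k)  (nf _ _ _ pU) b<a p any i j = contradiction b<a (mid-¬Inc pU p any i (Inc-inc₁ h aD k))
Step-mid h (inc₂ q cE k)  (nf _ _ _ pU) b<a p any i j = contradiction b<a (mid-¬Inc pU p any i (Inc-inc₂ h q cE k))
Step-mid h (mid _ _ k l)  (nf _ _ _ pU) b<a p any i j =
  DIns-≤′ l (NF-dec h) (d∈D j) (<-trans (d<c j) (≤-<-trans (UIns-≤ i pU (a∈U′ k) b<a) (a<c k)))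

-- As long as the old minimum stays (`mid`), the letter handed down does not grow, so the output
-- drops; the 101 rule ejects 0. From the first `inc` bump on, `Step-Inc` takes over.
Step-decreasing : ∀ {R a R′ d b R″ d′} → NF R → Step R a R′ d → Step R′ b R″ d′ →
  b < a → d ≢ d′ → IncStep R′ b R″ d′ ⊎ d′ < d
Step-decreasing h s (s101 _ _)        b<a d≢d′ = inj₂ (≤∧≢⇒< z≤n (d≢d′ ∘ sym))
Step-decreasing h s t@(inc₁ _ aD i)   b<a d≢d′ = inj₁ (inc t (Inc-inc₁ (Step-NF h s) aD i))
Step-decreasing h s t@(inc₂ p cE i)   b<a d≢d′ = inj₁ (inc t (Inc-inc₂ (Step-NF h s) p cE i))
Step-decreasing h s t@(mid p any i j) b<a d≢d′ =
  inj₂ (≤∧≢⇒< (Step-mid h s (Step-NF h s) b<a p any i j) (d≢d′ ∘ sym))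

Top : Row → ℕ → Set
Top (row E e U) a = All (_≤ a) (e ∷ U)

App-Up : ∀ {R a b R″} → Top R a → a < b → App R b R″ → Top R″ b
App-Up {row E e U} (e≤ ∷ U≤) a<b (appUp (e< ∷ U<)) = <⇒≤ e< ∷ All.∷ʳ⁺ (All.map <⇒≤ U<) ≤-refl
App-Up {row E e U} (e≤a ∷ _) a<b (appDn b<e) = contradiction e≤a (<⇒≱ (<-trans a<b b<e))

Pass-Top : ∀ {R a us R′ os} → Top R a → Up a us → Pass R us R′ os → All (_≡ nothing) os
Pass-Top top []        []         = []
Pass-Top top (p ∷ ups) (app s ps) = refl ∷ Pass-Top (App-Up top p s) ups ps
Pass-Top {row E e U} top (p ∷ ups) (step s ps) = contradiction s (¬Step top p)
  where
  ¬Step : ∀ {E e U a b R d} → All (_≤ a) (e ∷ U) → a < b → ¬ Step (row E e U) b R d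
  ¬Step top p (s101 _ _)       = contradiction p λ ()
  ¬Step (e≤a ∷ _) p (inc₁ b≤e _ _)   = contradiction (≤-trans b≤e e≤a) (<⇒≱ p)
  ¬Step (_ ∷ U≤) p (inc₂ _ _ i)      = contradiction (≤-trans (<⇒≤ (a<c i)) (All.lookup U≤ (c∈U i))) (<⇒≱ p)
  ¬Step (_ ∷ U≤) p (mid _ _ i _)     = contradiction (≤-trans (<⇒≤ (a<c i)) (All.lookup U≤ (c∈U i))) (<⇒≱ p)

Pass-decreasing : ∀ {E a us R′ os} → Dn a us → Pass (row E a []) us R′ os → All (_≡ nothing) os
Pass-decreasing (up ups)  ps                            = Pass-Top (≤-refl ∷ []) ups ps
Pass-decreasing (p ∷ dns) (app (appUp (q ∷ _)) ps)      = contradiction p (<-asym q)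
Pass-decreasing (p ∷ dns) (app (appDn _) ps)            = refl ∷ Pass-decreasing dns ps
Pass-decreasing (p ∷ dns) (step (inc₂ _ _ ()) ps)
Pass-decreasing (p ∷ dns) (step (mid _ _ () _) ps)

App-afterUp : ∀ {R a R′ d b R″ us R‴ os} → NF R → Step R a R′ d → a < b → App R′ b R″ →
  Up b us → Pass R″ us R‴ os → All (_≡ nothing) os
App-afterUp h s a<b (appUp (e< ∷ U<)) ups ps = Pass-Top (<⇒≤ e< ∷ All.∷ʳ⁺ (All.map <⇒≤ U<) ≤-refl) ups ps
App-afterUp h s a<b (appDn b<e) ups ps with Step-after h s
... | _ , _ , _ , _ , here refl = contradiction a<b (<-asym b<e)

App-afterDn : ∀ {R a R′ d b R″ us R‴ os} → NF R → Step R a R′ d → b < a → App R′ b R″ →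
  Dn b us → Pass R″ us R‴ os → All (_≡ nothing) os
App-afterDn h s b<a (appUp below) dns ps with Step-after h s
... | _ , _ , _ , _ , a∈ = contradiction b<a (<-asym (All.lookup below a∈))
App-afterDn h s b<a (appDn b<e) dns ps = Pass-decreasing dns ps

-- Two equal letters ejected in succession would be a square in front of the new row.
Red-≢ : ∀ {R a R′ d d₀ us} → NF R → Step R a R′ d → Red (d₀ ∷ word R ++ a ∷ us) →
  d₀ ≢ d × Red (d ∷ word R′ ++ us)
Red-≢ {R} {a} {R′} {d} {d₀} {us} h s red =
    (λ { refl → red [] d (word R′ ++ us) (~cons d r) })
  , Red-~ r (Red-++ʳ (d₀ ∷ []) red)
  where
  r : word R ++ a ∷ us ~ d ∷ word R′ ++ us
  r = ~trans (~reflexive (sym (++-assoc (word R) (a ∷ []) us))) (~++ʳ us (Step-~ h s))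

Pass-up : ∀ {R a R′ d us R″ os} → NF R → Step R a R′ d → Red (d ∷ word R′ ++ us) →
  Up a us → Pass R′ us R″ os → UpT d os
Pass-up h s red []        []          = end []
Pass-up h s red (p ∷ ups) (app t ps)  = end (refl ∷ App-afterUp h s p t ups ps)
Pass-up h s red (p ∷ ups) (step t ps) with Red-≢ (Step-NF h s) t red
... | d≢ , red′ = Step-increasing h s t p d≢ ∷ Pass-up (Step-NF h s) t red′ ups ps

Pass-inc : ∀ {R a R′ d us R″ os} → NF R → IncStep R a R′ d → Red (d ∷ word R′ ++ us) →
  Dn a us → Pass R′ us R″ os → UpT d os
Pass-inc h (inc s _) red (up ups)  ps          = Pass-up h s red ups ps
Pass-inc h (inc s i) red (p ∷ dns) (app t ps)  = end (refl ∷ App-afterDn h s p t dns ps)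
Pass-inc h (inc s i) red (p ∷ dns) (step t ps) with Red-≢ (Step-NF h s) t red
... | d≢ , red′ with Step-Inc (Step-NF h s) i t p d≢
... | i′ , q = q ∷ Pass-inc (Step-NF h s) i′ red′ dns ps

Pass-dn : ∀ {R a R′ d us R″ os} → NF R → Step R a R′ d → Red (d ∷ word R′ ++ us) →
  Dn a us → Pass R′ us R″ os → DnT d os
Pass-dn h s red (up ups)  ps          = up (Pass-up h s red ups ps)
Pass-dn h s red (p ∷ dns) (app t ps)  = up (end (refl ∷ App-afterDn h s p t dns ps))
Pass-dn {d = d} h s red (p ∷ dns) (step {d = d′} t ps) with Red-≢ (Step-NF h s) t red
... | d≢ , red′ with Step-decreasing h s t p d≢
...   | inj₂ q = q ∷ Pass-dn (Step-NF h s) t red′ dns ps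
-- The first `inc` bump may still belong to the decreasing side; only the bumps after it are known
-- to increase.
...   | inj₁ i with <-cmp d d′
...     | tri< q _ _ = up (q ∷ Pass-inc (Step-NF h s) i red′ dns ps)
...     | tri≈ _ q _ = contradiction q d≢
...     | tri> _ _ q = q ∷ up (Pass-inc (Step-NF h s) i red′ dns ps)

data Outputs : List (Maybe ℕ) → Set where
  none : ∀ {os} → All (_≡ nothing) os → Outputs os
  now  : ∀ {d os} → DnT d os → Outputs (just d ∷ os)
  next : ∀ {d os} → DnT d os → Outputs (nothing ∷ just d ∷ os)

Step-Red : ∀ {R a R′ d us} → NF R → Step R a R′ d → Red (word R ++ a ∷ us) → Red (d ∷ word R′ ++ us)
Step-Red {R} {a} {us = us} h s = Red-~
  (~trans (~reflexive (sym (++-assoc (word R) (a ∷ []) us))) (~++ʳ us (Step-~ h s)))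

App-Red : ∀ {R a R′ us} → App R a R′ → Red (word R ++ a ∷ us) → Red (word R′ ++ us)
App-Red {R} {a} {us = us} s = Red-~ (~reflexive
  (trans (sym (++-assoc (word R) (a ∷ []) us)) (cong (_++ us) (sym (App-word s)))))

Pass-outputs : ∀ {R a us R′ os} → NF R → Red (word R ++ a ∷ us) → Dn a us → Pass R (a ∷ us) R′ os →
  Outputs os
Pass-outputs h red dns (step s ps) = now (Pass-dn h s (Step-Red h s red) dns ps)
Pass-outputs h red dns (app (appDn _) ps) = none (refl ∷ Pass-decreasing dns ps)
Pass-outputs h red (up ups) (app (appUp (e< ∷ U<)) ps) =
  none (refl ∷ Pass-Top (<⇒≤ e< ∷ All.∷ʳ⁺ (All.map <⇒≤ U<) ≤-refl) ups ps)
Pass-outputs h red (p ∷ dns) (app s@(appUp (e< ∷ U<)) (step t ps)) =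
  next (Pass-dn (App-NF h s) t (Step-Red (App-NF h s) t (App-Red s red)) dns ps)
-- After `appUp` the row ends in an ascent to `a`, so a letter smaller than `a` cannot be appended.
Pass-outputs h red (p ∷ dns) (app (appUp {U = U} {a} (_ ∷ _)) (app t ps)) = contradiction t (¬App U p)
  where
  ¬App : ∀ {E e a b R} U → b < a → ¬ App (row E e (U ∷ʳ a)) b R
  ¬App []         q (appUp (_ ∷ a<b ∷ _))   = <-asym a<b q
  ¬App U@(_ ∷ _) q (appUp (_ ∷ below))     = <-asym q (proj₂ (All.∷ʳ⁻ {xs = U} below))

-- Rows of the new boxes

-- The reading word, bottom row first.
read : List Row → List ℕ
read []       = []
read (X ∷ Xs) = read Xs ++ word X

data Ins : List Row → ℕ → List Row → ℕ → Set where
  new  : ∀ {a} → Ins [] a (row [] a [] ∷ []) 0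
  app  : ∀ {X Xs a X′} → App X a X′ → Ins (X ∷ Xs) a (X′ ∷ Xs) 0
  bump : ∀ {X Xs a X′ d Xs′ r} → Step X a X′ d → Ins Xs d Xs′ r → Ins (X ∷ Xs) a (X′ ∷ Xs′) (suc r)

data InsWord : List Row → List ℕ → List Row → List ℕ → Set where
  []  : ∀ {Xs} → InsWord Xs [] Xs []
  _∷_ : ∀ {Xs a Xs′ r us Xs″ rs} → Ins Xs a Xs′ r → InsWord Xs′ us Xs″ rs → InsWord Xs (a ∷ us) Xs″ (r ∷ rs)

Ins-NF : ∀ {Xs a Xs′ r} → All NF Xs → Ins Xs a Xs′ r → All NF Xs′
Ins-NF []       new        = nf [] [] [] [] ∷ []
Ins-NF (h ∷ hs) (app s)    = App-NF h s ∷ hs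
Ins-NF (h ∷ hs) (bump s i) = Step-NF h s ∷ Ins-NF hs i

Ins-~ : ∀ {Xs a Xs′ r} → All NF Xs → Ins Xs a Xs′ r → read Xs ∷ʳ a ~ read Xs′
Ins-~ []       new = ~refl
Ins-~ {X ∷ Xs} (h ∷ hs) (app s) = ~reflexive
  (trans (++-assoc (read Xs) (word X) _) (cong (read Xs ++_) (sym (App-word s))))
Ins-~ {X ∷ Xs} {a} (h ∷ hs) (bump {X′ = X′} {d} s i) =
  ~trans (~reflexive (++-assoc (read Xs) (word X) _))
  (~trans (~++ˡ (read Xs) (Step-~ h s))
  (~trans (~reflexive (sym (++-assoc (read Xs) (d ∷ []) (word X′))))
          (~++ʳ (word X′) (Ins-~ hs i))))

krIns-app : ∀ w P a → unimodalᵇ (w ∷ʳ a) ≡ true → krIns (w ∷ P) a ≡ ((w ∷ʳ a) ∷ P , 0)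
krIns-app w P a p with unimodalᵇ (w ∷ʳ a) | p
... | true | _ = refl

krIns-bump : ∀ w P a {X d P′ r} → unimodalᵇ (w ∷ʳ a) ≡ false → BumpEq w a X d → krIns P d ≡ (P′ , r) →
  krIns (w ∷ P) a ≡ (word X ∷ P′ , suc r)
krIns-bump w P a p q eq with unimodalᵇ (w ∷ʳ a) | p
krIns-bump w P a p (inj₁ (t , v , refl)) eq | false | _
  with (a ≡ᵇ 0) ∧ subseqᵇ (1 ∷ 0 ∷ 1 ∷ []) w | t
... | true | _ rewrite eq | v = refl
krIns-bump w P a p (inj₂ (t , v)) eq | false | _
  with (a ≡ᵇ 0) ∧ subseqᵇ (1 ∷ 0 ∷ 1 ∷ []) w | t
... | false | _ = trans
  (cong (λ z → proj₁ z ∷ proj₁ (krIns P (proj₂ z)) , suc (proj₂ (krIns P (proj₂ z)))) v)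
  (cong (λ z → _ ∷ proj₁ z , suc (proj₂ z)) eq)

krIns-Ins : ∀ {Xs a} → All NF Xs → Red (read Xs ∷ʳ a) →
  ∃₂ λ Xs′ r → Ins Xs a Xs′ r × krIns (map word Xs) a ≡ (map word Xs′ , r)
krIns-Ins {[]}     _        _   = _ , _ , new , refl
krIns-Ins {X ∷ Xs} {a} (h ∷ hs) red
  with rowStep h (Red-++ʳ (read Xs) (Red-~ (~reflexive (++-assoc (read Xs) (word X) (a ∷ []))) red))
... | inj₁ (isUni , _ , s) = _ , _ , app s ,
  trans (krIns-app (word X) (map word Xs) a isUni) (cong (λ w → w ∷ map word Xs , 0) (sym (App-word s)))
... | inj₂ (notUni , X′ , d , s , q) with krIns-Ins hs (Red-++ˡ (word X′) (Red-~
    (~trans (~reflexive (++-assoc (read Xs) (word X) (a ∷ [])))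
    (~trans (~++ˡ (read Xs) (Step-~ h s))
            (~reflexive (sym (++-assoc (read Xs) (d ∷ []) (word X′)))))) red))
...   | _ , _ , i , eq = _ , _ , bump s i , krIns-bump (word X) (map word Xs) a {X′} notUni q eq

krInsWord-InsWord : ∀ {Xs us} → All NF Xs → Red (read Xs ++ us) →
  ∃₂ λ Xs′ rs → InsWord Xs us Xs′ rs × krInsWord (map word Xs) us ≡ (map word Xs′ , rs) ×
    All NF Xs′ × read Xs ++ us ~ read Xs′
krInsWord-InsWord {Xs} {[]} hs red = _ , _ , [] , refl , hs , ~reflexive (++-identityʳ (read Xs))
krInsWord-InsWord {Xs} {a ∷ us} hs red with krIns-Ins hs (Red-++ˡ us (Red-~ assoc red))
  where assoc = ~reflexive (sym (++-assoc (read Xs) (a ∷ []) us))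
... | Xs′ , r , i , eq with krInsWord-InsWord {Xs′} {us} (Ins-NF hs i) (Red-~ s red)
  where s = ~trans (~reflexive (sym (++-assoc (read Xs) (a ∷ []) us))) (~++ʳ us (Ins-~ hs i))
...   | Xs″ , rs , is , eq′ , hs″ , s = Xs″ , r ∷ rs , i ∷ is , eq″ , hs″ ,
  ~trans (~reflexive (sym (++-assoc (read Xs) (a ∷ []) us))) (~trans (~++ʳ us (Ins-~ hs i)) s)
  where
  eq″ : krInsWord (map word Xs) (a ∷ us) ≡ (map word Xs″ , r ∷ rs)
  eq″ = trans
    (cong (λ z → proj₁ (krInsWord (proj₁ z) us) , proj₂ z ∷ proj₂ (krInsWord (proj₁ z) us)) eq)
    (cong (λ z → proj₁ z , r ∷ proj₂ z) eq′)

-- Row indices as seen from the upper row: a letter appended there contributes 0, a bumped letter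
-- one more than the index it obtains in the rows below.
data Merge : List (Maybe ℕ) → List ℕ → List ℕ → Set where
  []   : Merge [] [] []
  skip : ∀ {os rs xs} → Merge os rs xs → Merge (nothing ∷ os) rs (0 ∷ xs)
  keep : ∀ {d os r rs xs} → Merge os rs xs → Merge (just d ∷ os) (r ∷ rs) (suc r ∷ xs)

bumped : List (Maybe ℕ) → List ℕ
bumped []             = []
bumped (nothing ∷ os) = bumped os
bumped (just d ∷ os)  = d ∷ bumped os

InsWord-Pass : ∀ {X Xs us Xs′ xs} → InsWord (X ∷ Xs) us Xs′ xs →
  ∃₂ λ X″ os → ∃₂ λ Xs″ rs → Pass X us X″ os × InsWord Xs (bumped os) Xs″ rs × Merge os rs xs
InsWord-Pass [] = _ , _ , _ , _ , [] , [] , []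
InsWord-Pass (app s ∷ is) with InsWord-Pass is
... | _ , _ , _ , _ , p , q , m = _ , _ , _ , _ , app s p , q , skip m
InsWord-Pass (bump s i ∷ is) with InsWord-Pass is
... | _ , _ , _ , _ , p , q , m = _ , _ , _ , _ , step s p , i ∷ q , keep m

Pass-~ : ∀ {X us X′ os} → NF X → Pass X us X′ os → word X ++ us ~ bumped os ++ word X′
Pass-~ {X} h [] = ~reflexive (++-identityʳ (word X))
Pass-~ {X} {a ∷ us} h (app s p) =
  ~trans (~reflexive (trans (sym (++-assoc (word X) (a ∷ []) us)) (cong (_++ us) (sym (App-word s)))))
         (Pass-~ (App-NF h s) p)
Pass-~ {X} {a ∷ us} h (step {d = d} s p) =
  ~trans (~reflexive (sym (++-assoc (word X) (a ∷ []) us)))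
  (~trans (~++ʳ us (Step-~ h s)) (~cons d (Pass-~ (Step-NF h s) p)))

data WeakDown : ℕ → List ℕ → Set where
  []  : ∀ {x} → WeakDown x []
  _∷_ : ∀ {x y ys} → y ≤ x → WeakDown y ys → WeakDown x (y ∷ ys)

-- Row indices that rise strictly and then fall weakly: the pattern on which the primes assigned by
-- `KR'` rest.
data Peak : ℕ → List ℕ → Set where
  down : ∀ {x xs} → WeakDown x xs → Peak x xs
  _∷_  : ∀ {x y ys} → x < y → Peak y ys → Peak x (y ∷ ys)

bumped-none : ∀ {os} → All (_≡ nothing) os → bumped os ≡ []
bumped-none []          = refl
bumped-none (refl ∷ ps) = bumped-none ps

Merge-none : ∀ {os rs xs y} → All (_≡ nothing) os → Merge os rs xs → WeakDown y xs
Merge-none []          []       = []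
Merge-none (refl ∷ ps) (skip m) = z≤n ∷ Merge-none ps m

bumped-Up : ∀ {d os} → UpT d os → Up d (bumped os)
bumped-Up {d} (end ps) = subst (Up d) (sym (bumped-none ps)) []
bumped-Up (p ∷ u)      = p ∷ bumped-Up u

bumped-Dn : ∀ {d os} → DnT d os → Dn d (bumped os)
bumped-Dn (up u)  = up (bumped-Up u)
bumped-Dn (p ∷ u) = p ∷ bumped-Dn u

Merge-UpT-down : ∀ {d os r rs xs} → UpT d os → Merge os rs xs → WeakDown r rs → WeakDown (suc r) xs
Merge-UpT-down (end ps) m        _       = Merge-none ps m
Merge-UpT-down (p ∷ u)  (keep m) (q ∷ w) = s≤s q ∷ Merge-UpT-down u m w

Merge-UpT : ∀ {d os r rs xs} → UpT d os → Merge os rs xs → Peak r rs → Peak (suc r) xs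
Merge-UpT (end ps) m        _        = down (Merge-none ps m)
Merge-UpT (p ∷ u)  m        (down w) = down (Merge-UpT-down (p ∷ u) m w)
Merge-UpT (p ∷ u)  (keep m) (q ∷ w)  = s<s q ∷ Merge-UpT u m w

Merge-DnT-down : ∀ {d os r rs xs} → DnT d os → Merge os rs xs → WeakDown r rs → WeakDown (suc r) xs
Merge-DnT-down (up u)  m        w       = Merge-UpT-down u m w
Merge-DnT-down (p ∷ u) (keep m) (q ∷ w) = s≤s q ∷ Merge-DnT-down u m w

Merge-DnT : ∀ {d os r rs xs} → DnT d os → Merge os rs xs → Peak r rs → Peak (suc r) xs
Merge-DnT (up u)  m        w        = Merge-UpT u m w
Merge-DnT (p ∷ u) m        (down w) = down (Merge-DnT-down (p ∷ u) m w)
Merge-DnT (p ∷ u) (keep m) (q ∷ w)  = s<s q ∷ Merge-DnT u m w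

-- The bumped letters are unimodal, so the rows below give a peak by induction. Appending in the
-- upper row adds a 0 in front of or behind these indices raised by one, and neither spoils the
-- peak.
rows-Peak : ∀ {Xs a us Xs′ x xs} → All NF Xs → Red (read Xs ++ a ∷ us) → Dn a us →
  InsWord Xs (a ∷ us) Xs′ (x ∷ xs) → Peak x xs
rows-Peak {[]} _ _ dns (new ∷ is) with InsWord-Pass is
... | _ , _ , _ , _ , p , _ , m = down (Merge-none (Pass-decreasing dns p) m)
rows-Peak {X ∷ Xs} {a} {us} (h ∷ hs) red dns is with InsWord-Pass is
... | X″ , os , Xs″ , rs , p , q , m = go (Pass-outputs h (Red-++ʳ (read Xs) redX) dns p) m red′ q
  where
  redX : Red (read Xs ++ word X ++ a ∷ us)
  redX = Red-~ (~reflexive (++-assoc (read Xs) (word X) (a ∷ us))) red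
  red′ : Red (read Xs ++ bumped os)
  red′ = Red-++ˡ (word X″) (Red-~ (~trans (~++ˡ (read Xs) (Pass-~ h p))
           (~reflexive (sym (++-assoc (read Xs) (bumped os) (word X″))))) redX)
  go : ∀ {os rs x xs} → Outputs os → Merge os rs (x ∷ xs) → Red (read Xs ++ bumped os) →
    InsWord Xs (bumped os) Xs″ rs → Peak x xs
  go (none (refl ∷ ps)) (skip m)        _   _ = down (Merge-none ps m)
  go (now u)            (keep m)        red q = Merge-DnT u m (rows-Peak hs red (bumped-Dn u) q)
  go (next u)           (skip (keep m)) red q = z<s ∷ Merge-DnT u m (rows-Peak hs red (bumped-Dn u) q)

-- Consecutive rows of the insertion tableau

opaque
  # : (ℕ → Bool) → List ℕ → ℕ
  # p []      = 0
  # p (x ∷ L) = if p x then suc (# p L) else # p L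

  #-yes : ∀ {p x} L → p x ≡ true → # p (x ∷ L) ≡ suc (# p L)
  #-yes L q rewrite q = refl

  #-no : ∀ {p x} L → p x ≡ false → # p (x ∷ L) ≡ # p L
  #-no L q rewrite q = refl

  #-≤suc : ∀ p x L → # p (x ∷ L) ≤ suc (# p L)
  #-≤suc p x L with p x
  ... | true  = ≤-refl
  ... | false = n≤1+n _

  #-≤∷ : ∀ p x L → # p L ≤ # p (x ∷ L)
  #-≤∷ p x L with p x
  ... | true  = n≤1+n _
  ... | false = ≤-refl

  #-cons-mono : ∀ p x {L L′} → # p L ≤ # p L′ → # p (x ∷ L) ≤ # p (x ∷ L′)
  #-cons-mono p x q with p x
  ... | true  = s≤s q
  ... | false = q

  #-mono : ∀ {p q} L → (∀ z → p z ≡ true → q z ≡ true) → # p L ≤ # q L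
  #-mono []      h = z≤n
  #-mono {p} {q} (x ∷ L) h with p x in eq
  ... | true  rewrite h x eq = s≤s (#-mono L h)
  ... | false = ≤-trans (#-mono L h) (#-≤∷ q x L)

  #-mono-strict : ∀ {p q z L} → (∀ z → p z ≡ true → q z ≡ true) → z ∈ L → p z ≡ false → q z ≡ true →
    suc (# p L) ≤ # q L
  #-mono-strict {L = x ∷ L} h (here refl) a b rewrite a | b = s≤s (#-mono L h)
  #-mono-strict {p} {q} {L = x ∷ L} h (there i) a b with p x in eq
  ... | true rewrite h x eq = s≤s (#-mono-strict h i a b)
  ... | false = ≤-trans (#-mono-strict h i a b) (#-≤∷ q x L)

  #-length : ∀ p L → # p L ≤ length L
  #-length p []      = z≤n
  #-length p (x ∷ L) = ≤-trans (#-≤suc p x L) (s≤s (#-length p L))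

  #-all : ∀ {p} L → All (λ x → p x ≡ true) L → # p L ≡ length L
  #-all []      []       = refl
  #-all (x ∷ L) (q ∷ qs) rewrite q = cong suc (#-all L qs)

  #-none : ∀ {p} L → All (λ x → p x ≡ false) L → # p L ≡ 0
  #-none []      []       = refl
  #-none (x ∷ L) (q ∷ qs) rewrite q = #-none L qs

  #-∷ʳ-no : ∀ {p x} L → p x ≡ false → # p (L ∷ʳ x) ≡ # p L
  #-∷ʳ-no []      q rewrite q = refl
  #-∷ʳ-no {p} (y ∷ L) q with p y
  ... | true  = cong suc (#-∷ʳ-no L q)
  ... | false = #-∷ʳ-no L q

  #-≤∷ʳ : ∀ p L x → # p L ≤ # p (L ∷ʳ x)
  #-≤∷ʳ p []      x = z≤n
  #-≤∷ʳ p (y ∷ L) x = #-cons-mono p y {L} {L ∷ʳ x} (#-≤∷ʳ p L x)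

  #-∷ʳ-≤suc : ∀ p L x → # p (L ∷ʳ x) ≤ suc (# p L)
  #-∷ʳ-≤suc p []      x = #-≤suc p x []
  #-∷ʳ-≤suc p (y ∷ L) x with p y
  ... | true  = s≤s (#-∷ʳ-≤suc p L x)
  ... | false = #-∷ʳ-≤suc p L x

above below : ℕ → List ℕ → ℕ
above x = # (x <ᵇ_)
below x = # (_<ᵇ x)

<ᵇ-true⁻ : ∀ m n → (m <ᵇ n) ≡ true → m < n
<ᵇ-true⁻ m n q = <ᵇ⇒< m n (Equivalence.from T-≡ q)

above-anti : ∀ {x y} L → x ≤ y → above y L ≤ above x L
above-anti {x} {y} L p = #-mono L λ z q → <ᵇ-true (≤-<-trans p (<ᵇ-true⁻ y z q))

above-strict : ∀ {x y z L} → x ≤ y → z ∈ L → x < z → z ≤ y → suc (above y L) ≤ above x L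
above-strict {x} {y} p i q r = #-mono-strict (λ z s → <ᵇ-true (≤-<-trans p (<ᵇ-true⁻ y z s))) i (<ᵇ-false r) (<ᵇ-true q)

below-mono : ∀ {x y} L → x ≤ y → below x L ≤ below y L
below-mono {x} L p = #-mono L λ z q → <ᵇ-true (<-≤-trans (<ᵇ-true⁻ z x q) p)

below-strict : ∀ {x y z L} → x ≤ y → z ∈ L → x ≤ z → z < y → suc (below x L) ≤ below y L
below-strict {x} p i q r = #-mono-strict (λ z s → <ᵇ-true (<-≤-trans (<ᵇ-true⁻ z x s) p)) i (<ᵇ-false q) (<ᵇ-true r)

above-yes : ∀ {x y} L → x < y → above x (y ∷ L) ≡ suc (above x L)
above-yes L p = #-yes L (<ᵇ-true p)

above-no : ∀ {x y} L → y ≤ x → above x (y ∷ L) ≡ above x L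
above-no L p = #-no L (<ᵇ-false p)

below-yes : ∀ {x y} L → y < x → below x (y ∷ L) ≡ suc (below x L)
below-yes L p = #-yes L (<ᵇ-true p)

below-no : ∀ {x y} L → x ≤ y → below x (y ∷ L) ≡ below x L
below-no L p = #-no L (<ᵇ-false p)

above-none : ∀ {x} L → All (_≤ x) L → above x L ≡ 0
above-none L ps = #-none L (All.map <ᵇ-false ps)

below-none : ∀ {x} L → All (x ≤_) L → below x L ≡ 0
below-none L ps = #-none L (All.map <ᵇ-false ps)

above-all : ∀ {x} L → All (x <_) L → above x L ≡ length L
above-all L ps = #-all L (All.map <ᵇ-true ps)

below-all : ∀ {x} L → All (_< x) L → below x L ≡ length L
below-all L ps = #-all L (All.map <ᵇ-true ps)

above-pos : ∀ {x} L → 0 < above x L → ∃ λ z → z ∈ L × x < z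
above-pos {x} L p with any? (x <?_) L
... | yes q = find q
... | no q  = contradiction p (≤⇒≯ (≤-reflexive (above-none L (All.map ≮⇒≥ (All.¬Any⇒All¬ L q)))))

-- How one bump changes the two halves of a row

DIns-length : ∀ {D c D′ d} → DIns D c D′ d → length D′ ≡ length D
DIns-length (drep _)    = refl
DIns-length dkeep       = refl
DIns-length (dnext _ i) = cong suc (DIns-length i)

DIns-above : ∀ {D c D′ d} x → DIns D c D′ d → above x D ≤ above x D′
DIns-above x (drep {c} {d} {D} p) with x <? d
... | yes q = ≤-reflexive (trans (above-yes D q) (sym (above-yes D (<-trans q p))))
... | no q  = ≤-trans (≤-reflexive (above-no D (≮⇒≥ q))) (#-≤∷ (x <ᵇ_) c D)
DIns-above x dkeep                = ≤-refl
DIns-above x (dnext {x = y} _ i)  = #-cons-mono (x <ᵇ_) y (DIns-above x i)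

DIns-above-d : ∀ {D c D′ d y} → DIns D c D′ d → d < y → suc (above y D) ≤ above d D′
DIns-above-d {y = y} (drep {c} {d} {D} p) q = begin
  suc (above y (d ∷ D)) ≡⟨ cong suc (above-no D (<⇒≤ q)) ⟩
  suc (above y D)       ≤⟨ s≤s (above-anti D (<⇒≤ q)) ⟩
  suc (above d D)       ≡⟨ above-yes D p ⟨
  above d (c ∷ D)       ∎
  where open ≤-Reasoning
DIns-above-d dkeep q = above-strict (<⇒≤ q) (here refl) ≤-refl q
DIns-above-d {d = d} {y} (dnext {x = x} {D} {D′} p i) q = begin
  suc (above y (x ∷ D)) ≤⟨ s≤s (#-≤suc (y <ᵇ_) x D) ⟩
  suc (suc (above y D)) ≤⟨ s≤s (DIns-above-d i q) ⟩
  suc (above d D′)      ≡⟨ above-yes D′ (<-trans (d<c i) p) ⟨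
  above d (x ∷ D′)      ∎
  where open ≤-Reasoning

DIns-above-≥ : ∀ {D c D′ d s} → DIns D c D′ d → c ≤ s → above s D′ ≤ above s D
DIns-above-≥ {s = s} (drep {c} {d} {D} p) q = ≤-trans (≤-reflexive (above-no D q)) (#-≤∷ (s <ᵇ_) d D)
DIns-above-≥ dkeep q = ≤-refl
DIns-above-≥ {s = s} (dnext {x = x} _ i) q = #-cons-mono (s <ᵇ_) x (DIns-above-≥ i q)

DIns-above-< : ∀ {D c D′ d s} → DIns D c D′ d → AllPairs _>_ D → s < c →
  above s D′ ≤ above s D ⊎ above s D′ ≤ suc (above c D)
DIns-above-< {s = s} (drep {c} {d} {D} p) (D<d ∷ _) q with s <? d
... | yes r = inj₁ (≤-reflexive (trans (above-yes D q) (sym (above-yes D r))))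
... | no r  = inj₂ (≤-trans (≤-reflexive (trans (above-yes D q)
                (cong suc (above-none D (All.map (λ z<d → <⇒≤ (<-≤-trans z<d (≮⇒≥ r))) D<d))))) (s≤s z≤n))
DIns-above-< dkeep _ q = inj₁ ≤-refl
DIns-above-< {s = s} (dnext {c} {x = x} {D} {D′} p i) (_ ∷ so) q with DIns-above-< i so q
... | inj₁ r = inj₁ (#-cons-mono (s <ᵇ_) x r)
... | inj₂ r = inj₂ (begin
  above s (x ∷ D′)      ≤⟨ #-≤suc (s <ᵇ_) x D′ ⟩
  suc (above s D′)      ≤⟨ s≤s r ⟩
  suc (suc (above c D)) ≡⟨ cong suc (above-yes D p) ⟨
  suc (above c (x ∷ D)) ∎)
  where open ≤-Reasoning

DIns-∈ : ∀ {D c D′ d s} → DIns D c D′ d → AllPairs _>_ D → s ∈ D′ →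
  s ≡ c ⊎ (s ∈ D × above s D′ ≤ above s D)
DIns-∈ (drep _) _ (here refl) = inj₁ refl
DIns-∈ {s = s} (drep {c} {d} {D} p) (D<d ∷ _) (there i) = inj₂ (there i ,
  ≤-reflexive (trans (above-yes D (<-trans s<d p)) (sym (above-yes D s<d))))
  where s<d = All.lookup D<d i
DIns-∈ dkeep _ i = inj₂ (i , ≤-refl)
DIns-∈ {s = s} (dnext p i) _ (here refl) =
  inj₂ (here refl , #-cons-mono (s <ᵇ_) s (DIns-above-≥ i (<⇒≤ p)))
DIns-∈ {s = s} (dnext {x = x} p i) (_ ∷ so) (there j) with DIns-∈ i so j
... | inj₁ q       = inj₁ q
... | inj₂ (k , q) = inj₂ (there k , #-cons-mono (s <ᵇ_) x q)

UIns-below : ∀ {U a U′ c} x → UIns U a U′ c → below x U ≤ below x U′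
UIns-below x (urep {a} {b} {U} p) with b <? x
... | yes q = ≤-reflexive (trans (below-yes U q) (sym (below-yes U (<-trans p q))))
... | no q  = ≤-trans (≤-reflexive (below-no U (≮⇒≥ q))) (#-≤∷ (_<ᵇ x) a U)
UIns-below x ukeep                = ≤-refl
UIns-below x (unext {x = y} _ i)  = #-cons-mono (_<ᵇ x) y (UIns-below x i)

UIns-below-strict : ∀ {U a U′ c y x} → UIns U a U′ c → y ≤ c → c < x → suc (below y U) ≤ below x U′
UIns-below-strict {y = y} {x} (urep {a} {b} {U} p) q r = begin
  suc (below y (b ∷ U)) ≡⟨ cong suc (below-no U q) ⟩
  suc (below y U)       ≤⟨ s≤s (below-mono U (≤-trans q (<⇒≤ r))) ⟩
  suc (below x U)       ≡⟨ below-yes U (<-trans p r) ⟨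
  below x (a ∷ U)       ∎
  where open ≤-Reasoning
UIns-below-strict ukeep q r = below-strict (≤-trans q (<⇒≤ r)) (there (here refl)) q r
UIns-below-strict {y = y} {x} (unext {x = z} {U} {U′} p i) q r = begin
  suc (below y (z ∷ U)) ≤⟨ s≤s (#-≤suc (_<ᵇ y) z U) ⟩
  suc (suc (below y U)) ≤⟨ s≤s (UIns-below-strict i q r) ⟩
  suc (below x U′)      ≡⟨ below-yes U′ (<-trans (<-trans p (a<c i)) r) ⟨
  below x (z ∷ U′)      ∎
  where open ≤-Reasoning

UIns-∈ : ∀ {U a U′ c x} → UIns U a U′ c → AllPairs _<_ U → x ∈ U′ →
  x ∈ U ⊎ (x ≡ a × below (suc c) U ≤ below (suc a) U′)
UIns-∈ (urep {a} {b} {U} p) (b<U ∷ _) (here refl) = inj₂ (refl , (begin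
  below (suc b) (b ∷ U) ≡⟨ below-yes U (n<1+n b) ⟩
  suc (below (suc b) U) ≡⟨ cong suc (below-none U b<U) ⟩
  1                     ≤⟨ s≤s z≤n ⟩
  suc (below (suc a) U) ≡⟨ below-yes U (n<1+n a) ⟨
  below (suc a) (a ∷ U) ∎))
  where open ≤-Reasoning
UIns-∈ (urep p)    _        (there i)   = inj₁ (there i)
UIns-∈ ukeep       _        i           = inj₁ i
UIns-∈ (unext p i) _        (here refl) = inj₁ (here refl)
UIns-∈ (unext {a} {c} {x} {U} {U′} p i) (_ ∷ s) (there j) with UIns-∈ i s j
... | inj₁ k          = inj₁ (there k)
... | inj₂ (refl , q) = inj₂ (refl , (begin
  below (suc c) (x ∷ U)  ≤⟨ #-≤suc (_<ᵇ suc c) x U ⟩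
  suc (below (suc c) U)  ≤⟨ s≤s q ⟩
  suc (below (suc a) U′) ≡⟨ below-yes U′ (m<n⇒m<1+n p) ⟨
  below (suc a) (x ∷ U′) ∎))
  where open ≤-Reasoning

UIns-below-new : ∀ {U a U′ c} x → UIns U a U′ c → AllPairs _<_ U →
  below x U′ ≤ below x U ⊎ (a < x × below x U′ ≤ suc (below a U))
UIns-below-new x (urep {a} {b} {U} p) (b<U ∷ _) with a <? x | b <? x
... | no q  | _     = inj₁ (≤-trans (≤-reflexive (below-no U (≮⇒≥ q))) (#-≤∷ (_<ᵇ x) b U))
... | yes q | yes r = inj₁ (≤-reflexive (trans (below-yes U q) (sym (below-yes U r))))
... | yes q | no r  = inj₂ (q , ≤-trans (≤-reflexive (trans (below-yes U q)
      (cong suc (below-none U (All.map (λ b<z → <⇒≤ (≤-<-trans (≮⇒≥ r) b<z)) b<U))))) (s≤s z≤n))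
UIns-below-new x ukeep _ = inj₁ ≤-refl
UIns-below-new x (unext {a} {x = z} {U} {U′} p i) (_ ∷ s) with UIns-below-new x i s
... | inj₁ q       = inj₁ (#-cons-mono (_<ᵇ x) z q)
... | inj₂ (q , r) = inj₂ (q , (begin
  below x (z ∷ U′)      ≤⟨ #-≤suc (_<ᵇ x) z U′ ⟩
  suc (below x U′)      ≤⟨ s≤s r ⟩
  suc (suc (below a U)) ≡⟨ cong suc (below-yes U p) ⟨
  suc (below a (z ∷ U)) ∎))
  where open ≤-Reasoning

nearest-above : ∀ {D} α → AllPairs _>_ D →
  above α D ≡ 0 ⊎ (∃ λ y → y ∈ D × α < y × above α D ≤ suc (above y D))
nearest-above α [] = inj₁ (above-none [] [])
nearest-above {x ∷ D} α (D<x ∷ s) with α <? x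
... | no p = inj₁ (trans (above-no D (≮⇒≥ p)) (above-none D (All.map (λ z<x → <⇒≤ (<-≤-trans z<x (≮⇒≥ p))) D<x)))
... | yes p with nearest-above α s
...   | inj₁ q = inj₂ (x , here refl , p ,
        ≤-trans (≤-reflexive (trans (above-yes D p) (cong suc q))) (s≤s z≤n))
...   | inj₂ (y , i , q , r) = inj₂ (y , there i , q , (begin
          above α (x ∷ D)       ≡⟨ above-yes D p ⟩
          suc (above α D)       ≤⟨ s≤s r ⟩
          suc (suc (above y D)) ≡⟨ cong suc (above-yes D (All.lookup D<x i)) ⟨
          suc (above y (x ∷ D)) ∎))
  where open ≤-Reasoning

-- Rows that fit, and how a bump through both of them preserves the fit

length-∷ʳ : ∀ {A : Set} (L : List A) x → length (L ∷ʳ x) ≡ suc (length L)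
length-∷ʳ L x = trans (length-++ L) (+-comm (length L) 1)

-- Consider the subword of `Y X` made of `F`, the entries of `f ∷ V` below `x`, the letter `x` of
-- `X`, and the entries of `U` above `x`. It is unimodal and has `suc (load Y x) + above x U`
-- letters, while `X` has `capacity X x + above x U`. The condition `room` of `▹` says that it is
-- not longer than `X`.
capacity load : Row → ℕ → ℕ
capacity (row E e U) x = below (suc x) U + length (E ∷ʳ e)
load     (row F f V) x = below x (f ∷ V) + length F

minimum : Row → ℕ
minimum (row F f V) = f

-- X ▹ Y: the row Y may stand directly below the row X.
-- The two counting conditions are local substitutes for
-- "X is a unimodal subword of maximal length of Y X".
record _▹_ (X Y : Row) : Set where
  constructor fits
  field
    dominate : ∀ {E e U F f V} → X ≡ row E e U → Y ≡ row F f V →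
               ∀ s → s ∈ word Y → suc (above s F) ≤ above s (E ∷ʳ e)
    room     : ∀ x → x ∈ word X → suc (load Y x) ≤ capacity X x

open _▹_

load-mono : ∀ Y {x y} → x ≤ y → load Y x ≤ load Y y
load-mono (row F f V) p = +-monoˡ-≤ (length F) (below-mono (f ∷ V) p)

load-≤length : ∀ Y x → load Y x ≤ length (word Y)
load-≤length (row F f V) x = ≤-trans (+-monoˡ-≤ (length F) (#-length _ (f ∷ V)))
  (≤-reflexive (trans (+-comm _ (length F)) (sym (length-++ F))))

NF-min : ∀ {E e U x} → NF (row E e U) → x ∈ word (row E e U) → e ≤ x
NF-min {E} h@(nf _ aE _ _) i with ∈-++⁻ E i
... | inj₁ j = <⇒≤ (All.lookup aE j)
... | inj₂ j = min≤ h j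

above-dec : ∀ {e s} E → e ≤ s → above s (E ∷ʳ e) ≡ above s E
above-dec E p = #-∷ʳ-no E (<ᵇ-false p)

∈-word : ∀ {E e U x} → x ∈ E ∷ʳ e → x ∈ word (row E e U)
∈-word {E} i with ∈-++⁻ E i
... | inj₁ j           = ∈-++⁺ˡ j
... | inj₂ (here refl) = ∈-++⁺ʳ E (here refl)

head-max : ∀ {E e} → AllPairs _>_ (E ∷ʳ e) → ∃ λ r → r ∈ E ∷ʳ e × All (_≤ r) (E ∷ʳ e)
head-max {[]}    {e} _       = e , here refl , ≤-refl ∷ []
head-max {x ∷ E}     (p ∷ _) = x , here refl , ≤-refl ∷ All.map <⇒≤ p

-- Take `r` to be the largest entry of `E ∷ʳ e`. By `dominate` every entry of `f ∷ V` lies below it,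
-- so the load at `r` is the whole length of `Y`, and `room` compares it with `X`.
▹-length : ∀ {X Y} → NF X → NF Y → X ▹ Y → length (word Y) < length (word X)
▹-length {row E e U} {row F f V} h h′ j with head-max (NF-dec h)
... | r , r∈ , ≤r = begin-strict
  length (F ++ f ∷ V)                ≡⟨ length-++ F ⟩
  length F + length (f ∷ V)          ≡⟨ +-comm (length F) _ ⟩
  length (f ∷ V) + length F          ≡⟨ cong (_+ length F) (below-all (f ∷ V) (All.tabulate below-r)) ⟨
  load (row F f V) r                 <⟨ room j r (∈-word r∈) ⟩
  capacity (row E e U) r             ≤⟨ +-monoˡ-≤ (length (E ∷ʳ e)) (#-length _ U) ⟩
  length U + length (E ∷ʳ e)         ≡⟨ +-comm (length U) _ ⟩
  length (E ∷ʳ e) + length U         ≡⟨ length-++ (E ∷ʳ e) ⟨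
  length ((E ∷ʳ e) ++ U)             ≡⟨ cong length (++-assoc E (e ∷ []) U) ⟩
  length (E ++ e ∷ U)                ∎
  where
  open ≤-Reasoning
  below-r : ∀ {s} → s ∈ f ∷ V → s < r
  below-r {s} i with above-pos (E ∷ʳ e) (≤-trans (s≤s z≤n) (dominate j refl refl s (∈-++⁺ʳ F i)))
  ... | z , z∈ , s<z = <-≤-trans s<z (All.lookup ≤r z∈)

-- The effect of bumping d out of X, as seen from the row below.
record Upper (X : Row) (d : ℕ) (X′ : Row) : Set where
  constructor upper
  field
    bumped∈   : d ∈ word X
    distinct  : ∀ {E e U} → X ≡ row E e U → ∀ f → d ≤ f → suc (above f (E ∷ʳ e)) ≤ length (E ∷ʳ e)
    above-≤   : ∀ {E e U E′ e′ U′} → X ≡ row E e U → X′ ≡ row E′ e′ U′ →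
                ∀ x → above x (E ∷ʳ e) ≤ above x (E′ ∷ʳ e′)
    above-<   : ∀ {E e U E′ e′ U′} → X ≡ row E e U → X′ ≡ row E′ e′ U′ →
                ∀ y → d < y → suc (above y (E ∷ʳ e)) ≤ above d (E′ ∷ʳ e′)
    capacity-< : ∀ x → x ∈ word X′ → d < x → suc (capacity X d) ≤ capacity X′ x
    capacity-≤ : ∀ x → x ∈ word X′ → ∃ λ y → y ∈ word X × x ≤ y × capacity X y ≤ capacity X′ x

open Upper

above-<length : ∀ {f d D} → d ∈ D → d ≤ f → suc (above f D) ≤ length D
above-<length {f} {D = x ∷ D} (here refl) p = s≤s (≤-trans (≤-reflexive (above-no D p)) (#-length _ D))
above-<length {f} {D = x ∷ D} (there i)   p = s≤s (≤-trans (#-≤suc (f <ᵇ_) x D) (above-<length i p))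

-- How the two halves produced by a bump split into a row again: the minimum is the last letter of
-- the new decreasing half (`old`) or the first of the new increasing half (`head`).
data Norm : List ℕ → List ℕ → Row → Set where
  old  : ∀ {E e U} → Norm (E ∷ʳ e) U (row E e U)
  head : ∀ {E u U} → Norm E (u ∷ U) (row E u U)

Upper-bump : ∀ {E e U a U′ c D d X′} → NF (row E e U) → UIns U a U′ c → DIns (E ∷ʳ e) c D d →
  Norm D U′ X′ → Upper (row E e U) d X′
Upper-bump {E} {e} {U} {a} {U′} {c} {D} {d} h@(nf _ _ _ pU) i j n = record
  { bumped∈    = ∈-word (d∈D j)
  ; distinct   = λ { refl f p → above-<length (d∈D j) p }
  ; above-≤    = λ { refl q x → ≤-trans (DIns-above x j) (norm-above n q x) }
  ; above-<    = λ { refl q y p → ≤-trans (DIns-above-d j p) (norm-above n q d) }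
  ; capacity-< = λ x x∈ p → ≤-trans (raw-< x (norm-∈ n x∈) p) (norm-capacity n x)
  ; capacity-≤ = λ x x∈ → let y , k , p , q = raw-≤ x (norm-∈ n x∈) in y , k , p , ≤-trans q (norm-capacity n x)
  }
  where
  norm-above : ∀ {D U′ X′ E′ e′ U″} → Norm D U′ X′ → X′ ≡ row E′ e′ U″ → ∀ x → above x D ≤ above x (E′ ∷ʳ e′)
  norm-above old              refl x = ≤-refl
  norm-above (head {E} {u}) refl x = #-≤∷ʳ (x <ᵇ_) E u
  norm-∈ : ∀ {D U′ X′ x} → Norm D U′ X′ → x ∈ word X′ → x ∈ D ⊎ x ∈ U′
  norm-∈ (old {E} {e} {U}) k = ∈-++⁻ (E ∷ʳ e) (subst (_ ∈_) (sym (++-assoc E (e ∷ []) U)) k)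
  norm-∈ (head {E}) k = ∈-++⁻ E k
  norm-capacity : ∀ {D U′ X′} → Norm D U′ X′ → ∀ x → below (suc x) U′ + length D ≤ capacity X′ x
  norm-capacity old x = ≤-refl
  norm-capacity (head {E} {u} {U}) x = begin
    below (suc x) (u ∷ U) + length E    ≤⟨ +-monoˡ-≤ (length E) (#-≤suc (_<ᵇ suc x) u U) ⟩
    suc (below (suc x) U) + length E    ≡⟨ +-suc (below (suc x) U) (length E) ⟨
    below (suc x) U + suc (length E)    ≡⟨ cong (below (suc x) U +_) (length-∷ʳ E u) ⟨
    below (suc x) U + length (E ∷ʳ u)   ∎
    where open ≤-Reasoning
  raw-< : ∀ x → x ∈ D ⊎ x ∈ U′ → d < x → suc (capacity (row E e U) d) ≤ below (suc x) U′ + length D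
  raw-< x k p = +-mono-≤ (go k) (≤-reflexive (sym (DIns-length j)))
    where
    go : x ∈ D ⊎ x ∈ U′ → suc (below (suc d) U) ≤ below (suc x) U′
    go (inj₂ k) = ≤-trans (s≤s (UIns-below (suc d) i)) (below-strict (s≤s (<⇒≤ p)) k p (n<1+n x))
    go (inj₁ k) with c ≤? x
    ... | yes q = UIns-below-strict i (d<c j) (s≤s q)
    ... | no q  = contradiction (DIns-≤′ j (NF-dec h) k (≰⇒> q)) (<⇒≱ p)
  len : length (E ∷ʳ e) ≤ length D
  len = ≤-reflexive (sym (DIns-length j))
  raw-≤ : ∀ x → x ∈ D ⊎ x ∈ U′ →
    ∃ λ y → y ∈ E ++ e ∷ U × x ≤ y × capacity (row E e U) y ≤ below (suc x) U′ + length D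
  raw-≤ x (inj₁ k) with DIns-∈ j (NF-dec h) k
  ... | inj₁ refl    = c , ∈-++⁺ʳ E (there (c∈U i)) , ≤-refl , +-mono-≤ (UIns-below (suc c) i) len
  ... | inj₂ (l , _) = x , ∈-word l , ≤-refl , +-mono-≤ (UIns-below (suc x) i) len
  raw-≤ x (inj₂ k) with UIns-∈ i pU k
  ... | inj₁ l          = x , ∈-++⁺ʳ E (there l) , ≤-refl , +-mono-≤ (UIns-below (suc x) i) len
  ... | inj₂ (refl , q) = c , ∈-++⁺ʳ E (there (c∈U i)) , <⇒≤ (a<c i) , +-mono-≤ q len

Upper-Step : ∀ {X a X′ d} → NF X → Step X a X′ d → Upper X d X′
Upper-Step _ (s101 E U) = record
  { bumped∈    = ∈-++⁺ʳ (E ∷ʳ 1) (here refl)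
  ; distinct   = λ { refl f p → above-<length (∈-++⁺ʳ (E ∷ʳ 1) (here refl)) p }
  ; above-≤    = λ { refl refl x → ≤-refl }
  ; above-<    = λ { refl refl y p → above-strict z≤n (∈-++⁺ˡ (∈-++⁺ʳ E (here refl))) z<s p }
  ; capacity-< = λ x x∈ p → +-monoˡ-≤ _ (below-strict (s≤s z≤n) (here refl) ≤-refl (s≤s p))
  ; capacity-≤ = λ x x∈ → x , x∈ , ≤-refl , ≤-refl
  }
Upper-Step h@(nf _ _ (e<c ∷ _) _) (inc₁ a≤e _ i) = Upper-bump h (urep (≤-<-trans a≤e e<c)) i head
Upper-Step h (inc₂ e<a cE i) = Upper-bump h i (DIns-last (<-trans e<a (a<c i)) cE) head
Upper-Step h (mid _ _ i j)   = Upper-bump h i j old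

-- The effect of inserting a into Y, as seen from the row above.
record Lower (Y : Row) (a : ℕ) (Y′ : Row) : Set where
  constructor lower
  field
    above-cases : ∀ {F f V F′ f′ V′} → Y ≡ row F f V → Y′ ≡ row F′ f′ V′ → ∀ s → s ∈ word Y′ →
        (s ∈ word Y × above s F′ ≤ above s F)
      ⊎ (s ≤ a × (above s F′ ≡ 0 ⊎ ∃ λ y → y ∈ word Y × a < y × above s F′ ≤ suc (above y F)))
    load-cases : ∀ {F f V} → Y ≡ row F f V → ∀ x →
        x ≤ minimum Y′
      ⊎ load Y′ x ≤ load Y x
      ⊎ (a < x × load Y′ x ≤ suc (load Y a))
      ⊎ (a < x × a ≤ f × load Y′ x ≤ 2 + length F)

open Lower

-- By ejecting `d` the upper row gains one unit of `above` at `d` and of `capacity` beyond `d`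
-- (`above-<`, `capacity-<`). This gain pays for what the lower row gains by receiving `d`.
fits-below : ∀ {X d X′ Y Y′} → Upper X d X′ → Lower Y d Y′ → NF Y → NF Y′ → X ▹ Y → X′ ▹ Y′
fits-below {row E e U} {d} {X′@(row E′ e′ U′)} {Y@(row F f V)} {Y′@(row F′ f′ V′)} u l hY hY′ j =
  fits (λ { refl refl → dom }) cap
  where
  open ≤-Reasoning
  X = row E e U
  dom : ∀ s → s ∈ word Y′ → suc (above s F′) ≤ above s (E′ ∷ʳ e′)
  dom s i with above-cases l refl refl s i
  ... | inj₁ (k , p) = ≤-trans (s≤s p) (≤-trans (dominate j refl refl s k) (above-≤ u refl refl s))
  ... | inj₂ (s≤d , inj₁ p) = begin
    suc (above s F′)             ≡⟨ cong suc p ⟩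
    1                            ≤⟨ s≤s z≤n ⟩
    suc (above (suc d) (E ∷ʳ e)) ≤⟨ above-< u refl refl (suc d) ≤-refl ⟩
    above d (E′ ∷ʳ e′)           ≤⟨ above-anti (E′ ∷ʳ e′) s≤d ⟩
    above s (E′ ∷ʳ e′)           ∎
  ... | inj₂ (s≤d , inj₂ (y , k , d<y , p)) = begin
    suc (above s F′)             ≤⟨ s≤s p ⟩
    suc (suc (above y F))        ≤⟨ s≤s (dominate j refl refl y k) ⟩
    suc (above y (E ∷ʳ e))       ≤⟨ above-< u refl refl y d<y ⟩
    above d (E′ ∷ʳ e′)           ≤⟨ above-anti (E′ ∷ʳ e′) s≤d ⟩
    above s (E′ ∷ʳ e′)           ∎
  dec-length : ∀ {F f V} → NF (row F f V) → above f F ≡ length F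
  dec-length (nf _ aF _ _) = above-all _ aF
  cap : ∀ x → x ∈ word X′ → suc (load Y′ x) ≤ capacity X′ x
  cap x i with load-cases l refl x
  -- Nothing of `f′ ∷ V′` is below `x`, so only `F′` counts, and `dominate` at `f′` bounds its
  -- length.
  ... | inj₁ x≤f′ = begin
    suc (below x (f′ ∷ V′) + length F′) ≡⟨ cong (λ k → suc (k + length F′)) (below-none (f′ ∷ V′) (low hY′)) ⟩
    suc (length F′)                     ≡⟨ cong suc (dec-length hY′) ⟨
    suc (above f′ F′)                   ≤⟨ dom f′ (∈-++⁺ʳ F′ (here refl)) ⟩
    above f′ (E′ ∷ʳ e′)                 ≤⟨ #-length _ (E′ ∷ʳ e′) ⟩
    length (E′ ∷ʳ e′)                   ≤⟨ m≤n+m _ (below (suc x) U′) ⟩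
    capacity X′ x                       ∎
    where
    low : ∀ {F′ V′} → NF (row F′ f′ V′) → All (x ≤_) (f′ ∷ V′)
    low (nf _ _ aV _) = x≤f′ ∷ All.map (λ p → ≤-trans x≤f′ (<⇒≤ p)) aV
  ... | inj₂ (inj₁ p) with capacity-≤ u x i
  ...   | y , k , x≤y , q = begin
    suc (load Y′ x) ≤⟨ s≤s p ⟩
    suc (load Y x)  ≤⟨ s≤s (load-mono Y x≤y) ⟩
    suc (load Y y)  ≤⟨ room j y k ⟩
    capacity X y    ≤⟨ q ⟩
    capacity X′ x   ∎
  cap x i | inj₂ (inj₂ (inj₁ (d<x , p))) = begin
    suc (load Y′ x)      ≤⟨ s≤s p ⟩
    suc (suc (load Y d)) ≤⟨ s≤s (room j d (bumped∈ u)) ⟩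
    suc (capacity X d)   ≤⟨ capacity-< u x i d<x ⟩
    capacity X′ x        ∎
  -- This happens when the old minimum `f` joins the decreasing part. Of the three units above
  -- `length F`, one comes from `dominate` at `f`, one from `d` itself, which lies in the old
  -- `E ∷ʳ e` but not above `f`, and one from `capacity-<`.
  cap x i | inj₂ (inj₂ (inj₂ (d<x , d≤f , p))) = begin
    suc (load Y′ x)                     ≤⟨ s≤s p ⟩
    3 + length F                        ≡⟨ cong (3 +_) (dec-length hY) ⟨
    3 + above f F                       ≤⟨ s≤s (s≤s (dominate j refl refl f (∈-++⁺ʳ F (here refl)))) ⟩
    2 + above f (E ∷ʳ e)                ≤⟨ s≤s (distinct u refl f d≤f) ⟩
    suc (length (E ∷ʳ e))               ≤⟨ s≤s (m≤n+m _ (below (suc d) U)) ⟩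
    suc (capacity X d)                  ≤⟨ capacity-< u x i d<x ⟩
    capacity X′ x                       ∎

fits-new : ∀ {X d X′} → Upper X d X′ → X′ ▹ row [] d []
fits-new {X@(row E e U)} {d} {X′@(row E′ e′ U′)} u = fits
  (λ { refl refl s (here refl) → begin
       suc (above d [])             ≡⟨ cong suc (above-none [] []) ⟩
       1                            ≤⟨ s≤s z≤n ⟩
       suc (above (suc d) (E ∷ʳ e)) ≤⟨ above-< u refl refl (suc d) ≤-refl ⟩
       above d (E′ ∷ʳ e′)           ∎
     ; refl refl s (there ()) })
  cap
  where
  open ≤-Reasoning
  pos : ∀ E {e : ℕ} → 1 ≤ length (E ∷ʳ e)
  pos []      = s≤s z≤n
  pos (_ ∷ _) = s≤s z≤n
  cap : ∀ x → x ∈ word X′ → suc (load (row [] d []) x) ≤ capacity X′ x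
  cap x i with d <? x
  ... | yes p = begin
    suc (below x (d ∷ []) + 0) ≡⟨ cong suc (+-identityʳ _) ⟩
    suc (below x (d ∷ []))     ≤⟨ s≤s (#-length _ (d ∷ [])) ⟩
    2                          ≤⟨ s≤s (≤-trans (pos E) (m≤n+m _ (below (suc d) U))) ⟩
    suc (capacity X d)         ≤⟨ capacity-< u x i p ⟩
    capacity X′ x              ∎
  ... | no p = begin
    suc (below x (d ∷ []) + 0) ≡⟨ cong (λ k → suc (k + 0)) (below-none (d ∷ []) (≮⇒≥ p ∷ [])) ⟩
    1                          ≤⟨ ≤-trans (pos E′) (m≤n+m _ (below (suc x) U′)) ⟩
    capacity X′ x              ∎

nearest : ∀ {F f V} a → NF (row F f V) →
  above a F ≡ 0 ⊎ (∃ λ y → y ∈ word (row F f V) × a < y × above a (F ∷ʳ f) ≤ suc (above y F))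
nearest {F} {f} {V} a h with nearest-above a (NF-dec h)
... | inj₁ p = inj₁ (n≤0⇒n≡0 (≤-trans (#-≤∷ʳ (a <ᵇ_) F f) (≤-reflexive p)))
... | inj₂ (y , i , q , r) = inj₂ (y , ∈-word i , q ,
      ≤-trans r (≤-reflexive (cong suc (above-dec F (NF-min h (∈-word i))))))

Lower-App : ∀ {Y a Y′} → NF Y → App Y a Y′ → Lower Y a Y′
Lower-App h (appUp {F} {f} {V} {a} V<a) = lower (λ { refl refl s i → cases s i }) (λ { refl x → loads x })
  where
  open ≤-Reasoning
  cases : ∀ s → s ∈ F ++ f ∷ V ∷ʳ a → _
  cases s i with ∈-++⁻ (F ++ f ∷ V) (subst (s ∈_) (sym (++-assoc F (f ∷ V) (a ∷ []))) i)
  ... | inj₁ k = inj₁ (k , ≤-refl)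
  ... | inj₂ (here refl) with nearest a h
  ...   | inj₁ p               = inj₂ (≤-refl , inj₁ p)
  ...   | inj₂ (y , k , p , q) = inj₂ (≤-refl , inj₂ (y , k , p , ≤-trans (#-≤∷ʳ (a <ᵇ_) F f) q))
  loads : ∀ x → _
  loads x with a <? x
  ... | no p  = inj₂ (inj₁ (≤-reflexive (cong (_+ length F) (#-∷ʳ-no (f ∷ V) (<ᵇ-false (≮⇒≥ p))))))
  ... | yes p = inj₂ (inj₂ (inj₁ (p , +-monoˡ-≤ (length F) (begin
    below x (f ∷ V ∷ʳ a)  ≤⟨ #-∷ʳ-≤suc (_<ᵇ x) (f ∷ V) a ⟩
    suc (below x (f ∷ V)) ≤⟨ s≤s (#-length _ (f ∷ V)) ⟩
    suc (length (f ∷ V))  ≡⟨ cong suc (below-all (f ∷ V) V<a) ⟨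
    suc (below a (f ∷ V)) ∎))))
Lower-App h (appDn {F} {f} {a} a<f) = lower (λ { refl refl s i → cases s i }) (λ { refl x → loads x })
  where
  open ≤-Reasoning
  cases : ∀ s → s ∈ (F ∷ʳ f) ++ a ∷ [] → _
  cases s i with ∈-++⁻ (F ∷ʳ f) i
  ... | inj₁ k = inj₁ (k , ≤-reflexive (above-dec F (NF-min h k)))
  ... | inj₂ (here refl) with nearest a h
  ...   | inj₂ (y , k , p , q) = inj₂ (≤-refl , inj₂ (y , k , p , q))
  ...   | inj₁ p               = inj₂ (≤-refl , inj₂ (f , ∈-++⁺ʳ F (here refl) , a<f , (begin
    above a (F ∷ʳ f)  ≤⟨ #-∷ʳ-≤suc (a <ᵇ_) F f ⟩
    suc (above a F)   ≡⟨ cong suc p ⟩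
    1                 ≤⟨ s≤s z≤n ⟩
    suc (above f F)   ∎)))
  loads : ∀ x → _
  loads x with a <? x
  ... | no p  = inj₁ (≮⇒≥ p)
  ... | yes p = inj₂ (inj₂ (inj₂ (p , <⇒≤ a<f , (begin
    below x (a ∷ []) + length (F ∷ʳ f) ≤⟨ +-mono-≤ (#-length _ (a ∷ [])) (≤-reflexive (length-∷ʳ F f)) ⟩
    2 + length F                       ∎))))

Lower-bump : ∀ {F f V a V₁ c F₁ d Y′} → NF (row F f V) → UIns V a V₁ c → DIns (F ∷ʳ f) c F₁ d →
  Norm F₁ V₁ Y′ →
  (∀ x → x ≤ minimum Y′
       ⊎ load Y′ x ≤ load (row F f V) x
       ⊎ (a < x × load Y′ x ≤ suc (load (row F f V) a))
       ⊎ (a < x × a ≤ f × load Y′ x ≤ 2 + length F)) →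
  Lower (row F f V) a Y′
Lower-bump {F} {f} {V} {a} {V₁} {c} {F₁} {d} h@(nf _ _ aV pV) i j n loads =
  lower (λ { refl refl s k → cases n s k }) (λ { refl → loads })
  where
  open ≤-Reasoning
  Goal : List ℕ → ℕ → Set
  Goal F′ s = (s ∈ F ++ f ∷ V × above s F′ ≤ above s F)
            ⊎ (s ≤ a × (above s F′ ≡ 0 ⊎ ∃ λ y → y ∈ F ++ f ∷ V × a < y × above s F′ ≤ suc (above y F)))
  c∈ : c ∈ F ++ f ∷ V
  c∈ = ∈-++⁺ʳ F (there (c∈U i))
  f≤c = NF-min h c∈
  weaken : ∀ {s F′ F″} → above s F′ ≤ above s F″ → Goal F″ s → Goal F′ s
  weaken p (inj₁ (k , q))            = inj₁ (k , ≤-trans p q)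
  weaken p (inj₂ (k , inj₁ q))       = inj₂ (k , inj₁ (n≤0⇒n≡0 (≤-trans p (≤-reflexive q))))
  weaken p (inj₂ (k , inj₂ (y , l , q , r))) = inj₂ (k , inj₂ (y , l , q , ≤-trans p r))
  typeA : ∀ s → s ∈ F ++ f ∷ V → above s F₁ ≤ above s (F ∷ʳ f) → Goal F₁ s
  typeA s k p = inj₁ (k , ≤-trans p (≤-reflexive (above-dec F (NF-min h k))))
  raw : ∀ s → s ∈ F₁ ⊎ s ∈ V₁ → Goal F₁ s
  raw s (inj₁ k) with DIns-∈ j (NF-dec h) k
  ... | inj₁ refl    = typeA s c∈ (DIns-above-≥ j ≤-refl)
  ... | inj₂ (l , p) = typeA s (∈-word l) p
  raw s (inj₂ k) with c ≤? s | UIns-∈ i pV k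
  ... | yes p | inj₁ l          = typeA s (∈-++⁺ʳ F (there l)) (DIns-above-≥ j p)
  ... | yes p | inj₂ (refl , _) = contradiction p (<⇒≱ (a<c i))
  ... | no p  | l with s ≤? a | DIns-above-< j (NF-dec h) (≰⇒> p)
  ...   | no q  | _      = contradiction (UIns-≤′ i pV k (≰⇒> q)) p
  ...   | yes q | inj₂ r = inj₂ (q , inj₂ (c , c∈ , a<c i , ≤-trans r (≤-reflexive (cong suc (above-dec F f≤c)))))
  raw s (inj₂ k) | no p | inj₁ l | yes q | inj₁ r = typeA s (∈-++⁺ʳ F (there l)) r
  raw s (inj₂ k) | no p | inj₂ (refl , _) | yes q | inj₁ r with nearest-above a (NF-dec h)
  ... | inj₁ t = inj₂ (q , inj₁ (n≤0⇒n≡0 (≤-trans r (≤-reflexive t))))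
  ... | inj₂ (y , l , t , v) = inj₂ (q , inj₂ (y , ∈-word l , t ,
          ≤-trans r (≤-trans v (≤-reflexive (cong suc (above-dec F (NF-min h (∈-word l))))))))
  cases : ∀ {F′ f′ V′} → Norm F₁ V₁ (row F′ f′ V′) → ∀ s → s ∈ F′ ++ f′ ∷ V′ → Goal F′ s
  cases (old {F′} {f′} {V′}) s k = weaken (#-≤∷ʳ (s <ᵇ_) F′ f′)
    (raw s (∈-++⁻ (F′ ∷ʳ f′) (subst (s ∈_) (sym (++-assoc F′ (f′ ∷ []) V′)) k)))
  cases (head {F′}) s k = raw s (∈-++⁻ F′ k)

Lower-Step : ∀ {Y a Y′ d} → NF Y → Step Y a Y′ d → Lower Y a Y′
Lower-Step h (s101 F V) = lower (λ { refl refl s i → inj₁ (i , ≤-refl) }) (λ { refl x → inj₂ (inj₁ ≤-refl) })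
Lower-Step h@(nf _ _ (f<c ∷ _) (c<V ∷ _)) (inc₁ {F} {f} {c} {V} {a} {D} a≤f aD i) =
  Lower-bump h (urep (≤-<-trans a≤f f<c)) i head loads
  where
  open ≤-Reasoning
  len : length D ≡ suc (length F)
  len = trans (DIns-length i) (length-∷ʳ F f)
  loads : ∀ x → _
  loads x with a <? x | c <? x
  ... | no p  | _ = inj₁ (≮⇒≥ p)
  ... | yes p | yes q = inj₂ (inj₁ (≤-reflexive (begin-equality
    below x (a ∷ V) + length D             ≡⟨ cong₂ _+_ (below-yes V p) len ⟩
    suc (below x V) + suc (length F)       ≡⟨ +-suc (suc (below x V)) (length F) ⟩
    suc (suc (below x V)) + length F       ≡⟨ cong (λ k → suc k + length F) (below-yes V q) ⟨
    suc (below x (c ∷ V)) + length F       ≡⟨ cong (_+ length F) (below-yes (c ∷ V) (<-trans f<c q)) ⟨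
    below x (f ∷ c ∷ V) + length F         ∎)))
  ... | yes p | no q = inj₂ (inj₂ (inj₂ (p , a≤f , (begin
    below x (a ∷ V) + length D             ≡⟨ cong₂ _+_ (below-yes V p) len ⟩
    suc (below x V) + suc (length F)       ≡⟨ cong (λ k → suc k + suc (length F))
                                                (below-none V (All.map (λ c<z → <⇒≤ (≤-<-trans (≮⇒≥ q) c<z)) c<V)) ⟩
    2 + length F                           ∎))))
Lower-Step h@(nf _ _ aV pV) (inc₂ {F} {f} {V} {a} {c} {u} {V′} f<a cF i) =
  Lower-bump h i (DIns-last (<-trans f<a (a<c i)) cF) head loads
  where
  open ≤-Reasoning
  f<u : f < u
  f<u = All.head (UIns-All i f<a aV)
  shift : ∀ {k k′ x} → f < x → k ≤ k′ → k + length (F ∷ʳ c) ≤ suc k′ + length F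
  shift {k} {k′} _ p = begin
    k + length (F ∷ʳ c)   ≡⟨ cong (k +_) (length-∷ʳ F c) ⟩
    k + suc (length F)    ≡⟨ +-suc k (length F) ⟩
    suc k + length F      ≤⟨ +-monoˡ-≤ (length F) (s≤s p) ⟩
    suc k′ + length F     ∎
  loads : ∀ x → _
  loads x with f <? x | UIns-below-new x i pV
  ... | no p  | _            = inj₁ (<⇒≤ (≤-<-trans (≮⇒≥ p) f<u))
  ... | yes p | inj₁ q       = inj₂ (inj₁ (≤-trans (shift p q)
                                 (≤-reflexive (cong (_+ length F) (sym (below-yes V p))))))
  ... | yes p | inj₂ (r , q) = inj₂ (inj₂ (inj₁ (r , ≤-trans (shift p q)
                                 (≤-reflexive (cong (λ k → suc k + length F) (sym (below-yes V f<a)))))))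
Lower-Step h@(nf _ _ aV pV) (mid {F} {f} {V} {a} {c} {V′} {F′} f<a any i j) =
  Lower-bump h i j old loads
  where
  open ≤-Reasoning
  len : length F′ ≡ length F
  len = suc-injective (trans (sym (length-∷ʳ F′ f)) (trans (DIns-length j) (length-∷ʳ F f)))
  loads : ∀ x → _
  loads x with UIns-below-new x i pV
  ... | inj₁ q       = inj₂ (inj₁ (+-mono-≤ (#-cons-mono (_<ᵇ x) f q) (≤-reflexive len)))
  ... | inj₂ (r , q) = inj₂ (inj₂ (inj₁ (r , +-mono-≤ (begin
    below x (f ∷ V′)      ≡⟨ below-yes V′ (<-trans f<a r) ⟩
    suc (below x V′)      ≤⟨ s≤s q ⟩
    suc (suc (below a V)) ≡⟨ cong suc (below-yes V f<a) ⟨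
    suc (below a (f ∷ V)) ∎) (≤-reflexive len))))

-- What has to be checked is the room at the entries of the lengthened row. Where the old bound does
-- not give it, the load is at most the length of `Y`, which is smaller than that of `X` by
-- `▹-length`.
fits-App : ∀ {X a X′ Y} → NF X → NF Y → App X a X′ → X ▹ Y → X′ ▹ Y
fits-App {Y = Y@(row F f V)} h hY (appUp {E} {e} {U} {a} U<a) j = fits (λ { refl refl → dominate j refl refl }) cap
  where
  open ≤-Reasoning
  cap : ∀ x → x ∈ E ++ e ∷ U ∷ʳ a → suc (load Y x) ≤ capacity (row E e (U ∷ʳ a)) x
  cap x i with ∈-++⁻ (E ++ e ∷ U) (subst (x ∈_) (sym (++-assoc E (e ∷ U) (a ∷ []))) i)
  ... | inj₁ k = ≤-trans (room j x k) (+-monoˡ-≤ _ (#-≤∷ʳ (_<ᵇ suc x) U a))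
  ... | inj₂ (here refl) = begin
    suc (load Y a)                             ≤⟨ s≤s (load-≤length Y a) ⟩
    suc (length (word Y))                      ≤⟨ ▹-length h hY j ⟩
    length (E ++ e ∷ U)                        ≡⟨ cong length (++-assoc E (e ∷ []) U) ⟨
    length ((E ∷ʳ e) ++ U)                     ≡⟨ length-++ (E ∷ʳ e) ⟩
    length (E ∷ʳ e) + length U                 ≡⟨ +-comm (length (E ∷ʳ e)) _ ⟩
    length U + length (E ∷ʳ e)                 ≡⟨ cong (_+ _) (below-all U (All.map m<n⇒m<1+n (All.tail U<a))) ⟨
    below (suc a) U + length (E ∷ʳ e)          ≤⟨ +-monoˡ-≤ _ (#-≤∷ʳ (_<ᵇ suc a) U a) ⟩
    below (suc a) (U ∷ʳ a) + length (E ∷ʳ e)   ∎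
fits-App {Y = Y@(row F f V)} h hY (appDn {E} {e} {a} a<e) j =
  fits (λ { refl refl s i → ≤-trans (dominate j refl refl s i) (#-≤∷ʳ (s <ᵇ_) (E ∷ʳ e) a) }) cap
  where
  open ≤-Reasoning
  cap : ∀ x → x ∈ (E ∷ʳ e) ++ a ∷ [] → suc (load Y x) ≤ capacity (row (E ∷ʳ e) a []) x
  cap x i = begin
    suc (load Y x)                                ≤⟨ s≤s (load-≤length Y x) ⟩
    suc (length (word Y))                         ≤⟨ ▹-length h hY j ⟩
    length (E ∷ʳ e)                               ≤⟨ n≤1+n _ ⟩
    suc (length (E ∷ʳ e))                         ≡⟨ length-∷ʳ (E ∷ʳ e) a ⟨
    length (E ∷ʳ e ∷ʳ a)                          ≤⟨ m≤n+m _ (below (suc x) []) ⟩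
    below (suc x) [] + length (E ∷ʳ e ∷ʳ a)       ∎

Ins-▹ : ∀ {Xs a Xs′ r} → All NF Xs → Ins Xs a Xs′ r → Linked _▹_ Xs → Linked _▹_ Xs′
Ins-▹ _ new _ = [-]
Ins-▹ (h ∷ hs) (app s) [-] = [-]
Ins-▹ (h ∷ h′ ∷ hs) (app s) (j ∷ js) = fits-App h h′ s j ∷ js
Ins-▹ (h ∷ hs) (bump s new) [-] = fits-new (Upper-Step h s) ∷ [-]
Ins-▹ (h ∷ h′ ∷ hs) (bump s i@(app t)) (j ∷ js) =
  fits-below (Upper-Step h s) (Lower-App h′ t) h′ (App-NF h′ t) j ∷ Ins-▹ (h′ ∷ hs) i js
Ins-▹ (h ∷ h′ ∷ hs) (bump s i@(bump t _)) (j ∷ js) =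
  fits-below (Upper-Step h s) (Lower-Step h′ t) h′ (Step-NF h′ t) j ∷ Ins-▹ (h′ ∷ hs) i js

-- Shifted primed tableaux, entry by entry

-- The second index counts from the diagonal: `entry T r j` lies in column `r + j`, so the box below
-- `(r , suc j)` is `(suc r , j)`.
entry : Tab → ℕ → ℕ → Maybe PL
entry T r j = nth (rowAt T r) j

code-injective : ∀ x y → code x ≡ code y → x ≡ y
code-injective (primed i) (primed j) p = cong primed (*-cancelˡ-≡ i j 2 p)
code-injective (plain i)  (plain j)  p = cong plain (*-cancelˡ-≡ i j 2 (suc-injective p))
code-injective (primed i) (plain j)  p = contradiction p (even≢odd i j)
code-injective (plain i)  (primed j) p = contradiction (sym p) (even≢odd j i)

plain-positive : ∀ {v} → 2 ≤ code (plain v) → 1 ≤ v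
plain-positive {suc v} _ = s≤s z≤n
plain-positive {zero} (s≤s ())

primed-positive : ∀ {v} → 2 ≤ code (primed v) → 1 ≤ v
primed-positive {suc v} _ = s≤s z≤n

infix 4 _≤ʳ_ _≤ᶜ_

-- Equality is allowed along rows only for unprimed letters and down columns only for primed ones:
-- at most one `i'` per row and one `i` per column.
_≤ʳ_ _≤ᶜ_ : PL → PL → Set
x ≤ʳ y = code x < code y ⊎ (x ≡ y × isPrimed x ≡ false)
x ≤ᶜ y = code x < code y ⊎ (x ≡ y × isPrimed x ≡ true)

≤ʳ⇒≤ : ∀ {x y} → x ≤ʳ y → code x ≤ code y
≤ʳ⇒≤ (inj₁ p)          = <⇒≤ p
≤ʳ⇒≤ (inj₂ (refl , _)) = ≤-refl

≤ᶜ⇒≤ : ∀ {x y} → x ≤ᶜ y → code x ≤ code y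
≤ᶜ⇒≤ (inj₁ p)          = <⇒≤ p
≤ᶜ⇒≤ (inj₂ (refl , _)) = ≤-refl

≤⇒≤ʳplain : ∀ {v z} → code (plain v) ≤ code z → plain v ≤ʳ z
≤⇒≤ʳplain {v} {z} p with m≤n⇒m<n∨m≡n p
... | inj₁ q = inj₁ q
... | inj₂ q = inj₂ (code-injective (plain v) z q , refl)

≤⇒≤ᶜprimed : ∀ {v z} → code (primed v) ≤ code z → primed v ≤ᶜ z
≤⇒≤ᶜprimed {v} {z} p with m≤n⇒m<n∨m≡n p
... | inj₁ q = inj₁ q
... | inj₂ q = inj₂ (code-injective (primed v) z q , refl)

≤ᶜplain⇒< : ∀ {x v} → x ≤ᶜ plain v → code x < code (plain v)
≤ᶜplain⇒< (inj₁ p)           = p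
≤ᶜplain⇒< (inj₂ (refl , ()))

≤ʳprimed⇒< : ∀ {x v} → x ≤ʳ primed v → code x < code (primed v)
≤ʳprimed⇒< (inj₁ p)           = p
≤ʳprimed⇒< (inj₂ (refl , ()))

-- The row condition of a strict partition is the existence of the box above each box (shape).
record Valid (T : Tab) : Set where
  field
    row-≤ : ∀ {r j x y} → entry T r j ≡ just x → entry T r (suc j) ≡ just y → x ≤ʳ y
    col-≤ : ∀ {r j x y} → entry T r (suc j) ≡ just x → entry T (suc r) j ≡ just y → x ≤ᶜ y
    shape : ∀ {r j y} → entry T (suc r) j ≡ just y → ∃ λ x → entry T r (suc j) ≡ just x
    diag  : ∀ {r x} → entry T r 0 ≡ just x → isPrimed x ≡ false
    low   : ∀ {r j x} → entry T r j ≡ just x → 2 ≤ code x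
    full  : ∀ {r} → r < length T → ∃ λ x → entry T r 0 ≡ just x

open Valid

-- Replacing a single entry

module _ {A : Set} where

  nth-set-same : ∀ (L : List A) i {y} e → nth L i ≡ just y → nth (setNth L i e) i ≡ just e
  nth-set-same (x ∷ L) zero    e _ = refl
  nth-set-same (x ∷ L) (suc i) e p = nth-set-same L i e p

  nth-set-other : ∀ (L : List A) i k e → i ≢ k → nth (setNth L i e) k ≡ nth L k
  nth-set-other []      i       k       e _ = refl
  nth-set-other (x ∷ L) zero    zero    e p = contradiction refl p
  nth-set-other (x ∷ L) zero    (suc k) e p = refl
  nth-set-other (x ∷ L) (suc i) zero    e p = refl
  nth-set-other (x ∷ L) (suc i) (suc k) e p = nth-set-other L i k e (p ∘ cong suc)

  length-setNth : ∀ (L : List A) i e → length (setNth L i e) ≡ length L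
  length-setNth []      i       e = refl
  length-setNth (x ∷ L) zero    e = refl
  length-setNth (x ∷ L) (suc i) e = cong suc (length-setNth L i e)

  setNth-setNth : ∀ (L : List A) i e {y} → nth L i ≡ just y → setNth (setNth L i e) i y ≡ L
  setNth-setNth (x ∷ L) zero    e refl = refl
  setNth-setNth (x ∷ L) (suc i) e p    = cong (x ∷_) (setNth-setNth L i e p)

  nth-prefix : ∀ (L : List A) {i k y} → nth L i ≡ just y → k ≤ i → ∃ λ x → nth L k ≡ just x
  nth-prefix (x ∷ L) {k = zero}  p _             = x , refl
  nth-prefix (x ∷ L) {suc i} {suc k} p (s≤s q) = nth-prefix L p q

  nth-beyond : ∀ (L : List A) k i → nth L (length L + k + i) ≡ nothing
  nth-beyond []      k i = refl
  nth-beyond (x ∷ L) k i = nth-beyond L k i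

  nth-< : ∀ (L : List A) {i x} → nth L i ≡ just x → i < length L
  nth-< (y ∷ L) {zero}  p = z<s
  nth-< (y ∷ L) {suc i} p = s<s (nth-< L p)

module _ {A : Set} where

  rowAt-just : ∀ (T : List (List A)) r {j x} → nth (rowAt T r) j ≡ just x → nth T r ≡ just (rowAt T r)
  rowAt-just (R ∷ T) zero    p = refl
  rowAt-just (R ∷ T) (suc r) p = rowAt-just T r p

  rowAt-other : ∀ (T : List (List A)) r k R → r ≢ k → rowAt (setNth T r R) k ≡ rowAt T k
  rowAt-other T r k R p = cong (fromMaybe []) (nth-set-other T r k R p)

  rowAt-same : ∀ (T : List (List A)) r {R₀} R → nth T r ≡ just R₀ → rowAt (setNth T r R) r ≡ R
  rowAt-same T r R p = cong (fromMaybe []) (nth-set-same T r R p)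

entry-same : ∀ T r j {y} e → entry T r j ≡ just y → entry (replaceAt T r j e) r j ≡ just e
entry-same T r j e p = trans (cong (λ R → nth R j) (rowAt-same T r _ (rowAt-just T r p)))
                             (nth-set-same (rowAt T r) j e p)

entry-other : ∀ T r j {y} e r′ j′ → entry T r j ≡ just y → r ≢ r′ ⊎ j ≢ j′ →
  entry (replaceAt T r j e) r′ j′ ≡ entry T r′ j′
entry-other T r j e r′ j′ p q with r ≟ r′
... | no r≢    = cong (λ R → nth R j′) (rowAt-other T r r′ _ r≢)
entry-other T r j e r j′ p (inj₁ q) | yes refl = contradiction refl q
entry-other T r j e r j′ p (inj₂ q) | yes refl =
  trans (cong (λ R → nth R j′) (rowAt-same T r _ (rowAt-just T r p)))
        (nth-set-other (rowAt T r) j j′ e q)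

replace-back : ∀ T r j {y} e → entry T r j ≡ just y → replaceAt (replaceAt T r j e) r j y ≡ T
replace-back T r j {y} e p = trans
  (cong (λ R → setNth (setNth T r (setNth (rowAt T r) j e)) r (setNth R j y))
        (rowAt-same T r _ (rowAt-just T r p)))
  (trans (cong (setNth (setNth T r _) r) (setNth-setNth (rowAt T r) j e p))
         (setNth-setNth T r _ (rowAt-just T r p)))

entry-cases : ∀ T r j {y} e r′ j′ {x} → entry T r j ≡ just y → entry (replaceAt T r j e) r′ j′ ≡ just x →
  (r′ ≡ r × j′ ≡ j × x ≡ e) ⊎ ((r ≢ r′ ⊎ j ≢ j′) × entry T r′ j′ ≡ just x)
entry-cases T r j e r′ j′ p q with r ≟ r′ | j ≟ j′
... | yes refl | yes refl = inj₁ (refl , refl , just-injective (trans (sym q) (entry-same T r j e p)))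
... | no n     | _        = inj₂ (inj₁ n , trans (sym (entry-other T r j e r′ j′ p (inj₁ n))) q)
... | yes _    | no n     = inj₂ (inj₂ n , trans (sym (entry-other T r j e r′ j′ p (inj₂ n))) q)

entry-keep : ∀ T r j {y} e r′ j′ {x} → entry T r j ≡ just y → entry T r′ j′ ≡ just x →
  ∃ λ x′ → entry (replaceAt T r j e) r′ j′ ≡ just x′
entry-keep T r j e r′ j′ p q with r ≟ r′ | j ≟ j′
... | yes refl | yes refl = e , entry-same T r j e p
... | no n     | _        = _ , trans (entry-other T r j e r′ j′ p (inj₁ n)) q
... | yes _    | no n     = _ , trans (entry-other T r j e r′ j′ p (inj₂ n)) q

Valid-replace : ∀ {T r j y e} → Valid T → entry T r j ≡ just y →
  (∀ {j′ x} → j ≡ suc j′ → entry T r j′ ≡ just x → x ≤ʳ e) →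
  (∀ {z} → entry T r (suc j) ≡ just z → e ≤ʳ z) →
  (∀ {r′ x} → r ≡ suc r′ → entry T r′ (suc j) ≡ just x → x ≤ᶜ e) →
  (∀ {j′ z} → j ≡ suc j′ → entry T (suc r) j′ ≡ just z → e ≤ᶜ z) →
  (j ≡ 0 → isPrimed e ≡ false) → 2 ≤ code e → Valid (replaceAt T r j e)
Valid-replace {T} {r} {j} {y} {e} V p left right north south dg lw = record
  { row-≤ = λ {r′} {j′} → rw r′ j′
  ; col-≤ = λ {r′} {j′} → cl r′ j′
  ; shape = λ {r′} {j′} → sh r′ j′
  ; diag  = λ {r′} → di r′
  ; low   = λ {r′} {j′} → lo r′ j′
  ; full  = λ {r′} q → let x , s = full V (subst (r′ <_) (length-setNth T r _) q) in entry-keep T r j e r′ 0 p s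
  }
  where
  T₁ = replaceAt T r j e
  rw : ∀ r′ j′ {x z} → entry T₁ r′ j′ ≡ just x → entry T₁ r′ (suc j′) ≡ just z → x ≤ʳ z
  rw r′ j′ q s with entry-cases T r j e r′ j′ p q | entry-cases T r j e r′ (suc j′) p s
  ... | inj₁ (refl , refl , refl) | inj₁ (_ , () , _)
  ... | inj₁ (refl , refl , refl) | inj₂ (_ , s′) = right s′
  ... | inj₂ (_ , q′) | inj₁ (refl , eq , refl) = left (sym eq) q′
  ... | inj₂ (_ , q′) | inj₂ (_ , s′) = row-≤ V q′ s′
  cl : ∀ r′ j′ {x z} → entry T₁ r′ (suc j′) ≡ just x → entry T₁ (suc r′) j′ ≡ just z → x ≤ᶜ z
  cl r′ j′ q s with entry-cases T r j e r′ (suc j′) p q | entry-cases T r j e (suc r′) j′ p s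
  ... | inj₁ (refl , refl , refl) | inj₁ (() , _)
  ... | inj₁ (refl , eq , refl) | inj₂ (_ , s′) = south (sym eq) s′
  ... | inj₂ (_ , q′) | inj₁ (eq , refl , refl) = north (sym eq) q′
  ... | inj₂ (_ , q′) | inj₂ (_ , s′) = col-≤ V q′ s′
  sh : ∀ r′ j′ {z} → entry T₁ (suc r′) j′ ≡ just z → ∃ λ x → entry T₁ r′ (suc j′) ≡ just x
  sh r′ j′ s with entry-cases T r j e (suc r′) j′ p s
  ... | inj₁ (refl , refl , refl) = let x , q = shape V p in entry-keep T r j e r′ (suc j′) p q
  ... | inj₂ (_ , s′) = let x , q = shape V s′ in entry-keep T r j e r′ (suc j′) p q
  di : ∀ r′ {x} → entry T₁ r′ 0 ≡ just x → isPrimed x ≡ false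
  di r′ q with entry-cases T r j e r′ 0 p q
  ... | inj₁ (_ , eq , refl) = dg (sym eq)
  ... | inj₂ (_ , q′) = diag V q′
  lo : ∀ r′ j′ {x} → entry T₁ r′ j′ ≡ just x → 2 ≤ code x
  lo r′ j′ q with entry-cases T r j e r′ j′ p q
  ... | inj₁ (_ , _ , refl) = lw
  ... | inj₂ (_ , q′) = low V q′

row-mono : ∀ {T r j x z} → Valid T → ∀ k → entry T r j ≡ just x → entry T r (k + j) ≡ just z → code x ≤ code z
row-mono V zero p q = ≤-reflexive (cong code (just-injective (trans (sym p) q)))
row-mono {T} {r} {j} V (suc k) p q with nth-prefix (rowAt T r) q (n≤1+n (k + j))
... | y , s = ≤-trans (row-mono V k p s) (≤ʳ⇒≤ (row-≤ V s q))

row-mono′ : ∀ {T r j k x z} → Valid T → j ≤ k → entry T r j ≡ just x → entry T r k ≡ just z → code x ≤ code z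
row-mono′ {T} {r} {j} {k} V j≤k p q =
  row-mono V (k ∸ j) p (subst (λ i → entry T r i ≡ just _) (sym (m∸n+n≡m j≤k)) q)

col-up : ∀ {T} → Valid T → ∀ r {j y} → entry T r j ≡ just y → ∀ {k} → k ≤ r →
  ∃ λ x → entry T k (r + j ∸ k) ≡ just x × code x ≤ code y
col-up {T} V r {j} p {k} k≤r with m≤n⇒m<n∨m≡n k≤r
... | inj₂ refl = _ , subst (λ i → entry T r i ≡ just _) (sym (m+n∸m≡n r j)) p , ≤-refl
col-up {T} V (suc r) {j} p {k} k≤r | inj₁ (s≤s k≤r′) with shape V p
... | x , q with col-up V r q k≤r′
... | x′ , q′ , s = x′ , subst (λ i → entry T k (i ∸ k) ≡ just x′) (+-suc r j) q′ , ≤-trans s (≤ᶜ⇒≤ (col-≤ V q p))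

col-mono : ∀ {T r j r′ j′ x z} → Valid T → r ≤ r′ → r + j ≡ r′ + j′ →
  entry T r j ≡ just x → entry T r′ j′ ≡ just z → code x ≤ code z
col-mono {T} {r} {j} {r′} {j′} V r≤r′ eq p q with col-up V r′ q r≤r′
... | x′ , s , t = subst (λ w → code w ≤ _) (just-injective (trans (sym s) (trans (cong (entry T r) idx) p))) t
  where
  idx : r′ + j′ ∸ r ≡ j
  idx = trans (cong (_∸ r) (sym eq)) (m+n∸m≡n r j)

-- Locating the entry to be bumped

firstGreater-hit : ∀ x y L → code y < code x → firstGreater (x ∷ L) y ≡ just 0
firstGreater-hit x y L p rewrite <ᵇ-true p = refl

firstGreater-skip : ∀ x y L → code x ≤ code y → firstGreater (x ∷ L) y ≡ Maybe.map suc (firstGreater L y)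
firstGreater-skip x y L p rewrite <ᵇ-false {code y} {code x} p = refl

firstGreater-at : ∀ L {y e} i → nth L i ≡ just e → code y < code e →
  (∀ {k x} → k < i → nth L k ≡ just x → code x ≤ code y) → firstGreater L y ≡ just i
firstGreater-at (x ∷ L) {y} zero    refl p h = firstGreater-hit x y L p
firstGreater-at (x ∷ L) {y} (suc i) q    p h =
  trans (firstGreater-skip x y L (h z<s refl)) (cong (Maybe.map suc) (firstGreater-at L i q p (λ s → h (s<s s))))

firstGreater-none : ∀ L {y} → (∀ {k x} → nth L k ≡ just x → code x ≤ code y) → firstGreater L y ≡ nothing
firstGreater-none []      h = refl
firstGreater-none (x ∷ L) {y} h =
  trans (firstGreater-skip x y L (h {0} refl)) (cong (Maybe.map suc) (firstGreater-none L (λ {k} → h {suc k})))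

colGo-here : ∀ R T {i c e} → i ≤ c → nth R (c ∸ i) ≡ just e → colGo (R ∷ T) i c ≡ e ∷ colGo T (suc i) c
colGo-here R T p q rewrite ≤ᵇ-true p | q = refl

colGo-stop : ∀ R T {i c} → i ≤ c → nth R (c ∸ i) ≡ nothing → colGo (R ∷ T) i c ≡ []
colGo-stop R T p q rewrite ≤ᵇ-true p | q = refl

-- `i` is the index, in the whole tableau, of the first row of `T`; row `k` of `T` therefore meets
-- column `c` at the offset `c ∸ (i + k)`.
colGo-at : ∀ T i c {y e} h → i + h ≤ c →
  (∀ {k} → k < h → ∃ λ x → entry T k (c ∸ (i + k)) ≡ just x × code x ≤ code y) →
  entry T h (c ∸ (i + h)) ≡ just e → code y < code e →
  firstGreater (colGo T i c) y ≡ just h × nth (colGo T i c) h ≡ just e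
colGo-at [] i c (suc h) b f p q with f z<s
... | _ , () , _
colGo-at (R ∷ T) i c {y} {e} zero b f p q =
    trans (cong (λ L → firstGreater L y) eq) (firstGreater-hit e y (colGo T (suc i) c) q)
  , cong (λ L → nth L 0) eq
  where eq = colGo-here R T (subst (_≤ c) (+-identityʳ i) b) (subst (λ m → nth R (c ∸ m) ≡ just e) (+-identityʳ i) p)
colGo-at (R ∷ T) i c {y} {e} (suc h) b f p q with f z<s
... | x , s , x≤y with colGo-at T (suc i) c {y} {e} h (subst (_≤ c) (+-suc i h) b)
         (λ {k} k<h → subst (λ m → ∃ λ x → entry T k (c ∸ m) ≡ just x × code x ≤ code y) (+-suc i k) (f (s<s k<h)))
         (subst (λ m → entry T h (c ∸ m) ≡ just e) (+-suc i h) p) q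
... | t , u =
    trans (cong (λ L → firstGreater L y) eq)
      (trans (firstGreater-skip x y (colGo T (suc i) c) x≤y) (cong (Maybe.map suc) t))
  , trans (cong (λ L → nth L (suc h)) eq) u
  where eq = colGo-here R T (≤-trans (m≤m+n i (suc h)) b) (subst (λ m → nth R (c ∸ m) ≡ just x) (+-identityʳ i) s)

colGo-end : ∀ T i c {y} h → i + h ≤ c →
  (∀ {k} → k < h → ∃ λ x → entry T k (c ∸ (i + k)) ≡ just x × code x ≤ code y) →
  entry T h (c ∸ (i + h)) ≡ nothing →
  firstGreater (colGo T i c) y ≡ nothing × length (colGo T i c) ≡ h
colGo-end [] i c zero    b f p = refl , refl
colGo-end [] i c (suc h) b f p with f z<s
... | _ , () , _
colGo-end (R ∷ T) i c {y} zero b f p =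
    cong (λ L → firstGreater L y) eq , cong length eq
  where eq = colGo-stop R T (subst (_≤ c) (+-identityʳ i) b) (subst (λ m → nth R (c ∸ m) ≡ nothing) (+-identityʳ i) p)
colGo-end (R ∷ T) i c {y} (suc h) b f p with f z<s
... | x , s , x≤y with colGo-end T (suc i) c {y} h (subst (_≤ c) (+-suc i h) b)
         (λ {k} k<h → subst (λ m → ∃ λ x → entry T k (c ∸ m) ≡ just x × code x ≤ code y) (+-suc i k) (f (s<s k<h)))
         (subst (λ m → entry T h (c ∸ m) ≡ nothing) (+-suc i h) p)
... | t , u =
    trans (cong (λ L → firstGreater L y) eq)
      (trans (firstGreater-skip x y (colGo T (suc i) c) x≤y) (cong (Maybe.map suc) t))
  , trans (cong length eq) (cong suc u)
  where eq = colGo-here R T (≤-trans (m≤m+n i (suc h)) b) (subst (λ m → nth R (c ∸ m) ≡ just x) (+-identityʳ i) s)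

-- Mixed insertion can be undone: the letters met on the way back strictly decrease

size : Tab → ℕ
size []      = 0
size (R ∷ T) = length R + size T

size-setNth : ∀ T r R → length R ≡ length (rowAt T r) → size (setNth T r R) ≡ size T
size-setNth []      r       R p = refl
size-setNth (_ ∷ T) zero    R p = cong (_+ size T) p
size-setNth (S ∷ T) (suc r) R p = cong (length S +_) (size-setNth T r R p)

size-replaceAt : ∀ T r j e → size (replaceAt T r j e) ≡ size T
size-replaceAt T r j e = size-setNth T r _ (length-setNth (rowAt T r) j e)

record Undone (T* : Tab) (N : ℕ) : Set where
  constructor undone
  field
    {before} : Tab
    {letter} : ℕ
    valid    : Valid before
    size≡    : size before ≡ N
    positive : 1 ≤ letter
    inserts  : RowIns before 0 (plain letter) T*

-- `k` is fuel: by `k + i` the row has ended. The box found is the one from which a letter of code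
-- `n` was bumped, and its entry is the letter that displaced it.
scan : ∀ {n} (f : ℕ → Maybe PL) k i {x} → f i ≡ just x → code x < n → f (k + i) ≡ nothing →
  ∃ λ j → i ≤ j × ∃ λ y → f j ≡ just y × code y < n × (∀ {z} → f (suc j) ≡ just z → n ≤ code z)
scan f zero i p q s with () ← trans (sym p) s
scan {n} f (suc k) i p q s with f (suc i) in eq
... | nothing = i , ≤-refl , _ , p , q , λ t → contradiction (trans (sym eq) t) λ ()
... | just z with n ≤? code z
...   | yes r = i , ≤-refl , _ , p , q , λ t → subst (λ w → n ≤ code w) (just-injective (trans (sym eq) t)) r
...   | no r with scan f k (suc i) eq (≰⇒> r) (subst (λ m → f m ≡ nothing) (sym (+-suc k i)) s)
...     | j , i<j , rest = j , ≤-trans (n≤1+n i) i<j , rest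

scanCol : ∀ {n} T i t {x} → entry T i t ≡ just x → code x < n →
  ∃₂ λ i₀ t₀ → i ≤ i₀ × i₀ + t₀ ≡ i + t × ∃ λ y → entry T i₀ t₀ ≡ just y × code y < n ×
    (∀ {t₁ z} → t₀ ≡ suc t₁ → entry T (suc i₀) t₁ ≡ just z → n ≤ code z)
scanCol T i zero p q = i , zero , ≤-refl , refl , _ , p , q , λ ()
scanCol {n} T i (suc t) p q with entry T (suc i) t in eq
... | nothing = i , suc t , ≤-refl , refl , _ , p , q , λ { refl s → contradiction (trans (sym eq) s) λ () }
... | just z with n ≤? code z
...   | yes r = i , suc t , ≤-refl , refl , _ , p , q ,
                λ { refl s → subst (λ w → n ≤ code w) (just-injective (trans (sym eq) s)) r }
...   | no r with scanCol T (suc i) t eq (≰⇒> r)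
...     | i₀ , t₀ , i≤ , e , rest = i₀ , t₀ , ≤-trans (n≤1+n i) i≤ , trans e (sym (+-suc i t)) , rest

module Undo (T* : Tab) (N : ℕ) where

  fg-row : ∀ {T r j y e} → Valid T → entry T r j ≡ just y → code y < code e →
    firstGreater (rowAt (replaceAt T r j e) r) y ≡ just j
  fg-row {T} {r} {j} {y} {e} V p q = firstGreater-at (rowAt (replaceAt T r j e) r) {y} j (entry-same T r j e p) q
    λ {k} k<j s → row-mono′ V (<⇒≤ k<j) (trans (sym (entry-other T r j e r k p (inj₂ (>⇒≢ k<j)))) s) p

  fg-col : ∀ {T r j y e} → Valid T → entry T r j ≡ just y → code y < code e →
    firstGreater (colEntries (replaceAt T r j e) (r + j)) y ≡ just r ×
    nth (colEntries (replaceAt T r j e) (r + j)) r ≡ just e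
  fg-col {T} {r} {j} {y} {e} V p q = colGo-at (replaceAt T r j e) 0 (r + j) {y} r (m≤m+n r j)
    (λ {k} k<r → let x , s , t = col-up V r p (<⇒≤ k<r) in
       x , trans (entry-other T r j e k _ p (inj₁ (>⇒≢ k<r))) s , t)
    (trans (cong (entry (replaceAt T r j e) r) (m+n∸m≡n r j)) (entry-same T r j e p)) q

  mutual
    -- An unprimed letter inserted into row `suc r` came from row `r`, from the last box whose entry
    -- is smaller. `left` shows that such a box exists, `right` that the letter may return to it.
    -- The entry found there has a smaller code, so the fuel `n` decreases.
    undoRow : ∀ n T r v {s} → code (plain v) ≤ n → Valid T → 1 ≤ v → size T ≡ N →
      RowIns T r (plain v) T* →
      (∀ {r′} → r ≡ suc r′ → ∃ λ x → entry T r′ (suc s) ≡ just x × code x < code (plain v)) →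
      (∀ {j z} → s ≤ j → entry T r j ≡ just z → code (plain v) < code z) → Undone T* N
    undoRow n T zero v b V lv sz d _ _ = undone V sz lv d
    undoRow (suc n) T (suc r) v {s} b V lv sz d left right with left refl
    ... | x , p , q with scan (entry T r) (length (rowAt T r)) (suc s) p q
                         (trans (cong (entry T r) (cong (_+ suc s) (sym (+-identityʳ _)))) (nth-beyond (rowAt T r) 0 (suc s)))
    ... | zero , () , _
    ... | suc j , s≤ , y , p′ , q′ , beyond = resume n T r (suc j) y (plain v)
        (s≤s⁻¹ (≤-trans q′ b)) V V₁ p′ q′ sz
        (λ { u refl → rowUn (fg-row V p′ q′) (entry-same T r (suc j) _ p′) d′ })
        (λ { u j′ refl _ → let f , g = fg-col V p′ q′ in
             colUn f (<⇒≢ (m<m+n r z<s)) g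
               (subst (λ k → RowIns (replaceAt T₁ r k (primed u)) (suc r) (plain v) T*) (sym (m+n∸m≡n r (suc j))) d′) })
      where
      T₁ = replaceAt T r (suc j) (plain v)
      d′ = subst (λ U → RowIns U (suc r) (plain v) T*) (sym (replace-back T r (suc j) (plain v) p′)) d
      V₁ : Valid T₁
      V₁ = Valid-replace V p′
        (λ { refl t → inj₁ (≤-<-trans (≤ʳ⇒≤ (row-≤ V t p′)) q′) })
        (λ t → ≤⇒≤ʳplain (beyond t))
        (λ { refl t → inj₁ (≤-<-trans (≤ᶜ⇒≤ (col-≤ V t p′)) q′) })
        (λ { refl t → inj₁ (right (s≤s⁻¹ s≤) t) })
        (λ ()) (s≤s (≤-trans lv (m≤m+n v _)))

    -- The same for a primed letter, which came from the column to the left: either from a box off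
    -- the diagonal, where it was primed already, or from the diagonal box.
    undoCol : ∀ n T c v i t → code (primed v) ≤ n → Valid T → 1 ≤ v → size T ≡ N →
      ColIns T c (primed v) T* → c ≡ suc (i + t) →
      (∃ λ x → entry T i t ≡ just x × code x < code (primed v)) →
      (∀ {i′ j z} → i ≤ i′ → i′ + j ≡ c → entry T i′ j ≡ just z → code (primed v) < code z) → Undone T* N
    undoCol zero T c (suc v) i t () V lv sz d eq left right
    undoCol (suc n) T c v i t b V lv sz d eq (x , p , q) right with scanCol T i t p q
    ... | i₀ , suc t₀ , i≤ , e , y , p′ , q′ , beyond = resume n T i₀ (suc t₀) y (primed v)
        (s≤s⁻¹ (≤-trans q′ b)) V V₁ p′ q′ sz
        (λ { u refl → rowPr (fg-row V p′ q′) (entry-same T i₀ (suc t₀) _ p′) d′ })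
        (λ { u j′ refl _ → let f , g = fg-col V p′ q′ in
             colPr f (<⇒≢ (m<m+n i₀ z<s)) g
               (subst (λ k → ColIns (replaceAt T₁ i₀ k (primed u)) (suc (i₀ + suc t₀)) (primed v) T*)
                      (sym (m+n∸m≡n i₀ (suc t₀))) d′) })
      where
      T₁ = replaceAt T i₀ (suc t₀) (primed v)
      c≡ : c ≡ suc (i₀ + suc t₀)
      c≡ = trans eq (cong suc (sym e))
      d′ : ColIns (replaceAt T₁ i₀ (suc t₀) y) (suc (i₀ + suc t₀)) (primed v) T*
      d′ = subst (λ U → ColIns U (suc (i₀ + suc t₀)) (primed v) T*)
             (sym (replace-back T i₀ (suc t₀) (primed v) p′))
             (subst (λ k → ColIns T k (primed v) T*) c≡ d)
      V₁ : Valid T₁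
      V₁ = Valid-replace V p′
        (λ { refl s → inj₁ (≤-<-trans (≤ʳ⇒≤ (row-≤ V s p′)) q′) })
        (λ s → inj₁ (right i≤ (trans (+-suc i₀ (suc t₀)) (sym c≡)) s))
        (λ { refl s → inj₁ (≤-<-trans (≤ᶜ⇒≤ (col-≤ V s p′)) q′) })
        (λ { refl s → ≤⇒≤ᶜprimed (beyond refl s) })
        (λ ()) (≤-trans (*-monoʳ-≤ 2 lv) ≤-refl)
    ... | i₀ , zero , i≤ , e , primed u , p′ , q′ , beyond with () ← diag V p′
    -- On the diagonal the letter was still unprimed and received its prime when bumped. So
    -- `plain v` returns there, with a code one higher than that of the letter in hand.
    ... | i₀ , zero , i≤ , e , plain u , p′ , q′ , beyond = resume n T i₀ 0 (plain u) (plain v)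
        (s≤s⁻¹ (≤-trans q′ b)) V V₁ p′ (m<n⇒m<1+n q′) sz
        (λ { _ refl → rowDiag (fg-row V p′ (m<n⇒m<1+n q′)) (entry-same T i₀ 0 _ p′) d′ })
        (λ { _ _ () })
      where
      T₁ = replaceAt T i₀ 0 (plain v)
      c≡ : c ≡ suc i₀
      c≡ = trans eq (cong suc (trans (sym e) (+-identityʳ i₀)))
      d′ = subst (λ U → ColIns U (suc i₀) (primed v) T*) (sym (replace-back T i₀ 0 (plain v) p′))
             (subst (λ k → ColIns T k (primed v) T*) c≡ d)
      V₁ : Valid T₁
      V₁ = Valid-replace V p′
        (λ ())
        (λ s → ≤⇒≤ʳplain (right i≤ (trans (+-comm i₀ 1) (sym c≡)) s))
        (λ { refl s → inj₁ (<-trans (≤ᶜplain⇒< (col-≤ V s p′)) (m<n⇒m<1+n q′)) })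
        (λ ()) (λ _ → refl) (s≤s (≤-trans lv (m≤m+n v _)))

    -- Row insertion carries unprimed letters and column insertion primed ones, so the form of `y`
    -- tells how it reached the box that now holds `e` again.
    resume : ∀ n T r j y e → code y ≤ n → Valid T → Valid (replaceAt T r j e) →
      entry T r j ≡ just y → code y < code e → size T ≡ N →
      (∀ u → y ≡ plain u → RowIns (replaceAt T r j e) r (plain u) T*) →
      (∀ u j′ → y ≡ primed u → j ≡ suc j′ → ColIns (replaceAt T r j e) (r + j) (primed u) T*) →
      Undone T* N
    resume n T r j (plain u) e b V V₁ p q sz asRow _ =
      undoRow n (replaceAt T r j e) r u {j} b V₁ (plain-positive (low V p)) (trans (size-replaceAt T r j e) sz) (asRow u refl)
        (λ { {r′} refl → let x , s = shape V p in
             x , trans (entry-other T r j e r′ (suc j) p (inj₁ λ ())) s , ≤ᶜplain⇒< (col-≤ V s p) })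
        (λ j≤ s → <-≤-trans q (row-mono′ V₁ j≤ (entry-same T r j e p) s))
    resume n T r zero (primed u) e b V V₁ p q sz _ asCol with () ← diag V p
    resume n T r (suc j) (primed u) e b V V₁ p q sz _ asCol with nth-prefix (rowAt T r) p (n≤1+n j)
    ... | x , s = undoCol n (replaceAt T r (suc j) e) (r + suc j) u r j b V₁ (primed-positive (low V p))
        (trans (size-replaceAt T r (suc j) e) sz) (asCol u j refl refl) (+-suc r j)
        (x , trans (entry-other T r (suc j) e r j p (inj₂ 1+n≢n)) s , ≤ʳprimed⇒< (row-≤ V s p))
        (λ r≤ eq t → <-≤-trans q (col-mono V₁ r≤ (sym eq) (entry-same T r (suc j) e p) t))

-- The last box of the last row is always a corner of a shifted shape. If it is alone in its row,
-- `base` has one row less; describing rows by `rowAt` and `ℓ` treats both cases alike.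
record Removal (T : Tab) : Set where
  field
    base   : Tab
    ℓ      : ℕ
    rest   : List PL
    corner : PL
    other  : ∀ {r} → r ≢ ℓ → rowAt base r ≡ rowAt T r
    base-ℓ : rowAt base ℓ ≡ rest
    T-ℓ    : rowAt T ℓ ≡ rest ∷ʳ corner
    back   : appendRow base ℓ corner ≡ T
    ℓ≤     : ℓ ≤ length base
    len    : length T ≡ suc ℓ
    inside : ∀ {r} → r < length base → r ≢ ℓ ⊎ rest ≢ []
    len≤   : length base ≤ suc ℓ
    size≡  : size T ≡ suc (size base)

removal : ∀ T → T ≢ [] → (∀ {r} → r < length T → ∃ λ x → entry T r 0 ≡ just x) → Removal T
removal [] p _ = contradiction refl p
removal (R ∷ []) _ f with initLast R
removal (.[] ∷ []) _ f | [] with f {0} z<s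
... | _ , ()
removal (.([] ∷ʳ z) ∷ []) _ f | [] ∷ʳ′ z = record
  { base = [] ; ℓ = 0 ; rest = [] ; corner = z
  ; other = λ { {zero} p → contradiction refl p ; {suc r} _ → refl }
  ; base-ℓ = refl ; T-ℓ = refl ; back = refl ; ℓ≤ = z≤n ; len = refl ; inside = λ ()
  ; len≤ = z≤n ; size≡ = refl }
removal (.((x ∷ R) ∷ʳ z) ∷ []) _ f | (x ∷ R) ∷ʳ′ z = record
  { base = (x ∷ R) ∷ [] ; ℓ = 0 ; rest = x ∷ R ; corner = z
  ; other = λ { {zero} p → contradiction refl p ; {suc r} _ → refl }
  ; base-ℓ = refl ; T-ℓ = refl ; back = refl ; ℓ≤ = z≤n ; len = refl ; inside = λ _ → inj₂ λ ()
  ; len≤ = ≤-refl ; size≡ = cong (λ k → suc k + 0) (length-∷ʳ R z) }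
removal (R ∷ T@(_ ∷ _)) _ f with removal T (λ ()) (λ p → f (s<s p))
... | rm = record
  { base = R ∷ base ; ℓ = suc ℓ ; rest = rest ; corner = corner
  ; other = λ { {zero} _ → refl ; {suc r} p → other (p ∘ cong suc) }
  ; base-ℓ = base-ℓ ; T-ℓ = T-ℓ ; back = cong (R ∷_) back ; ℓ≤ = s≤s ℓ≤ ; len = cong suc len
  ; inside = λ { {zero} _ → inj₁ λ () ; {suc r} p → Sum.map₁ (λ q → q ∘ suc-injective) (inside (s<s⁻¹ p)) }
  ; len≤ = s≤s len≤
  ; size≡ = trans (cong (length R +_) size≡) (+-suc (length R) (size base)) }
  where open Removal rm

nth-++ˡ : ∀ {A : Set} (L M : List A) {j x} → nth L j ≡ just x → nth (L ++ M) j ≡ just x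
nth-++ˡ (y ∷ L) M {zero}  p = p
nth-++ˡ (y ∷ L) M {suc j} p = nth-++ˡ L M p

nth-++ʳ : ∀ {A : Set} (L M : List A) k → nth (L ++ M) (length L + k) ≡ nth M k
nth-++ʳ []      M k = refl
nth-++ʳ (x ∷ L) M k = nth-++ʳ L M k

nth-length : ∀ {A : Set} (L : List A) → nth L (length L) ≡ nothing
nth-length []      = refl
nth-length (x ∷ L) = nth-length L

entry-< : ∀ T r {j x} → entry T r j ≡ just x → r < length T
entry-< (R ∷ T) zero    p = z<s
entry-< (R ∷ T) (suc r) p = s<s (entry-< T r p)

nonempty-head : ∀ {A : Set} (L : List A) → L ≢ [] → ∃ λ x → nth L 0 ≡ just x
nonempty-head []      p = contradiction refl p
nonempty-head (x ∷ L) _ = x , refl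

undoLast : ∀ {T} → Valid T → T ≢ [] → ∃ λ N → size T ≡ suc N × Undone T N
undoLast {T} V T≢[] with removal T T≢[] (full V)
... | rm = size base , size≡ , start corner refl
  where
  open Removal rm
  sub : ∀ {r j x} → entry base r j ≡ just x → entry T r j ≡ just x
  sub {r} {j} {x} p with r ≟ ℓ
  ... | no q     = subst (λ R → nth R j ≡ just x) (other q) p
  ... | yes refl = subst (λ R → nth R j ≡ just x) (sym T-ℓ)
                     (nth-++ˡ rest _ (subst (λ R → nth R j ≡ just x) base-ℓ p))
  sup : ∀ {r j x} → r ≢ ℓ → entry T r j ≡ just x → entry base r j ≡ just x
  sup {r} {j} {x} q = subst (λ R → nth R j ≡ just x) (sym (other q))
  Vb : Valid base
  Vb = record
    { row-≤ = λ p q → row-≤ V (sub p) (sub q)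
    ; col-≤ = λ p q → col-≤ V (sub p) (sub q)
    ; shape = λ {r} p → let x , q = shape V (sub p) in
        x , sup (<⇒≢ (s<s⁻¹ (subst (suc r <_) len (entry-< T (suc r) (sub p))))) q
    ; diag  = λ p → diag V (sub p)
    ; low   = λ p → low V (sub p)
    ; full  = λ {r} p → fullBase r p
    }
    where
    fullBase : ∀ r → r < length base → ∃ λ x → entry base r 0 ≡ just x
    fullBase r p with inside p | r ≟ ℓ
    ... | inj₁ q | _ = let x , s = full V (subst (r <_) (sym len) (<-≤-trans p len≤)) in x , sup q s
    ... | inj₂ q | yes refl = let x , s = nonempty-head rest q in x , trans (cong (λ R → nth R 0) base-ℓ) s
    ... | inj₂ _ | no q = let x , s = full V (subst (r <_) (sym len) (<-≤-trans p len≤)) in x , sup q s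
  corner-at : entry T ℓ (length rest) ≡ just corner
  corner-at = trans (cong (λ R → nth R (length rest)) T-ℓ)
                (trans (cong (nth (rest ∷ʳ corner)) (sym (+-identityʳ (length rest)))) (nth-++ʳ rest (corner ∷ []) 0))
  base-end : entry base ℓ (length rest) ≡ nothing
  base-end = trans (cong (λ R → nth R (length rest)) base-ℓ) (nth-length rest)
  below-ℓ : ∀ {r j x} → ℓ < r → entry base r j ≢ just x
  below-ℓ {r} p q = <-irrefl refl (<-≤-trans (entry-< base r q) (≤-trans len≤ p))
  right-of : ∀ {j z} → length rest ≤ j → entry base ℓ j ≢ just z
  right-of {j} p q = <-irrefl refl (<-≤-trans (nth-< rest (subst (λ R → nth R j ≡ just _) base-ℓ q)) p)
  start : ∀ z → z ≡ corner → Undone T (size base)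
  start (plain v) refl = Undo.undoRow T (size base) (code (plain v)) base ℓ v {length rest}
    ≤-refl Vb (plain-positive (low V corner-at)) refl
    (subst (RowIns base ℓ (plain v)) back (rowApp
      (firstGreater-none (rowAt base ℓ) {plain v} λ {k} s → row-mono′ V (<⇒≤ (k< s)) (sub s) corner-at) ℓ≤))
    (λ { {r′} eq → let x , s = shape V (subst (λ r → entry T r (length rest) ≡ just (plain v)) eq corner-at) in
         x , sup (λ q → 1+n≢n (trans (sym eq) (sym q))) s ,
         ≤ᶜplain⇒< (col-≤ V s (subst (λ r → entry T r (length rest) ≡ just (plain v)) eq corner-at)) })
    (λ p s → contradiction s (right-of p))
    where
    k< : ∀ {k x} → entry base ℓ k ≡ just x → k < length rest
    k< {k} s = nth-< rest (subst (λ R → nth R k ≡ just _) base-ℓ s)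
  start (primed v) refl = go (length rest) refl
    where
    go : ∀ k → k ≡ length rest → Undone T (size base)
    go zero eq with () ← diag V (subst (λ j → entry T ℓ j ≡ just (primed v)) (sym eq) corner-at)
    go (suc t) eq with nth-prefix (rowAt T ℓ) {i = suc t} {k = t}
                         (subst (λ j → entry T ℓ j ≡ just (primed v)) (sym eq) corner-at) (n≤1+n t)
    ... | x , s = Undo.undoCol T (size base) (code (primed v)) base (ℓ + suc t) v ℓ t
        ≤-refl Vb (primed-positive (low V corner-at)) refl
        (subst (ColIns base (ℓ + suc t) (primed v)) back
          (colApp (proj₁ column) (proj₂ column) ℓ≤ (cong (ℓ +_) (trans (cong length base-ℓ) (sym eq)))))
        (+-suc ℓ t)
        (x , s′ , ≤ʳprimed⇒< (row-≤ V s corner′))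
        (λ {i′} {j} p e q → no-entry i′ j p e q)
      where
      corner′ : entry T ℓ (suc t) ≡ just (primed v)
      corner′ = subst (λ j → entry T ℓ j ≡ just (primed v)) (sym eq) corner-at
      s′ : entry base ℓ t ≡ just x
      s′ = trans (cong (λ R → nth R t) base-ℓ) (inRest rest (subst (λ R → nth R t ≡ just x) T-ℓ s) (≤-reflexive eq))
        where
        inRest : ∀ L {t z} → nth (L ∷ʳ z) t ≡ just x → t < length L → nth L t ≡ just x
        inRest (y ∷ L) {zero}  p q = p
        inRest (y ∷ L) {suc t} p q = inRest L p (s<s⁻¹ q)
      column = colGo-end base 0 (ℓ + suc t) {primed v} ℓ (m≤m+n ℓ (suc t))
        (λ {k} k<ℓ → let y , q , b = col-up V ℓ corner′ (<⇒≤ k<ℓ) in y , sup (<⇒≢ k<ℓ) q , b)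
        (trans (cong (entry base ℓ) (trans (m+n∸m≡n ℓ (suc t)) eq)) base-end)
      no-entry : ∀ i′ j {z} → ℓ ≤ i′ → i′ + j ≡ ℓ + suc t → entry base i′ j ≡ just z → code (primed v) < code z
      no-entry i′ j p e q with m≤n⇒m<n∨m≡n p
      ... | inj₁ r = contradiction q (below-ℓ r)
      ... | inj₂ refl = contradiction q (right-of (≤-reflexive (trans (sym eq) (sym (+-cancelˡ-≡ ℓ _ _ e)))))

HM-snoc : ∀ {T b T′ x T″} → HMfrom T b T′ → RowIns T′ 0 (plain x) T″ → HMfrom T (b ∷ʳ x) T″
HM-snoc hmDone       i = hmStep i hmDone
HM-snoc (hmStep j h) i = hmStep j (HM-snoc h i)

HM-onto : ∀ n {T} → size T ≡ n → Valid T → ∃ λ b → HMfrom [] b T × All (1 ≤_) b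
HM-onto n       {[]}    _ V = [] , hmDone , []
HM-onto n       {R ∷ T} p V with undoLast V (λ ())
HM-onto zero    {R ∷ T} p V | N , q , _ with () ← trans (sym p) q
HM-onto (suc n) {R ∷ T} p V | N , q , undone V′ s lv i
  with HM-onto n (trans s (suc-injective (trans (sym q) p))) V′
... | b , h , pos = b ∷ʳ _ , HM-snoc h i , All.∷ʳ⁺ pos lv

-- Inserting into two tableaux that differ only in small entries at the start of the first row

colEntries-cons : ∀ R Rs c → colEntries (R ∷ Rs) c ≡ Maybe.maybe (λ e → e ∷ colGo Rs 1 c) [] (nth R c)
colEntries-cons R Rs c with nth R c
... | just e  = refl
... | nothing = refl

-- Only strictly greater entries are bumped, so a letter of code at least `θ` passes over both
-- prefixes, and every letter it displaces is again at least `θ`. The two insertions therefore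
-- follow the same path.
module Twins (θ : ℕ) (p p′ : List PL) (len : length p ≡ length p′)
             (small : All (λ x → code x ≤ θ) p) (small′ : All (λ x → code x ≤ θ) p′) where

  Big : List PL → Set
  Big = All (λ x → θ ≤ code x)

  fg-++ : ∀ {y} q S → All (λ x → code x ≤ θ) q → θ ≤ code y →
    firstGreater (q ++ S) y ≡ Maybe.map (length q +_) (firstGreater S y)
  fg-++ {y} [] S _ _ with firstGreater S y
  ... | just _  = refl
  ... | nothing = refl
  fg-++ {y} (x ∷ q) S (a ∷ as) b = trans (firstGreater-skip x y (q ++ S) (≤-trans a b))
    (trans (cong (Maybe.map suc) (fg-++ q S as b)) (lift (firstGreater S y)))
    where
    lift : ∀ m → Maybe.map suc (Maybe.map (length q +_) m) ≡ Maybe.map (suc (length q) +_) m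
    lift (just _) = refl
    lift nothing  = refl

  fg-twin : ∀ {y} S → θ ≤ code y → firstGreater (p′ ++ S) y ≡ firstGreater (p ++ S) y
  fg-twin {y} S b = trans (fg-++ p′ S small′ b)
    (trans (cong (λ k → Maybe.map (k +_) (firstGreater S y)) (sym len)) (sym (fg-++ p S small b)))

  fg-big : ∀ {y i} S → θ ≤ code y → firstGreater (p ++ S) y ≡ just i → ∃ λ k → i ≡ length p + k
  fg-big {y} S b e with firstGreater S y | trans (sym (fg-++ p S small b)) e
  ... | just k | refl = k , refl

  nth-twin : ∀ S k → nth (p′ ++ S) (length p + k) ≡ nth (p ++ S) (length p + k)
  nth-twin S k = trans (cong (λ l → nth (p′ ++ S) (l + k)) len)
                   (trans (nth-++ʳ p′ S k) (sym (nth-++ʳ p S k)))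

  set-++ : ∀ (q : List PL) S k y → setNth (q ++ S) (length q + k) y ≡ q ++ setNth S k y
  set-++ []      S k y = refl
  set-++ (x ∷ q) S k y = cong (x ∷_) (set-++ q S k y)

  Big-set : ∀ {S} k {y} → Big S → θ ≤ code y → Big (setNth S k y)
  Big-set {[]}    k       _        b = []
  Big-set {x ∷ S} zero    (_ ∷ as) b = b ∷ as
  Big-set {x ∷ S} (suc k) (a ∷ as) b = a ∷ Big-set k as b

  record Twin (T T′ : Tab) : Set where
    constructor twin
    field
      {S}  : List PL
      {Rs} : Tab
      big  : Big S
      T≡   : T ≡ (p ++ S) ∷ Rs
      T′≡  : T′ ≡ (p′ ++ S) ∷ Rs

  append-twin : ∀ {T T′} r {y} → Twin T T′ → θ ≤ code y → Twin (appendRow T r y) (appendRow T′ r y)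
  append-twin zero {y} (twin {S} {Rs} big refl refl) b =
    twin (All.∷ʳ⁺ big b) (cong (_∷ Rs) (++-assoc p S (y ∷ []))) (cong (_∷ Rs) (++-assoc p′ S (y ∷ [])))
  append-twin (suc r) (twin big refl refl) b = twin big refl refl

  replace-twin : ∀ {T T′} i j {y} → Twin T T′ → θ ≤ code y → (i ≡ 0 → ∃ λ k → j ≡ length p + k) →
    Twin (replaceAt T i j y) (replaceAt T′ i j y)
  replace-twin zero j {y} (twin {S} {Rs} big refl refl) b f with f refl
  ... | k , refl = twin (Big-set k big b) (cong (_∷ Rs) (set-++ p S k y))
          (cong (_∷ Rs) (trans (cong (λ l → setNth (p′ ++ S) (l + k) y) len) (set-++ p′ S k y)))
  replace-twin (suc i) j (twin big refl refl) b _ = twin big refl refl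

  row-twin : ∀ {T T′ y} r → Twin T T′ → θ ≤ code y →
    firstGreater (rowAt T′ r) y ≡ firstGreater (rowAt T r) y ×
    (∀ {i} → firstGreater (rowAt T r) y ≡ just i → nth (rowAt T′ r) i ≡ nth (rowAt T r) i ×
      (r ≡ 0 → ∃ λ k → i ≡ length p + k))
  row-twin zero (twin {S} big refl refl) b = fg-twin S b , λ e → let k , q = fg-big S b e in
    subst (λ i → nth (p′ ++ S) i ≡ nth (p ++ S) i) (sym q) (nth-twin S k) , λ _ → k , q
  row-twin (suc r) (twin big refl refl) b = refl , λ _ → refl , λ ()

  length-twin : ∀ {T T′} → Twin T T′ → length T′ ≡ length T
  length-twin (twin _ refl refl) = refl

  rowLength-twin : ∀ {T T′} r → Twin T T′ → length (rowAt T′ r) ≡ length (rowAt T r)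
  rowLength-twin zero    (twin {S} _ refl refl) = trans (length-++ p′)
    (trans (cong (_+ length S) (sym len)) (sym (length-++ p)))
  rowLength-twin (suc r) (twin _ refl refl) = refl

  prefix-or : ∀ (q q′ : List PL) S c → length q ≡ length q′ →
    (∃ λ k → c ≡ length q + k) ⊎
    (∃₂ λ e e′ → nth (q ++ S) c ≡ just e × nth (q′ ++ S) c ≡ just e′ × e ∈ q × e′ ∈ q′)
  prefix-or []      []        S c       _ = inj₁ (c , refl)
  prefix-or (x ∷ q) (x′ ∷ q′) S zero    _ = inj₂ (x , x′ , refl , refl , here refl , here refl)
  prefix-or (x ∷ q) (x′ ∷ q′) S (suc c) l with prefix-or q q′ S c (suc-injective l)
  ... | inj₁ (k , e)                 = inj₁ (k , cong suc e)
  ... | inj₂ (e , e′ , a , b , i , j) = inj₂ (e , e′ , a , b , there i , there j)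

  col-twin : ∀ {T T′ y} c → Twin T T′ → θ ≤ code y →
    firstGreater (colEntries T′ c) y ≡ firstGreater (colEntries T c) y ×
    length (colEntries T′ c) ≡ length (colEntries T c) ×
    (∀ {i} → firstGreater (colEntries T c) y ≡ just i → nth (colEntries T′ c) i ≡ nth (colEntries T c) i ×
      (i ≡ 0 → ∃ λ k → c ∸ i ≡ length p + k))
  col-twin {y = y} c (twin {S} {Rs} big refl refl) b with prefix-or p p′ S c len
  ... | inj₁ (k , refl) =
      cong (λ L → firstGreater L y) same , cong length same ,
      λ {i} _ → cong (λ L → nth L i) same , λ { refl → k , refl }
    where
    same : colEntries ((p′ ++ S) ∷ Rs) (length p + k) ≡ colEntries ((p ++ S) ∷ Rs) (length p + k)
    same = trans (colEntries-cons (p′ ++ S) Rs (length p + k))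
             (trans (cong (Maybe.maybe _ []) (nth-twin S k)) (sym (colEntries-cons (p ++ S) Rs (length p + k))))
  -- Column `c` starts with an entry of the prefix. It is skipped in both tableaux, and the
  -- remainder of the column is common.
  ... | inj₂ (e , e′ , a , a′ , i , j) =
      trans (cong (λ L → firstGreater L y) col′) (trans (firstGreater-skip e′ y L e′≤)
        (trans (sym (firstGreater-skip e y L e≤)) (sym (cong (λ L → firstGreater L y) col))))
    , trans (cong length col′) (sym (cong length col))
    , λ { {zero} q → contradiction (trans (sym (trans (cong (λ L → firstGreater L y) col) (firstGreater-skip e y L e≤))) q) (¬zero (firstGreater L y))
        ; {suc i} _ → trans (cong (λ L → nth L (suc i)) col′) (sym (cong (λ L → nth L (suc i)) col)) , λ () }
    where
    L = colGo Rs 1 c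
    e≤  = ≤-trans (All.lookup small i) b
    e′≤ = ≤-trans (All.lookup small′ j) b
    col : colEntries ((p ++ S) ∷ Rs) c ≡ e ∷ L
    col = trans (colEntries-cons (p ++ S) Rs c) (cong (Maybe.maybe (λ e → e ∷ L) []) a)
    col′ : colEntries ((p′ ++ S) ∷ Rs) c ≡ e′ ∷ L
    col′ = trans (colEntries-cons (p′ ++ S) Rs c) (cong (Maybe.maybe (λ e → e ∷ L) []) a′)
    ¬zero : ∀ m → Maybe.map suc m ≢ just 0
    ¬zero (just _) ()
    ¬zero nothing ()

  -- Priming lowers a code by at most one, and a bumped letter is strictly greater than `y`.
  Big-prime : ∀ y z → θ ≤ code y → code y < code z → θ ≤ code (prime z)
  Big-prime y (primed v) b q = ≤-trans b (<⇒≤ q)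
  Big-prime y (plain v)  b q = ≤-trans b (s≤s⁻¹ q)

  fg-greater : ∀ L {y i z} → firstGreater L y ≡ just i → nth L i ≡ just z → code y < code z
  fg-greater (e ∷ L) {y} p q with code y <ᵇ code e in eq
  fg-greater (e ∷ L) {y} refl refl | true = <ᵇ-true⁻ (code y) (code e) eq
  ... | false with firstGreater L y in eq′
  fg-greater (e ∷ L) {y} refl q | false | just i = fg-greater L eq′ q

  mutual
    rowIns-twin : ∀ {T T′ r y U} → Twin T T′ → θ ≤ code y → RowIns T r y U →
      ∃ λ U′ → RowIns T′ r y U′ × Twin U U′
    rowIns-twin {r = r} t b (rowApp f l) =
      _ , rowApp (trans (proj₁ (row-twin r t b)) f) (subst (r ≤_) (sym (length-twin t)) l) , append-twin r t b
    rowIns-twin {T} {T′} {r} {y} t b (rowDiag {z = z} f g i) with proj₂ (row-twin r t b) f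
    ... | same , big with colIns-twin (replace-twin r 0 t b big) (Big-prime y z b (fg-greater (rowAt T r) f g)) i
    ... | _ , i′ , t′ = _ , rowDiag (trans (proj₁ (row-twin r t b)) f) (trans same g) i′ , t′
    rowIns-twin {T} {T′} {r} t b (rowUn {j = j} f g i) with proj₂ (row-twin r t b) f
    ... | same , big with rowIns-twin (replace-twin r (suc j) t b big) (≤-trans b (<⇒≤ (fg-greater (rowAt T r) f g))) i
    ... | _ , i′ , t′ = _ , rowUn (trans (proj₁ (row-twin r t b)) f) (trans same g) i′ , t′
    rowIns-twin {T} {T′} {r} t b (rowPr {j = j} f g i) with proj₂ (row-twin r t b) f
    ... | same , big with colIns-twin (replace-twin r (suc j) t b big) (≤-trans b (<⇒≤ (fg-greater (rowAt T r) f g))) i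
    ... | _ , i′ , t′ = _ , rowPr (trans (proj₁ (row-twin r t b)) f) (trans same g) i′ , t′

    colIns-twin : ∀ {T T′ c y U} → Twin T T′ → θ ≤ code y → ColIns T c y U →
      ∃ λ U′ → ColIns T′ c y U′ × Twin U U′
    colIns-twin {c = c} t b (colApp {h = h} f l m n) with col-twin c t b
    ... | fg , ln , _ = _ , colApp (trans fg f) (trans ln l) (subst (h ≤_) (sym (length-twin t)) m)
                              (trans (cong (h +_) (rowLength-twin h t)) n) , append-twin h t b
    colIns-twin {T} {c = c} {y} t b (colDiag {i = i} {z = z} f e g d) with col-twin c t b
    ... | fg , _ , h with h f
    ... | same , big with colIns-twin (replace-twin i (c ∸ i) t b big) (Big-prime y z b (fg-greater (colEntries T c) f g)) d
    ... | _ , d′ , t′ = _ , colDiag (trans fg f) e (trans same g) d′ , t′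
    colIns-twin {T} {c = c} t b (colUn {i = i} f e g d) with col-twin c t b
    ... | fg , _ , h with h f
    ... | same , big with rowIns-twin (replace-twin i (c ∸ i) t b big) (≤-trans b (<⇒≤ (fg-greater (colEntries T c) f g))) d
    ... | _ , d′ , t′ = _ , colUn (trans fg f) e (trans same g) d′ , t′
    colIns-twin {T} {c = c} t b (colPr {i = i} f e g d) with col-twin c t b
    ... | fg , _ , h with h f
    ... | same , big with colIns-twin (replace-twin i (c ∸ i) t b big) (≤-trans b (<⇒≤ (fg-greater (colEntries T c) f g))) d
    ... | _ , d′ , t′ = _ , colPr (trans fg f) e (trans same g) d′ , t′

-- The odd operator on the first row of a primed tableau

ones : ℕ → List PL
ones m = replicate m (plain 1)

ones-∷ʳ : ∀ m S → ones m ++ plain 1 ∷ S ≡ ones (suc m) ++ S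
ones-∷ʳ zero    S = refl
ones-∷ʳ (suc m) S = cong (plain 1 ∷_) (ones-∷ʳ m S)

ones-≤5 : ∀ m → All (λ x → code x ≤ 5) (ones m)
ones-≤5 zero    = []
ones-≤5 (suc m) = s≤s (s≤s (s≤s z≤n)) ∷ ones-≤5 m

-- 5 is the code of the letter 2, so a 2′ is excluded here.
Large : List PL → Set
Large = All (λ x → 5 ≤ code x)

data Lowered : Tab → Tab → Set where
  low₂ : ∀ {S Rs} → Large S → Lowered ((plain 2 ∷ S) ∷ Rs) ((plain 1 ∷ S) ∷ Rs)
  low₁ : ∀ m {S Rs} → Large S →
         Lowered ((ones (suc m) ++ primed 2 ∷ S) ∷ Rs) ((ones (suc m) ++ plain 1 ∷ S) ∷ Rs)

-- `P₂` and `P₁` are the two forms of `Lowered`. `P₀` and `P₆` compare a tableau with itself: this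
-- shows that an initial run of ones, or the absence of letters below 3′ in the first row, survives
-- the insertion.
module P₂ = Twins 5 (plain 2 ∷ []) (plain 1 ∷ []) refl (≤-refl ∷ []) (s≤s (s≤s (s≤s z≤n)) ∷ [])
module P₁ m = Twins 5 (ones m ∷ʳ primed 2) (ones m ∷ʳ plain 1)
  (trans (length-∷ʳ (ones m) (primed 2)) (sym (length-∷ʳ (ones m) (plain 1))))
  (All.∷ʳ⁺ (ones-≤5 m) (m≤m+n 4 1)) (All.∷ʳ⁺ (ones-≤5 m) (m≤m+n 3 2))
module P₀ m = Twins 5 (ones m) (ones m) refl (ones-≤5 m) (ones-≤5 m)
module P₆ = Twins 6 [] [] refl [] []

P₁-Lowered : ∀ m {T T′} → P₁.Twin (suc m) T T′ → Lowered T T′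
P₁-Lowered m (P₁.twin {S} {Rs} big refl refl) = subst₂ (λ R R′ → Lowered (R ∷ Rs) (R′ ∷ Rs))
  (sym (++-assoc (ones (suc m)) (primed 2 ∷ []) S)) (sym (++-assoc (ones (suc m)) (plain 1 ∷ []) S)) (low₁ m big)

P₁-twin : ∀ m {S Rs} → Large S →
  P₁.Twin (suc m) ((ones (suc m) ++ primed 2 ∷ S) ∷ Rs) ((ones (suc m) ++ plain 1 ∷ S) ∷ Rs)
P₁-twin m {S} {Rs} big = M.twin big (cong (_∷ Rs) (sym (++-assoc (ones (suc m)) (primed 2 ∷ []) S)))
                                    (cong (_∷ Rs) (sym (++-assoc (ones (suc m)) (plain 1 ∷ []) S)))
  where module M = P₁ (suc m)

P₀-twin : ∀ m {S Rs} → Large S → P₀.Twin m ((ones m ++ S) ∷ Rs) ((ones m ++ S) ∷ Rs)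
P₀-twin m big = M.twin big refl refl
  where module M = P₀ m

fg-ones : ∀ m S → firstGreater (ones m ++ S) (plain 1) ≡ Maybe.map (m +_) (firstGreater S (plain 1))
fg-ones zero S with firstGreater S (plain 1)
... | just _  = refl
... | nothing = refl
fg-ones (suc m) S rewrite fg-ones m S with firstGreater S (plain 1)
... | just _  = refl
... | nothing = refl

nth-ones : ∀ m S → nth (ones m ++ S) m ≡ nth S 0
nth-ones zero    S = refl
nth-ones (suc m) S = nth-ones m S

set-ones : ∀ m z S y → setNth (ones m ++ z ∷ S) m y ≡ ones m ++ y ∷ S
set-ones zero    z S y = refl
set-ones (suc m) z S y = cong (plain 1 ∷_) (set-ones m z S y)

fg-ones-large : ∀ m z S → 5 ≤ code z → firstGreater (ones m ++ z ∷ S) (plain 1) ≡ just m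
fg-ones-large m z S p = trans (fg-ones m (z ∷ S))
  (trans (cong (Maybe.map (m +_)) (firstGreater-hit z (plain 1) S (≤-trans (m≤m+n 4 1) p))) (cong just (+-identityʳ m)))

-- The 2′ entering column `suc m` on one side and the 1 running over `suc m` ones on the other reach
-- the same box of the first row. They displace the same letter or both extend the row, and the
-- difference is again a 2′ against a 1.
pushTwo : ∀ m {S Rs U} → Large S → ColIns ((ones (suc m) ++ S) ∷ Rs) (suc m) (primed 2) U →
  ∃ λ U′ → RowIns ((ones (suc m) ++ S) ∷ Rs) 0 (plain 1) U′ × Lowered U U′
pushTwo m {[]} {Rs} [] d = go d
  where
  empty : colEntries ((ones (suc m) ++ []) ∷ Rs) (suc m) ≡ []
  empty = trans (colEntries-cons (ones (suc m) ++ []) Rs (suc m)) (cong (Maybe.maybe _ []) (nth-ones (suc m) []))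
  nope : ∀ {i} → firstGreater (colEntries ((ones (suc m) ++ []) ∷ Rs) (suc m)) (primed 2) ≢ just i
  nope e with () ← trans (sym (cong (λ L → firstGreater L (primed 2)) empty)) e
  lowered : Lowered (((ones (suc m) ++ []) ∷ʳ primed 2) ∷ Rs) (((ones (suc m) ++ []) ∷ʳ plain 1) ∷ Rs)
  lowered = subst (λ R → Lowered ((R ∷ʳ primed 2) ∷ Rs) ((R ∷ʳ plain 1) ∷ Rs))
    (sym (++-identityʳ (ones (suc m)))) (low₁ m [])
  go : ∀ {U} → ColIns ((ones (suc m) ++ []) ∷ Rs) (suc m) (primed 2) U →
    ∃ λ U′ → RowIns ((ones (suc m) ++ []) ∷ Rs) 0 (plain 1) U′ × Lowered U U′
  go (colApp {h = h} _ l _ _) with trans (sym l) (cong length empty)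
  ... | refl = _ , rowApp (fg-ones (suc m) []) z≤n , lowered
  go (colDiag f _ _ _) = contradiction f nope
  go (colUn f _ _ _)   = contradiction f nope
  go (colPr f _ _ _)   = contradiction f nope
pushTwo m {z ∷ S} {Rs} (q ∷ big) d = go d
  where
  T = (ones (suc m) ++ z ∷ S) ∷ Rs
  col : colEntries T (suc m) ≡ z ∷ colGo Rs 1 (suc m)
  col = trans (colEntries-cons (ones (suc m) ++ z ∷ S) Rs (suc m))
          (cong (Maybe.maybe _ []) (nth-ones (suc m) (z ∷ S)))
  fg : firstGreater (colEntries T (suc m)) (primed 2) ≡ just 0
  fg = trans (cong (λ L → firstGreater L (primed 2)) col) (firstGreater-hit z (primed 2) (colGo Rs 1 (suc m)) q)
  fr : firstGreater (ones (suc m) ++ z ∷ S) (plain 1) ≡ just (suc m)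
  fr = fg-ones-large (suc m) z S q
  at : ∀ {x} → nth (colEntries T (suc m)) 0 ≡ just x → nth (ones (suc m) ++ z ∷ S) (suc m) ≡ just x
  at e = trans (nth-ones (suc m) (z ∷ S)) (trans (sym (cong (λ L → nth L 0) col)) e)
  large : ∀ {x} → nth (colEntries T (suc m)) 0 ≡ just x → 5 ≤ code x
  large e = subst (λ w → 5 ≤ code w) (just-injective (trans (sym (cong (λ L → nth L 0) col)) e)) q
  twins : P₁.Twin (suc m) (replaceAt T 0 (suc m) (primed 2)) (replaceAt T 0 (suc m) (plain 1))
  twins = subst₂ (λ R R′ → P₁.Twin (suc m) (R ∷ Rs) (R′ ∷ Rs))
    (sym (set-ones (suc m) z S (primed 2))) (sym (set-ones (suc m) z S (plain 1))) (P₁-twin m big)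
  go : ∀ {U} → ColIns T (suc m) (primed 2) U → ∃ λ U′ → RowIns T 0 (plain 1) U′ × Lowered U U′
  go (colApp f _ _ _) with () ← trans (sym fg) f
  go (colDiag f e _ _) with trans (sym fg) f
  go (colDiag f () _ _) | refl
  go (colUn {v = v} f _ g i) with trans (sym fg) f
  ... | refl with P₁.rowIns-twin (suc m) {y = plain v} twins (large {plain v} g) i
  ...   | _ , i′ , t = _ , rowUn fr (at g) i′ , P₁-Lowered m t
  go (colPr {v = v} f _ g i) with trans (sym fg) f
  ... | refl with P₁.colIns-twin (suc m) {y = primed v} twins (large {primed v} g) i
  ...   | _ , i′ , t = _ , rowPr fr (at g) i′ , P₁-Lowered m t

5≤plain : ∀ {y} → 2 ≤ y → 5 ≤ code (plain y)
5≤plain p = s≤s (*-monoʳ-≤ 2 p)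

-- A letter from 2 on takes the same path in both tableaux. A 1 displaces the distinguished 2 or 2′
-- of `T`, which enters the next column as a 2′, while in `T′` it passes over one more 1.
Lowered-step : ∀ {T T′ y U} → Lowered T T′ → 1 ≤ y → RowIns T 0 (plain y) U →
  ∃ λ U′ → RowIns T′ 0 (plain y) U′ × Lowered U U′
Lowered-step {y = suc zero} (low₂ big) _ (rowDiag refl refl i) = pushTwo 0 big i
Lowered-step {y = suc zero} (low₁ m {S} {Rs} big) _ d = go d
  where
  R = ones (suc m) ++ primed 2 ∷ S
  fr : firstGreater R (plain 1) ≡ just (suc m)
  fr = trans (fg-ones (suc m) (primed 2 ∷ S)) (cong just (+-identityʳ (suc m)))
  at : nth R (suc m) ≡ just (primed 2)
  at = nth-ones (suc m) (primed 2 ∷ S)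
  eq : setNth R (suc m) (plain 1) ≡ ones (suc (suc m)) ++ S
  eq = trans (set-ones (suc m) (primed 2) S (plain 1)) (ones-∷ʳ (suc m) S)
  go : ∀ {U} → RowIns (R ∷ Rs) 0 (plain 1) U →
    ∃ λ U′ → RowIns ((ones (suc m) ++ plain 1 ∷ S) ∷ Rs) 0 (plain 1) U′ × Lowered U U′
  go (rowApp f _) with () ← trans (sym fr) f
  go (rowDiag f _ _) with () ← trans (sym fr) f
  go (rowUn f g _) with trans (sym fr) f
  ... | refl with () ← trans (sym at) g
  go {U} (rowPr f g i) with trans (sym fr) f
  ... | refl with trans (sym at) g
  ...   | refl with pushTwo (suc m) big (subst (λ R → ColIns (R ∷ Rs) (suc (suc m)) (primed 2) U) eq i)
  ...     | U′ , i′ , l = U′ , subst (λ R → RowIns (R ∷ Rs) 0 (plain 1) U′) (sym (ones-∷ʳ (suc m) S)) i′ , l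
Lowered-step {y = suc (suc y)} (low₂ big) _ d
  with P₂.rowIns-twin (P₂.twin big refl refl) (5≤plain (s≤s (s≤s z≤n))) d
... | _ , d′ , P₂.twin big′ refl refl = _ , d′ , low₂ big′
Lowered-step {y = suc (suc y)} (low₁ m big) _ d
  with P₁.rowIns-twin (suc m) (P₁-twin m big) (5≤plain (s≤s (s≤s z≤n))) d
... | _ , d′ , t = _ , d′ , P₁-Lowered m t

Lowered-run : ∀ {T T′ b U} → Lowered T T′ → All (1 ≤_) b → HMfrom T b U →
  ∃ λ U′ → HMfrom T′ b U′ × Lowered U U′
Lowered-run l []         hmDone       = _ , hmDone , l
Lowered-run l (q ∷ qs) (hmStep d h) with Lowered-step l q d
... | _ , d′ , l′ with Lowered-run l′ qs h
... | _ , h′ , l″ = _ , hmStep d′ h′ , l″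

-- The state after a 1 has been inserted before any 2, when the operator on words gives `nothing`.
data One : Tab → Set where
  one : ∀ m {S Rs} → Large S → One ((ones (suc m) ++ S) ∷ Rs)

P₀-One : ∀ m {T T′} → P₀.Twin (suc m) T T′ → One T
P₀-One m (P₀.twin big refl _) = one m big

One-step : ∀ {T y U} → One T → 1 ≤ y → RowIns T 0 (plain y) U → One U
One-step {y = suc (suc y)} (one m big) _ d
  with P₀.rowIns-twin (suc m) (P₀-twin (suc m) big) (5≤plain (s≤s (s≤s z≤n))) d
... | _ , _ , t = P₀-One m t
One-step {y = suc zero} (one m {[]} {Rs} []) _ d = go d
  where
  fr : firstGreater (ones (suc m) ++ []) (plain 1) ≡ nothing
  fr = fg-ones (suc m) []
  go : ∀ {U} → RowIns ((ones (suc m) ++ []) ∷ Rs) 0 (plain 1) U → One U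
  go (rowApp _ _) = subst (λ R → One (R ∷ Rs))
    (sym (trans (++-assoc (ones (suc m)) [] (plain 1 ∷ [])) (ones-∷ʳ (suc m) []))) (one (suc m) [])
  go (rowDiag f _ _) with () ← trans (sym fr) f
  go (rowUn f _ _)   with () ← trans (sym fr) f
  go (rowPr f _ _)   with () ← trans (sym fr) f
One-step {y = suc zero} (one m {z ∷ S} {Rs} (q ∷ big)) _ d = go d
  where
  R = ones (suc m) ++ z ∷ S
  fr : firstGreater R (plain 1) ≡ just (suc m)
  fr = fg-ones-large (suc m) z S q
  large : ∀ {x} → nth R (suc m) ≡ just x → 5 ≤ code x
  large e = subst (λ w → 5 ≤ code w) (just-injective (trans (sym (nth-ones (suc m) (z ∷ S))) e)) q
  twins : P₀.Twin (suc (suc m)) (replaceAt (R ∷ Rs) 0 (suc m) (plain 1)) (replaceAt (R ∷ Rs) 0 (suc m) (plain 1))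
  twins = subst (λ R → P₀.Twin (suc (suc m)) R R) (sym e) (P₀-twin (suc (suc m)) big)
    where e = cong (_∷ Rs) (trans (set-ones (suc m) z S (plain 1)) (ones-∷ʳ (suc m) S))
  go : ∀ {U} → RowIns (R ∷ Rs) 0 (plain 1) U → One U
  go (rowApp f _) with () ← trans (sym fr) f
  go (rowDiag f _ _) with () ← trans (sym fr) f
  go (rowUn {v = v} f g i) with trans (sym fr) f
  ... | refl with P₀.rowIns-twin (suc (suc m)) {y = plain v} twins (large {plain v} g) i
  ...   | _ , _ , t = P₀-One (suc m) t
  go (rowPr {v = v} f g i) with trans (sym fr) f
  ... | refl with P₀.colIns-twin (suc (suc m)) {y = primed v} twins (large {primed v} g) i
  ...   | _ , _ , t = P₀-One (suc m) t

One-run : ∀ {T b U} → One T → All (1 ≤_) b → HMfrom T b U → One U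
One-run o []       hmDone       = o
One-run o (q ∷ qs) (hmStep d h) = One-run (One-step o q d) qs h

-- 6 is the code of 3′: the state before the first 1 or 2 of the word.
Fresh : Tab → Set
Fresh T = All (λ x → 6 ≤ code x) (rowAt T 0)

Fresh-step : ∀ {T y U} → Fresh T → 3 ≤ y → RowIns T 0 (plain y) U → Fresh U
Fresh-step {[]}     fr p (rowApp _ _) = ≤-trans (*-monoʳ-≤ 2 p) (n≤1+n _) ∷ []
Fresh-step {R ∷ Rs} fr p d
  with P₆.rowIns-twin (P₆.twin fr refl refl) (≤-trans (*-monoʳ-≤ 2 p) (n≤1+n _)) d
... | _ , _ , P₆.twin big refl _ = big

6⇒5 : ∀ {S} → All (λ x → 6 ≤ code x) S → Large S
6⇒5 = All.map (≤-trans (n≤1+n 5))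

prime-≥5 : ∀ z → 6 ≤ code z → 5 ≤ code (prime z)
prime-≥5 (primed v) p = ≤-trans (n≤1+n 5) p
prime-≥5 (plain v)  p = s≤s⁻¹ p

Fresh-two : ∀ {T U} → Fresh T → RowIns T 0 (plain 2) U →
  ∃ λ U′ → RowIns T 0 (plain 1) U′ × Lowered U U′
Fresh-two {[]}          fr (rowApp _ _)      = _ , rowApp refl z≤n , low₂ []
Fresh-two {[] ∷ Rs}     fr (rowApp _ _)      = _ , rowApp refl z≤n , low₂ []
Fresh-two {(z ∷ S) ∷ Rs} {U} (q ∷ fr) d = go d
  where
  hit : ∀ y → code y < 6 → firstGreater (z ∷ S) y ≡ just 0
  hit y p = firstGreater-hit z y S (≤-trans p q)
  go : RowIns ((z ∷ S) ∷ Rs) 0 (plain 2) U → ∃ λ U′ → RowIns ((z ∷ S) ∷ Rs) 0 (plain 1) U′ × Lowered U U′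
  go (rowApp f _) with () ← trans (sym (hit (plain 2) ≤-refl)) f
  go (rowUn f _ _) with () ← trans (sym (hit (plain 2) ≤-refl)) f
  go (rowPr f _ _) with () ← trans (sym (hit (plain 2) ≤-refl)) f
  go (rowDiag f refl i) with P₂.colIns-twin {y = prime z} (P₂.twin (6⇒5 fr) refl refl) (prime-≥5 z q) i
  ... | _ , i′ , P₂.twin big refl refl = _ , rowDiag (hit (plain 1) (m≤m+n 4 2)) refl i′ , low₂ big

Fresh-one : ∀ {T U} → Fresh T → RowIns T 0 (plain 1) U → One U
Fresh-one {[]}      fr (rowApp _ _) = one 0 []
Fresh-one {[] ∷ Rs} fr (rowApp _ _) = one 0 []
Fresh-one {(z ∷ S) ∷ Rs} {U} (q ∷ fr) d = go d
  where
  hit : firstGreater (z ∷ S) (plain 1) ≡ just 0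
  hit = firstGreater-hit z (plain 1) S (≤-trans (m≤m+n 4 2) q)
  go : RowIns ((z ∷ S) ∷ Rs) 0 (plain 1) U → One U
  go (rowApp f _) with () ← trans (sym hit) f
  go (rowUn f _ _) with () ← trans (sym hit) f
  go (rowPr f _ _) with () ← trans (sym hit) f
  go (rowDiag f refl i) with P₀.colIns-twin 1 {y = prime z} (P₀-twin 1 (6⇒5 fr)) (prime-≥5 z q) i
  ... | _ , _ , t = P₀-One 0 t

-- The first letter below 3 decides the outcome. The outcomes `Fresh`, `One` and `Lowered` can be
-- told apart from the first row of `U` alone, by `lowerRow`, so the result does not depend on which
-- word `b` produced the tableau.
eOdd-HM : ∀ {T b U} → Fresh T → All (1 ≤_) b → HMfrom T b U →
    (eOdd b ≡ nothing × (Fresh U ⊎ One U))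
  ⊎ (∃₂ λ b′ U′ → eOdd b ≡ just b′ × HMfrom T b′ U′ × Lowered U U′)
eOdd-HM fr [] hmDone = inj₁ (refl , inj₁ fr)
eOdd-HM fr (_∷_ {suc zero} _ qs) (hmStep d h) = inj₁ (refl , inj₂ (One-run (Fresh-one fr d) qs h))
eOdd-HM fr (_∷_ {suc (suc zero)} _ qs) (hmStep d h) with Fresh-two fr d
... | _ , d′ , l with Lowered-run l qs h
... | U′ , h′ , l′ = inj₂ (_ , U′ , refl , hmStep d′ h′ , l′)
eOdd-HM fr (_∷_ {suc (suc (suc x))} {xs} _ qs) (hmStep d h)
  with eOdd-HM (Fresh-step fr (s≤s (s≤s (s≤s z≤n))) d) qs h
... | inj₁ (e , s) = inj₁ (cong (Maybe.map _) e , s)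
... | inj₂ (b′ , U′ , e , h′ , l) = inj₂ (_ , U′ , cong (Maybe.map _) e , hmStep d h′ , l)

lowerOnes lowerRow : List PL → Maybe (List PL)
lowerOnes (plain 1 ∷ R)  = Maybe.map (plain 1 ∷_) (lowerOnes R)
lowerOnes (primed 2 ∷ R) = just (plain 1 ∷ R)
lowerOnes _              = nothing

lowerRow (plain 1 ∷ R) = Maybe.map (plain 1 ∷_) (lowerOnes R)
lowerRow (plain 2 ∷ R) = just (plain 1 ∷ R)
lowerRow _             = nothing

lowerOnes-ones : ∀ m {R R′} → lowerOnes R ≡ R′ → lowerOnes (ones m ++ R) ≡ Maybe.map (ones m ++_) R′
lowerOnes-ones zero {R′ = just _}  e = e
lowerOnes-ones zero {R′ = nothing} e = e
lowerOnes-ones (suc m) {R′ = just _}  e = cong (Maybe.map (plain 1 ∷_)) (lowerOnes-ones m e)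
lowerOnes-ones (suc m) {R′ = nothing} e = cong (Maybe.map (plain 1 ∷_)) (lowerOnes-ones m e)

lowerRow-ones : ∀ m {R R′} → lowerOnes R ≡ R′ → lowerRow (ones (suc m) ++ R) ≡ Maybe.map (ones (suc m) ++_) R′
lowerRow-ones m {R′ = just _}  e = cong (Maybe.map (plain 1 ∷_)) (lowerOnes-ones m e)
lowerRow-ones m {R′ = nothing} e = cong (Maybe.map (plain 1 ∷_)) (lowerOnes-ones m e)

lowerOnes-large : ∀ {S} → Large S → lowerOnes S ≡ nothing
lowerOnes-large []                                  = refl
lowerOnes-large (_∷_ {plain 0} (s≤s ()) _)
lowerOnes-large (_∷_ {plain 1} (s≤s (s≤s (s≤s ()))) _)
lowerOnes-large (_∷_ {plain (suc (suc _))} _ _)     = refl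
lowerOnes-large (_∷_ {primed 0} () _)
lowerOnes-large (_∷_ {primed 1} (s≤s (s≤s ())) _)
lowerOnes-large (_∷_ {primed 2} (s≤s (s≤s (s≤s (s≤s ())))) _)
lowerOnes-large (_∷_ {primed (suc (suc (suc _)))} _ _) = refl

lowerRow-Fresh : ∀ {R} → All (λ x → 6 ≤ code x) R → lowerRow R ≡ nothing
lowerRow-Fresh []                                     = refl
lowerRow-Fresh (_∷_ {primed _} _ _)                   = refl
lowerRow-Fresh (_∷_ {plain 0} (s≤s ()) _)
lowerRow-Fresh (_∷_ {plain 1} (s≤s (s≤s (s≤s ()))) _)
lowerRow-Fresh (_∷_ {plain 2} (s≤s (s≤s (s≤s (s≤s (s≤s ()))))) _)
lowerRow-Fresh (_∷_ {plain (suc (suc (suc _)))} _ _)  = refl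

lowerRow-One : ∀ {T} → One T → lowerRow (rowAt T 0) ≡ nothing
lowerRow-One (one m big) = lowerRow-ones m (lowerOnes-large big)

lowerRow-Lowered : ∀ {T T′} → Lowered T T′ → ∃₂ λ R R′ → ∃ λ Rs → T ≡ R ∷ Rs × T′ ≡ R′ ∷ Rs × lowerRow R ≡ just R′
lowerRow-Lowered (low₂ big)   = _ , _ , _ , refl , refl , refl
lowerRow-Lowered (low₁ m big) = _ , _ , _ , refl , refl , lowerRow-ones m refl

eOdd-nothing : ∀ {b T} → All (1 ≤_) b → HMfrom [] b T → lowerRow (rowAt T 0) ≡ nothing → eOdd b ≡ nothing
eOdd-nothing pos h e with eOdd-HM [] pos h
... | inj₁ (r , _) = r
... | inj₂ (_ , _ , _ , _ , l) with lowerRow-Lowered l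
...   | _ , _ , _ , refl , _ , e′ with () ← trans (sym e) e′

eOdd-just : ∀ {b R R′ Rs} → All (1 ≤_) b → HMfrom [] b (R ∷ Rs) → lowerRow R ≡ just R′ →
  ∃ λ b′ → eOdd b ≡ just b′ × HMfrom [] b′ (R′ ∷ Rs)
eOdd-just pos h e with eOdd-HM [] pos h
... | inj₁ (_ , inj₁ fr) with () ← trans (sym e) (lowerRow-Fresh fr)
... | inj₁ (_ , inj₂ o)  with () ← trans (sym e) (lowerRow-One o)
... | inj₂ (b′ , _ , r , h′ , l) with lowerRow-Lowered l
...   | _ , _ , _ , refl , refl , e′ with trans (sym e) e′
...     | refl = b′ , r , h′

-- The recording tableau is a signed primed tableau

record SignedValid (T : Tab) : Set where
  field
    row-≤ˢ : ∀ {r j x y} → entry T r j ≡ just x → entry T r (suc j) ≡ just y → x ≤ʳ y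
    col-≤ˢ : ∀ {r j x y} → entry T r (suc j) ≡ just x → entry T (suc r) j ≡ just y → x ≤ᶜ y
    shapeˢ : ∀ {r j y} → entry T (suc r) j ≡ just y → ∃ λ x → entry T r (suc j) ≡ just x
    lowˢ   : ∀ {r j x} → entry T r j ≡ just x → 2 ≤ code x
    fullˢ  : ∀ {r} → r < length T → ∃ λ x → entry T r 0 ≡ just x

open SignedValid

DPR-suc : ∀ T r j → entry (DPR T) r (suc j) ≡ entry T r (suc j)
DPR-suc []             r       j = refl
DPR-suc ([] ∷ T)       zero    j = refl
DPR-suc ((e ∷ es) ∷ T) zero    j = refl
DPR-suc (R ∷ T)        (suc r) j = DPR-suc T r j

DPR-zero : ∀ T r → entry (DPR T) r 0 ≡ Maybe.map unprime (entry T r 0)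
DPR-zero []             r       = refl
DPR-zero ([] ∷ T)       zero    = refl
DPR-zero ((e ∷ es) ∷ T) zero    = refl
DPR-zero (R ∷ T)        (suc r) = DPR-zero T r

DPR-entry : ∀ T r j {x} → entry (DPR T) r j ≡ just x →
  ∃ λ x₀ → entry T r j ≡ just x₀ × ((j ≡ 0 × x ≡ unprime x₀) ⊎ (∃ λ k → j ≡ suc k × x ≡ x₀))
DPR-entry T r zero p with entry T r 0 | trans (sym p) (DPR-zero T r)
... | just x₀ | refl = x₀ , refl , inj₁ (refl , refl)
DPR-entry T r (suc j) {x} p = x , trans (sym (DPR-suc T r j)) p , inj₂ (j , refl , refl)

unprime-plain : ∀ x → isPrimed (unprime x) ≡ false
unprime-plain (primed _) = refl
unprime-plain (plain _)  = refl

≤-unprime : ∀ x → code x ≤ code (unprime x)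
≤-unprime (primed _) = n≤1+n _
≤-unprime (plain _)  = ≤-refl

unprime-≤ʳ : ∀ {x y} → x ≤ʳ y → unprime x ≤ʳ y
unprime-≤ʳ {plain _}  p = p
unprime-≤ʳ {primed _} p with p
... | inj₁ q = ≤⇒≤ʳplain q

unprime-≤ᶜ : ∀ {x y} → x ≤ᶜ y → x ≤ᶜ unprime y
unprime-≤ᶜ {y = plain _}  p = p
unprime-≤ᶜ {y = primed _} p = inj₁ (s≤s (≤ᶜ⇒≤ p))

-- Unpriming raises a diagonal entry by one code. To its left and below it there is no box, its
-- right neighbour was already beyond the primed letter, and a larger entry does not disturb the box
-- above.
DPR-Valid : ∀ {T} → SignedValid T → Valid (DPR T)
DPR-Valid {T} V = record
  { row-≤ = λ {r} {j} → rw r j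
  ; col-≤ = λ {r} {j} → cl r j
  ; shape = λ {r} {j} p → let _ , q , _ = DPR-entry T (suc r) j p
                              x , s = shapeˢ V q in x , trans (DPR-suc T r j) s
  ; diag  = λ {r} → dg r
  ; low   = λ {r} {j} → lw r j
  ; full  = λ {r} p → let x , q = fullˢ V (subst (r <_) (length-map _ T) p) in
                      unprime x , trans (DPR-zero T r) (cong (Maybe.map unprime) q)
  }
  where
  rw : ∀ r j {x y} → entry (DPR T) r j ≡ just x → entry (DPR T) r (suc j) ≡ just y → x ≤ʳ y
  rw r j p q with DPR-entry T r j p
  ... | _ , s , inj₁ (refl , refl)     = unprime-≤ʳ (row-≤ˢ V s (trans (sym (DPR-suc T r j)) q))
  ... | _ , s , inj₂ (_ , refl , refl) = row-≤ˢ V s (trans (sym (DPR-suc T r j)) q)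
  cl : ∀ r j {x y} → entry (DPR T) r (suc j) ≡ just x → entry (DPR T) (suc r) j ≡ just y → x ≤ᶜ y
  cl r j p q with DPR-entry T (suc r) j q
  ... | _ , s , inj₁ (refl , refl)     = unprime-≤ᶜ (col-≤ˢ V (trans (sym (DPR-suc T r j)) p) s)
  ... | _ , s , inj₂ (_ , refl , refl) = col-≤ˢ V (trans (sym (DPR-suc T r j)) p) s
  dg : ∀ r {x} → entry (DPR T) r 0 ≡ just x → isPrimed x ≡ false
  dg r p with DPR-entry T r 0 p
  ... | x , _ , inj₁ (_ , refl)   = unprime-plain x
  ... | _ , _ , inj₂ (_ , () , _)
  lw : ∀ r j {x} → entry (DPR T) r j ≡ just x → 2 ≤ code x
  lw r j p with DPR-entry T r j p
  ... | x , s , inj₁ (_ , refl)     = ≤-trans (lowˢ V s) (≤-unprime x)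
  ... | _ , s , inj₂ (_ , _ , refl) = lowˢ V s

nth-∷ʳ-cases : ∀ {A : Set} (L : List A) l {j x} → nth (L ∷ʳ l) j ≡ just x →
  (j ≡ length L × x ≡ l) ⊎ nth L j ≡ just x
nth-∷ʳ-cases []      l {zero}  refl = inj₁ (refl , refl)
nth-∷ʳ-cases (y ∷ L) l {zero}  p    = inj₂ p
nth-∷ʳ-cases (y ∷ L) l {suc j} p    = Sum.map₁ (λ { (q , s) → cong suc q , s }) (nth-∷ʳ-cases L l p)

nth-exists : ∀ {A : Set} (L : List A) {j} → j < length L → ∃ λ x → nth L j ≡ just x
nth-exists (x ∷ L) {zero}  p = x , refl
nth-exists (x ∷ L) {suc j} p = nth-exists L (s<s⁻¹ p)

append-cases : ∀ T r l r′ j {x} → entry (appendRow T r l) r′ j ≡ just x →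
  (r′ ≡ r × j ≡ length (rowAt T r) × x ≡ l) ⊎ entry T r′ j ≡ just x
append-cases []      zero    l zero     zero p = inj₁ (refl , refl , just-injective (sym p))
append-cases []      zero    l zero     (suc j) ()
append-cases []      zero    l (suc r′) j ()
append-cases []      (suc r) l zero     j ()
append-cases []      (suc r) l (suc r′) j p with append-cases [] r l r′ j p
... | inj₁ (refl , q , s) = inj₁ (refl , q , s)
... | inj₂ ()
append-cases (R ∷ T) zero    l zero     j p = Sum.map₁ (refl ,_) (nth-∷ʳ-cases R l p)
append-cases (R ∷ T) zero    l (suc r′) j p = inj₂ p
append-cases (R ∷ T) (suc r) l zero     j p = inj₂ p
append-cases (R ∷ T) (suc r) l (suc r′) j p = Sum.map₁ (λ { (q , s) → cong suc q , s }) (append-cases T r l r′ j p)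

append-old : ∀ T r l r′ j {x} → entry T r′ j ≡ just x → entry (appendRow T r l) r′ j ≡ just x
append-old (R ∷ T) zero    l zero     j p = nth-++ˡ R _ p
append-old (R ∷ T) zero    l (suc r′) j p = p
append-old (R ∷ T) (suc r) l zero     j p = p
append-old (R ∷ T) (suc r) l (suc r′) j p = append-old T r l r′ j p

append-new : ∀ T r l → entry (appendRow T r l) r (length (rowAt T r)) ≡ just l
append-new []      zero    l = refl
append-new []      (suc r) l = append-new [] r l
append-new (R ∷ T) zero    l = trans (cong (nth (R ∷ʳ l)) (sym (+-identityʳ (length R)))) (nth-++ʳ R (l ∷ []) 0)
append-new (R ∷ T) (suc r) l = append-new T r l

incAt : List ℕ → ℕ → List ℕ
incAt []       zero    = 1 ∷ []
incAt []       (suc r) = 0 ∷ incAt [] r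
incAt (n ∷ ns) zero    = suc n ∷ ns
incAt (n ∷ ns) (suc r) = n ∷ incAt ns r

lengths-append : ∀ (T : Tab) r l → map length (appendRow T r l) ≡ incAt (map length T) r
lengths-append []      zero    l = refl
lengths-append []      (suc r) l = cong (0 ∷_) (lengths-append [] r l)
lengths-append (R ∷ T) zero    l = cong (_∷ map length T) (length-∷ʳ R l)
lengths-append (R ∷ T) (suc r) l = cong (length R ∷_) (lengths-append T r l)

rowLengths : List Row → List ℕ
rowLengths = map (length ∘ word)

Step-length : ∀ {X a X′ d} → NF X → Step X a X′ d → length (word X′) ≡ length (word X)
Step-length {X} {a} h s = suc-injective (trans (sym (~-length (Step-~ h s))) (length-∷ʳ (word X) a))

App-length : ∀ {X a X′} → App X a X′ → length (word X′) ≡ suc (length (word X))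
App-length {X} {a} s = trans (cong length (App-word s)) (length-∷ʳ (word X) a)

lengths-Ins : ∀ {Xs a Xs′ r} → All NF Xs → Ins Xs a Xs′ r → rowLengths Xs′ ≡ incAt (rowLengths Xs) r
lengths-Ins _        new        = refl
lengths-Ins (h ∷ hs) (app s)    = cong (_∷ _) (App-length s)
lengths-Ins (h ∷ hs) (bump s i) = cong₂ _∷_ (Step-length h s) (lengths-Ins hs i)

lengths-strict : ∀ {Xs} → All NF Xs → Linked _▹_ Xs → Linked _>_ (rowLengths Xs)
lengths-strict []            []       = []
lengths-strict (h ∷ [])      [-]      = [-]
lengths-strict (h ∷ h′ ∷ hs) (j ∷ js) = ▹-length h h′ j ∷ lengths-strict (h′ ∷ hs) js

Ins-≤length : ∀ {Xs a Xs′ r} → Ins Xs a Xs′ r → r ≤ length Xs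
Ins-≤length new        = z≤n
Ins-≤length (app _)    = z≤n
Ins-≤length (bump _ i) = s≤s (Ins-≤length i)

length-rowAt : ∀ (T : Tab) r → length (rowAt T r) ≡ fromMaybe 0 (nth (map length T) r)
length-rowAt []      r       = refl
length-rowAt (R ∷ T) zero    = refl
length-rowAt (R ∷ T) (suc r) = length-rowAt T r

strict-at : ∀ {ns} r → Linked _>_ ns → suc r < length ns → fromMaybe 0 (nth ns (suc r)) < fromMaybe 0 (nth ns r)
strict-at zero    (p ∷ _)  _ = p
strict-at (suc r) (_ ∷ ps) q = strict-at r ps (s<s⁻¹ q)
strict-at r       [-]      (s≤s ())

record State (T : Tab) (Xs : List Row) : Set where
  constructor state
  field
    tableau : SignedValid T
    lengths : map length T ≡ rowLengths Xs
    normal  : All NF Xs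
    fitting : Linked _▹_ Xs

open State

State-[] : State [] []
State-[] = state (record { row-≤ˢ = λ () ; col-≤ˢ = λ () ; shapeˢ = λ () ; lowˢ = λ () ; fullˢ = λ () }) refl [] []

length-append : ∀ (T : Tab) r l → r ≤ length T → length T ≤ length (appendRow T r l) ×
  (∀ {r′} → r′ < length (appendRow T r l) → r′ < length T ⊎ (r′ ≡ r × rowAt T r ≡ []))
length-append []      zero    l p = z≤n , λ { {zero} _ → inj₂ (refl , refl) ; {suc _} (s≤s ()) }
length-append (R ∷ T) zero    l p = ≤-refl , inj₁
length-append (R ∷ T) (suc r) l p with length-append T r l (s≤s⁻¹ p)
... | q , f = s≤s q , λ { {zero} _ → inj₁ z<s ; {suc r′} s → Sum.map s<s (λ { (refl , e) → refl , e }) (f (s<s⁻¹ s)) }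

addBox : ∀ {T Xs a Xs′ r l} → State T Xs → Ins Xs a Xs′ r →
  (∀ {j x} → entry T r j ≡ just x → x ≤ʳ l) →
  (∀ {r′ j x} → r ≡ suc r′ → entry T r′ j ≡ just x → x ≤ᶜ l) →
  2 ≤ code l → State (appendRow T r l) Xs′
addBox {T} {Xs} {a} {Xs′} {r} {l} (state V ln hs js) i left above-l lw = state V′ ln′ hs′ js′
  where
  T′  = appendRow T r l
  hs′ = Ins-NF hs i
  js′ = Ins-▹ hs i js
  ln′ : map length T′ ≡ rowLengths Xs′
  ln′ = trans (lengths-append T r l) (trans (cong (λ ns → incAt ns r) ln) (sym (lengths-Ins hs i)))
  len≡ : ∀ {T Xs} → map length T ≡ rowLengths Xs → length T ≡ length Xs
  len≡ {T} {Xs} e = trans (sym (length-map length T)) (trans (cong length e) (length-map (length ∘ word) Xs))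
  r≤ : r ≤ length T
  r≤ = subst (r ≤_) (sym (len≡ {T} {Xs} ln)) (Ins-≤length i)
  strict : Linked _>_ (map length T′)
  strict = subst (Linked _>_) (sym ln′) (lengths-strict hs′ js′)
  -- The lengths of the enlarged rows decrease strictly, so there is a box above the new one; lying
  -- in another row, it is an old box.
  room-above : ∀ {r′} → r ≡ suc r′ → ∃ λ x → entry T r′ (suc (length (rowAt T r))) ≡ just x
  room-above {r′} refl with nth-exists (rowAt T′ r′) (<-≤-trans (s<s (nth-< (rowAt T′ r) (append-new T r l)))
      (subst₂ _<_ (sym (length-rowAt T′ r)) (sym (length-rowAt T′ r′))
        (strict-at r′ strict (subst (r <_) (sym (length-map length T′)) (entry-< T′ r (append-new T r l))))))
  ... | x , p with append-cases T r l r′ (suc (length (rowAt T r))) p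
  ...   | inj₁ (e , _) = contradiction (sym e) 1+n≢n
  ...   | inj₂ q       = x , q
  V′ : SignedValid T′
  V′ = record
    { row-≤ˢ = λ {r′} {j} → rw r′ j
    ; col-≤ˢ = λ {r′} {j} → cl r′ j
    ; shapeˢ = λ {r′} {j} → sh r′ j
    ; lowˢ   = λ {r′} {j} p → [ (λ { (_ , _ , refl) → lw }) , lowˢ V ]′ (append-cases T r l r′ j p)
    ; fullˢ  = λ {r′} p → fl r′ (proj₂ (length-append T r l r≤) p)
    }
    where
    rw : ∀ r′ j {x y} → entry T′ r′ j ≡ just x → entry T′ r′ (suc j) ≡ just y → x ≤ʳ y
    rw r′ j p q with append-cases T r l r′ j p | append-cases T r l r′ (suc j) q
    ... | inj₁ (refl , refl , _) | inj₁ (_ , e , _) = contradiction e 1+n≢n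
    ... | inj₁ (refl , refl , _) | inj₂ q′ = contradiction (nth-< (rowAt T r) q′) (≤⇒≯ (n≤1+n _))
    ... | inj₂ p′ | inj₁ (refl , _ , refl) = left p′
    ... | inj₂ p′ | inj₂ q′ = row-≤ˢ V p′ q′
    cl : ∀ r′ j {x y} → entry T′ r′ (suc j) ≡ just x → entry T′ (suc r′) j ≡ just y → x ≤ᶜ y
    cl r′ j p q with append-cases T r l r′ (suc j) p | append-cases T r l (suc r′) j q
    ... | inj₁ (refl , _ , _) | inj₁ (e , _) = contradiction e 1+n≢n
    ... | inj₁ (refl , e , _) | inj₂ q′ with shapeˢ V q′
    ...   | _ , s = contradiction (nth-< (rowAt T r) s) (≤⇒≯ (≤-reflexive (sym e)))
    cl r′ j p q | inj₂ p′ | inj₁ (e , _ , refl) = above-l (sym e) p′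
    cl r′ j p q | inj₂ p′ | inj₂ q′ = col-≤ˢ V p′ q′
    sh : ∀ r′ j {y} → entry T′ (suc r′) j ≡ just y → ∃ λ x → entry T′ r′ (suc j) ≡ just x
    sh r′ j q with append-cases T r l (suc r′) j q
    ... | inj₁ (e , refl , _) = let x , s = room-above (sym e) in x , append-old T r l r′ _ s
    ... | inj₂ q′             = let x , s = shapeˢ V q′ in x , append-old T r l r′ _ s
    fl : ∀ r′ → r′ < length T ⊎ (r′ ≡ r × rowAt T r ≡ []) → ∃ λ x → entry T′ r′ 0 ≡ just x
    fl r′ (inj₁ p) = let x , s = fullˢ V p in x , append-old T r l r′ 0 s
    fl r′ (inj₂ (refl , e)) = l , subst (λ R → entry T′ r (length R) ≡ just l) e (append-new T r l)

-- The labels of the boxes of one factor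

peakLabels : ℕ → Sign → List ℕ → List PL
peakLabels i s []           = []
peakLabels i s (x ∷ [])     = signLabel i s ∷ []
peakLabels i s (x ∷ y ∷ xs) =
  if x <ᵇ y then primed i ∷ peakLabels i s (y ∷ xs) else signLabel i s ∷ map (λ _ → plain i) (y ∷ xs)

mkLabels-after : ∀ i s {k pos} xs → k < pos → mkLabels i s k pos xs ≡ map (λ _ → plain i) xs
mkLabels-after i s []       p = refl
mkLabels-after i s (x ∷ xs) p rewrite <ᵇ-false (<⇒≤ p) | ≡ᵇ-false (>⇒≢ p) =
  cong (plain i ∷_) (mkLabels-after i s xs (m<n⇒m<1+n p))

incPrefixLen-pos : ∀ x xs → 1 ≤ incPrefixLen (x ∷ xs)
incPrefixLen-pos x []       = ≤-refl
incPrefixLen-pos x (y ∷ xs) with x <ᵇ y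
... | true  = s≤s z≤n
... | false = ≤-refl

mkLabels-primed : ∀ i s {k pos} x xs → pos < k →
  mkLabels i s k pos (x ∷ xs) ≡ primed i ∷ mkLabels i s k (suc pos) xs
mkLabels-primed i s x xs p rewrite <ᵇ-true p = refl

mkLabels-last : ∀ i s k x xs → mkLabels i s k k (x ∷ xs) ≡ signLabel i s ∷ map (λ _ → plain i) xs
mkLabels-last i s k x xs rewrite <ᵇ-false (≤-refl {k}) | ≡ᵇ-true k =
  cong (signLabel i s ∷_) (mkLabels-after i s xs ≤-refl)

-- `p` boxes precede the list. Positions in `mkLabels` start at 1, hence the current position
-- `suc p` and the peak at `incPrefixLen xs + p`.
mkLabels-peak : ∀ i s p xs → mkLabels i s (incPrefixLen xs + p) (suc p) xs ≡ peakLabels i s xs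
mkLabels-peak i s p []       = refl
mkLabels-peak i s p (x ∷ []) = mkLabels-last i s (suc p) x []
mkLabels-peak i s p (x ∷ y ∷ xs) with x <ᵇ y | mkLabels-peak i s (suc p) (y ∷ xs)
... | true  | ih = trans (mkLabels-primed i s x (y ∷ xs) (s<s (+-monoˡ-≤ p (incPrefixLen-pos y xs))))
  (cong (primed i ∷_) (trans (cong (λ k → mkLabels i s k (2 + p) (y ∷ xs)) (sym (+-suc (incPrefixLen (y ∷ xs)) p)))
                             ih))
... | false | _ = mkLabels-last i s (suc p) x (y ∷ xs)

mkLabels≡ : ∀ i s xs → mkLabels i s (incPrefixLen xs) 1 xs ≡ peakLabels i s xs
mkLabels≡ i s xs = trans (cong (λ k → mkLabels i s k 1 xs) (sym (+-identityʳ (incPrefixLen xs)))) (mkLabels-peak i s 0 xs)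

Below : Tab → ℕ → Set
Below T n = ∀ {r j z} → entry T r j ≡ just z → code z < n

Below-append : ∀ T r l {n} → Below T n → code l < n → Below (appendRow T r l) n
Below-append T r l b p {r′} {j} q with append-cases T r l r′ j q
... | inj₁ (_ , _ , refl) = p
... | inj₂ q′             = b q′

plain-low : ∀ {i} → 1 ≤ i → 2 ≤ code (plain i)
plain-low {suc i} _ = s≤s (s≤s z≤n)

≤⇒≤ʳplain′ : ∀ {x i} → code x ≤ code (plain i) → x ≤ʳ plain i
≤⇒≤ʳplain′ {x} {i} p with m≤n⇒m<n∨m≡n p
... | inj₁ q = inj₁ q
... | inj₂ q with code-injective x (plain i) q
...   | refl = inj₂ (refl , refl)

≤⇒≤ᶜprimed′ : ∀ {x i} → code x ≤ code (primed i) → x ≤ᶜ primed i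
≤⇒≤ᶜprimed′ {x} {i} p with m≤n⇒m<n∨m≡n p
... | inj₁ q = inj₁ q
... | inj₂ q with code-injective x (primed i) q
...   | refl = inj₂ (refl , refl)

-- The rows strictly above the last box hold neither `i` nor anything larger, so an `i` placed in
-- the same row or higher never gets an equal letter above it.
addDown : ∀ {T Xs us Xs′ x xs} i → 1 ≤ i → State T Xs → InsWord Xs us Xs′ xs → WeakDown x xs →
  Below T (2 + 2 * i) → (∀ {r j z} → r < x → entry T r j ≡ just z → code z < suc (2 * i)) →
  State (addLabels T (map (λ _ → plain i) xs) xs) Xs′ × Below (addLabels T (map (λ _ → plain i) xs) xs) (2 + 2 * i)
addDown i 1≤i st [] [] b _ = st , b
addDown {T} {x = x} i 1≤i st (_∷_ {r = y} d is) (y≤x ∷ w) b h =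
  addDown i 1≤i (addBox st d (λ p → ≤⇒≤ʳplain′ (s≤s⁻¹ (b p))) (λ { refl p → inj₁ (h y≤x p) }) (plain-low 1≤i))
    is w (Below-append T y (plain i) b ≤-refl) h′
  where
  h′ : ∀ {r j z} → r < y → entry (appendRow T y (plain i)) r j ≡ just z → code z < suc (2 * i)
  h′ {r} {j} r<y q with append-cases T y (plain i) r j q
  ... | inj₁ (refl , _) = contradiction r<y (<-irrefl refl)
  ... | inj₂ q′         = h (<-≤-trans r<y y≤x) q′

-- Before the peak the rows from `x` on hold only letters of earlier factors, so each new `i'` is
-- the first of its row. All other entries are at most `i'`, which a column tolerates above an `i'`.
addPeak : ∀ {T Xs us Xs′ x xs} i s → 1 ≤ i → State T Xs → InsWord Xs us Xs′ (x ∷ xs) → Peak x xs →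
  Below T (suc (2 * i)) → (∀ {r j z} → x ≤ r → entry T r j ≡ just z → code z < 2 * i) →
  State (addLabels T (peakLabels i s (x ∷ xs)) (x ∷ xs)) Xs′ ×
  Below (addLabels T (peakLabels i s (x ∷ xs)) (x ∷ xs)) (2 + 2 * i)
addPeak {T} {Xs} {_ ∷ _} {Xs′} {x} {xs} i s 1≤i st (d ∷ is) (down w) b h = go xs w is
  where
  l = signLabel i s
  l≤ : ∀ s → code (signLabel i s) < 2 + 2 * i
  l≤ sminus = n≤1+n _
  l≤ splus  = ≤-refl
  l≤ szero  = ≤-refl
  l-low : ∀ s → 2 ≤ code (signLabel i s)
  l-low sminus = *-monoʳ-≤ 2 1≤i
  l-low splus  = plain-low 1≤i
  l-low szero  = plain-low 1≤i
  left : ∀ s {z} → code z < 2 * i → z ≤ʳ signLabel i s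
  left sminus p = inj₁ p
  left splus  p = inj₁ (m<n⇒m<1+n p)
  left szero  p = inj₁ (m<n⇒m<1+n p)
  up-l : ∀ s {z} → code z < suc (2 * i) → z ≤ᶜ signLabel i s
  up-l sminus p = ≤⇒≤ᶜprimed′ (s≤s⁻¹ p)
  up-l splus  p = inj₁ p
  up-l szero  p = inj₁ p
  st′ = addBox {l = l} st d (λ p → left s (h ≤-refl p)) (λ { refl p → up-l s (b p) }) (l-low s)
  b′ : Below (appendRow T x l) (2 + 2 * i)
  b′ = Below-append T x l (λ p → m<n⇒m<1+n (b p)) (l≤ s)
  h′ : ∀ {r j z} → r < x → entry (appendRow T x l) r j ≡ just z → code z < suc (2 * i)
  h′ {r} {j} r<x q with append-cases T x l r j q
  ... | inj₁ (refl , _) = contradiction r<x (<-irrefl refl)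
  ... | inj₂ q′         = b q′
  rest : ∀ {us xs} → WeakDown x xs → InsWord _ us Xs′ xs → _
  rest w is = addDown i 1≤i st′ is w b′ h′
  go : ∀ {us} xs → WeakDown x xs → InsWord _ us Xs′ xs →
    State (addLabels T (peakLabels i s (x ∷ xs)) (x ∷ xs)) Xs′ ×
    Below (addLabels T (peakLabels i s (x ∷ xs)) (x ∷ xs)) (2 + 2 * i)
  go []       w         is = rest w is
  go (y ∷ ys) w@(q ∷ _) is rewrite <ᵇ-false q = rest w is
addPeak {T} {x = x} i s 1≤i st (d ∷ is) (_∷_ {y = y} x<y w) b h rewrite <ᵇ-true x<y =
  addPeak i s 1≤i
    (addBox st d (λ p → inj₁ (h ≤-refl p)) (λ { refl p → ≤⇒≤ᶜprimed′ (s≤s⁻¹ (b p)) }) (*-monoʳ-≤ 2 1≤i))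
    is w (Below-append T x (primed i) b ≤-refl) h′
  where
  h′ : ∀ {r j z} → y ≤ r → entry (appendRow T x (primed i)) r j ≡ just z → code z < 2 * i
  h′ {r} {j} y≤r q with append-cases T x (primed i) r j q
  ... | inj₁ (refl , _) = contradiction y≤r (<⇒≱ x<y)
  ... | inj₂ q′         = h (≤-trans (<⇒≤ x<y) y≤r) q′

-- Unimodal words and the run of `KR'` over all factors

Um : List ℕ → Set
Um []       = ⊤
Um (x ∷ xs) = Dn x xs

Linked⇒Up : ∀ {x xs} → Linked _<_ (x ∷ xs) → Up x xs
Linked⇒Up [-]     = []
Linked⇒Up (p ∷ l) = p ∷ Linked⇒Up l

Up⇒Linked : ∀ {x xs} → Up x xs → Linked _<_ (x ∷ xs)
Up⇒Linked []      = [-]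
Up⇒Linked (p ∷ u) = p ∷ Up⇒Linked u

Unimodal⇒Um : ∀ {a} → Unimodal a → Um a
Unimodal⇒Um {[]}     _ = tt
Unimodal⇒Um {x ∷ xs} (k , _ , l , m) = go k xs l m
  where
  go : ∀ k {x} xs → Linked _>_ (take k (x ∷ xs)) → Linked _<_ (drop (k ∸ 1) (x ∷ xs)) → Dn x xs
  go zero          xs       l       m = up (Linked⇒Up m)
  go (suc zero)    xs       l       m = up (Linked⇒Up m)
  go (suc (suc k)) []       l       m = up []
  go (suc (suc k)) (y ∷ ys) (p ∷ l) m = p ∷ go (suc k) ys l m

Um⇒Unimodal : ∀ {a} → Um a → Unimodal a
Um⇒Unimodal {[]}     _ = 0 , z≤n , [] , []
Um⇒Unimodal {x ∷ xs} u = let k , p , l , m = go u in suc k , p , l , m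
  where
  go : ∀ {x xs} → Dn x xs → ∃ λ k → suc k ≤ length (x ∷ xs) ×
    Linked _>_ (take (suc k) (x ∷ xs)) × Linked _<_ (drop k (x ∷ xs))
  go (up u)  = 0 , s≤s z≤n , [-] , Up⇒Linked u
  go (p ∷ d) = let k , q , l , m = go d in suc k , s≤s q , p ∷ l , m

KR′go-cons : ∀ i s {a P P′ xs} T fs → krInsWord P a ≡ (P′ , xs) →
  KR'go i ((s , a) ∷ fs) (P , T) ≡ KR'go (suc i) fs (P′ , addLabels T (peakLabels i s xs) xs)
KR′go-cons i s {xs = xs} T fs e rewrite e | mkLabels≡ i s xs = refl

-- `2 * i` is the code of `i'`: before factor `i` every recorded letter is smaller.
KR′go-State : ∀ i fs {T Xs} → 1 ≤ i → State T Xs → Below T (2 * i) → All (Um ∘ proj₂) fs →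
  Red (read Xs ++ concatMap proj₂ fs) →
  SignedValid (proj₂ (KR'go i fs (map word Xs , T)))
KR′go-State i [] 1≤i st b us red = tableau st
KR′go-State i ((s , a) ∷ fs) {T} {Xs} 1≤i st b (u ∷ us) red
  with krInsWord-InsWord {Xs} {a} (normal st) (Red-++ˡ (concatMap proj₂ fs) red′)
  where red′ = Red-~ (~reflexive (sym (++-assoc (read Xs) a (concatMap proj₂ fs)))) red
... | Xs′ , xs , is , e , hs′ , r rewrite KR′go-cons i s T fs e =
  KR′go-State (suc i) fs {Xs = Xs′} (m≤n⇒m≤1+n 1≤i) (proj₁ next-state) below′ us
    (Red-~ (~trans (~reflexive (sym (++-assoc (read Xs) a (concatMap proj₂ fs)))) (~++ʳ (concatMap proj₂ fs) r)) red)
  where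
  T′ = addLabels T (peakLabels i s xs) xs
  next-of : ∀ {a xs} → Um a → InsWord Xs a Xs′ xs → Red (read Xs ++ a) →
    State (addLabels T (peakLabels i s xs) xs) Xs′ × Below (addLabels T (peakLabels i s xs) xs) (2 + 2 * i)
  next-of {[]} u [] _ = st , λ p → ≤-trans (b p) (m≤n+m (2 * i) 2)
  next-of {x ∷ a} u is@(_ ∷ _) red = addPeak i s 1≤i st is (rows-Peak (normal st) red u is)
    (λ p → m<n⇒m<1+n (b p)) (λ _ p → b p)
  next-state = next-of u is (Red-++ˡ (concatMap proj₂ fs)
                 (Red-~ (~reflexive (sym (++-assoc (read Xs) a (concatMap proj₂ fs)))) red))
  below′ : Below T′ (2 * suc i)
  below′ {r} {j} {z} p = subst (λ n → code z < n) (sym (*-suc 2 i)) (proj₂ next-state {r} {j} p)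

-- The first row of the recording tableau

-- The labels outside the first row are unrestricted, because the odd operator is read off the first
-- row.
data Boxes (θ : ℕ) : List PL → List ℕ → Set where
  []  : Boxes θ [] []
  _∷_ : ∀ {l ls x xs} → (x ≡ 0 → θ ≤ code l) → Boxes θ ls xs → Boxes θ (l ∷ ls) (x ∷ xs)

Boxes-plain : ∀ {θ i} xs → θ ≤ code (plain i) → Boxes θ (map (λ _ → plain i) xs) xs
Boxes-plain []       p = []
Boxes-plain (x ∷ xs) p = (λ _ → p) ∷ Boxes-plain xs p

signLabel-≥ : ∀ i s → 2 * i ≤ code (signLabel i s)
signLabel-≥ i sminus = ≤-refl
signLabel-≥ i splus  = n≤1+n _
signLabel-≥ i szero  = n≤1+n _

Boxes-peak : ∀ {θ} i s xs → θ ≤ 2 * i → Boxes θ (peakLabels i s xs) xs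
Boxes-peak i s []       p = []
Boxes-peak i s (x ∷ []) p = (λ _ → ≤-trans p (signLabel-≥ i s)) ∷ []
Boxes-peak i s (x ∷ y ∷ xs) p with x <ᵇ y | Boxes-peak i s (y ∷ xs) p
... | true  | bs = (λ _ → p) ∷ bs
... | false | _  = (λ _ → ≤-trans p (signLabel-≥ i s)) ∷ Boxes-plain (y ∷ xs) (m≤n⇒m≤1+n p)

-- Starting off the first row, the boxes met in the first row lie after the peak.
Boxes-offrow : ∀ {θ} i s {x xs} → Peak x xs → 0 < x → θ ≤ code (plain i) → Boxes θ (peakLabels i s (x ∷ xs)) (x ∷ xs)
Boxes-offrow i s {xs = []} _ p q = (λ e → contradiction (sym e) (<⇒≢ p)) ∷ []
Boxes-offrow i s {xs = y ∷ xs} (down (y≤x ∷ _)) p q rewrite <ᵇ-false y≤x =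
  (λ e → contradiction (sym e) (<⇒≢ p)) ∷ Boxes-plain (y ∷ xs) q
Boxes-offrow i s {xs = y ∷ xs} (x<y ∷ pk) p q rewrite <ᵇ-true x<y =
  (λ e → contradiction (sym e) (<⇒≢ p)) ∷ Boxes-offrow i s pk (<-trans p x<y) q

-- The insertion tableau is common to both runs, so the later factors create the same boxes with the
-- same labels. In the first row they are appended behind the prefixes that differ.
module TwinRuns (θ : ℕ) (p p′ : List PL) (len : length p ≡ length p′)
                (small : All (λ x → code x ≤ θ) p) (small′ : All (λ x → code x ≤ θ) p′) where

  open Twins θ p p′ len small small′

  addLabels-twin : ∀ {T T′ ls xs} → Boxes θ ls xs → Twin T T′ → Twin (addLabels T ls xs) (addLabels T′ ls xs)
  addLabels-twin [] t = t
  addLabels-twin (_∷_ {x = zero}  q bs) t = addLabels-twin bs (append-twin 0 t (q refl))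
  addLabels-twin (_∷_ {x = suc x} q bs) (twin big refl refl) = addLabels-twin bs (twin big refl refl)

  KR′go-twin : ∀ {T T′} i fs P → θ ≤ 2 * i → Twin T T′ →
    proj₁ (KR'go i fs (P , T′)) ≡ proj₁ (KR'go i fs (P , T)) ×
    Twin (proj₂ (KR'go i fs (P , T))) (proj₂ (KR'go i fs (P , T′)))
  KR′go-twin i [] P q t = refl , t
  KR′go-twin {T} {T′} i ((s , a) ∷ fs) P q t
    rewrite KR′go-cons i s {a} {P} T fs refl | KR′go-cons i s {a} {P} T′ fs refl =
    KR′go-twin (suc i) fs (proj₁ (krInsWord P a)) (≤-trans q (*-monoʳ-≤ 2 (n≤1+n i)))
      (addLabels-twin (Boxes-peak i s (proj₂ (krInsWord P a)) q) t)

addLabels-row0 : ∀ {θ T ls xs} → Boxes θ ls xs → All (λ x → θ ≤ code x) (rowAt T 0) →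
  All (λ x → θ ≤ code x) (rowAt (addLabels T ls xs) 0)
addLabels-row0 [] h = h
addLabels-row0 {T = []}    (_∷_ {x = zero}  q bs) h = addLabels-row0 bs (q refl ∷ [])
addLabels-row0 {T = []}    (_∷_ {x = suc x} q bs) h = addLabels-row0 bs []
addLabels-row0 {T = R ∷ T} (_∷_ {x = zero}  q bs) h = addLabels-row0 bs (All.∷ʳ⁺ h (q refl))
addLabels-row0 {T = R ∷ T} (_∷_ {x = suc x} q bs) h = addLabels-row0 {T = R ∷ appendRow T x _} bs h

KR′go-row0 : ∀ {θ T} i fs P → θ ≤ 2 * i → All (λ x → θ ≤ code x) (rowAt T 0) →
  All (λ x → θ ≤ code x) (rowAt (proj₂ (KR'go i fs (P , T))) 0)
KR′go-row0 i [] P q h = h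
KR′go-row0 {T = T} i ((s , a) ∷ fs) P q h rewrite KR′go-cons i s {a} {P} T fs refl =
  KR′go-row0 (suc i) fs (proj₁ (krInsWord P a)) (≤-trans q (*-monoʳ-≤ 2 (n≤1+n i)))
    (addLabels-row0 {T = T} (Boxes-peak i s (proj₂ (krInsWord P a)) q) h)

-- Unimodal words stay in the first row

Um-word : ∀ {X} → NF X → Um (word X)
Um-word (nf pE aE aU pU) = go _ pE aE (rising aU pU)
  where
  rising : ∀ {e U} → All (e <_) U → AllPairs _<_ U → Up e U
  rising []      []      = []
  rising (p ∷ _) (q ∷ s) = p ∷ rising q s
  go : ∀ E {e U} → AllPairs _>_ E → All (e <_) E → Up e U → Um (E ++ e ∷ U)
  go []          _             _        u = up u
  go (x ∷ [])    _             (p ∷ _)  u = p ∷ up u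
  go (x ∷ y ∷ E) ((p ∷ _) ∷ s) (_ ∷ ps) u = p ∷ go (y ∷ E) s ps u

zero-rows : ∀ {X us Xs xs} → NF X → InsWord (X ∷ []) us Xs xs → All (_≡ 0) xs →
  ∃ λ X′ → Xs ≡ X′ ∷ [] × NF X′ × word X′ ≡ word X ++ us
zero-rows {X} h [] [] = X , refl , h , sym (++-identityʳ (word X))
zero-rows {X} {a ∷ us} h (app s ∷ is) (refl ∷ zs) with zero-rows (App-NF h s) is zs
... | X′ , e , h′ , w = X′ , e , h′ , trans w (trans (cong (_++ us) (App-word s)) (++-assoc (word X) (a ∷ []) us))

InsWord-length : ∀ {Xs us Xs′ xs} → InsWord Xs us Xs′ xs → length xs ≡ length us
InsWord-length []       = refl
InsWord-length (_ ∷ is) = cong suc (InsWord-length is)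

WeakDown-zero : ∀ {xs} → WeakDown 0 xs → All (_≡ 0) xs
WeakDown-zero []        = []
WeakDown-zero (z≤n ∷ w) = refl ∷ WeakDown-zero w

All-zero : ∀ {xs} → All (_≡ 0) xs → xs ≡ replicate (length xs) 0
All-zero []          = refl
All-zero (refl ∷ zs) = cong (0 ∷_) (All-zero zs)

zero-All : ∀ n → All (_≡ 0) (replicate n 0)
zero-All zero    = []
zero-All (suc n) = refl ∷ zero-All n

-- A row with empty `R↑` accepts every unimodal continuation of its last letter (`Pass-decreasing`),
-- so nothing is bumped.
unimodal-krInsWord : ∀ {x us} → Dn x us → Red (x ∷ us) →
  ∃ λ X → NF X × word X ≡ x ∷ us × krInsWord [] (x ∷ us) ≡ (word X ∷ [] , replicate (suc (length us)) 0)
unimodal-krInsWord {x} {us} dns red with krInsWord-InsWord {[]} {x ∷ us} [] red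
... | Xs , _ , new ∷ is , e , _ with InsWord-Pass is
... | _ , _ , _ , _ , p , _ , m with WeakDown-zero (Merge-none {y = 0} (Pass-decreasing dns p) m)
... | zs with zero-rows (nf [] [] [] []) is zs
... | X , refl , h , w = X , h , w , trans e (cong (λ l → word X ∷ [] , 0 ∷ l)
      (trans (All-zero zs) (cong (λ n → replicate n 0) (InsWord-length is))))

krInsWord-++ : ∀ P a b → krInsWord P (a ++ b) ≡
  (proj₁ (krInsWord (proj₁ (krInsWord P a)) b) , proj₂ (krInsWord P a) ++ proj₂ (krInsWord (proj₁ (krInsWord P a)) b))
krInsWord-++ P []      b = refl
krInsWord-++ P (x ∷ a) b = cong (λ z → proj₁ z , proj₂ (krIns P x) ∷ proj₂ z) (krInsWord-++ (proj₁ (krIns P x)) a b)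

krInsWord-length : ∀ P a → length (proj₂ (krInsWord P a)) ≡ length a
krInsWord-length P []      = refl
krInsWord-length P (x ∷ a) = cong suc (krInsWord-length (proj₁ (krIns P x)) a)

peakLabels-zeros : ∀ i s n → peakLabels i s (replicate (suc n) 0) ≡ signLabel i s ∷ map (λ _ → plain i) (replicate n 0)
peakLabels-zeros i s zero    = refl
peakLabels-zeros i s (suc n) = refl

addLabels-ones : ∀ R m → addLabels (R ∷ []) (map (λ _ → plain 1) (replicate m 0)) (replicate m 0) ≡ (R ++ ones m) ∷ []
addLabels-ones R zero    = cong (_∷ []) (sym (++-identityʳ R))
addLabels-ones R (suc m) = trans (addLabels-ones (R ∷ʳ plain 1) m) (cong (_∷ []) (++-assoc R (plain 1 ∷ []) (ones m)))

first-labels : ∀ s m → addLabels [] (peakLabels 1 s (replicate (suc m) 0)) (replicate (suc m) 0) ≡ (signLabel 1 s ∷ ones m) ∷ []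
first-labels s m rewrite peakLabels-zeros 1 s m = addLabels-ones (signLabel 1 s ∷ []) m

unprime-signLabel : ∀ i s → unprime (signLabel i s) ≡ plain i
unprime-signLabel i sminus = refl
unprime-signLabel i splus  = refl
unprime-signLabel i szero  = refl

-- `PR` gives the diagonal box its prime back. Hence the sign of the factor that owned the box, the
-- first or the second, becomes the sign of the new first factor.
restore-signLabel : ∀ i s → (if isPrimed (signLabel (suc i) s) then prime (plain 1) else plain 1) ≡ signLabel 1 s
restore-signLabel i sminus = refl
restore-signLabel i splus  = refl
restore-signLabel i szero  = refl

PR-DPR : ∀ T → (∀ {r} → r < length T → ∃ λ x → entry T r 0 ≡ just x) → PR T (DPR T) ≡ T
PR-DPR []                     f = refl
PR-DPR ([] ∷ T)               f with f {0} z<s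
... | _ , ()
PR-DPR ((primed v ∷ es) ∷ T) f = cong ((primed v ∷ es) ∷_) (PR-DPR T (λ p → f (s<s p)))
PR-DPR ((plain v ∷ es) ∷ T)  f = cong ((plain v ∷ es) ∷_) (PR-DPR T (λ p → f (s<s p)))

-- The odd operator evaluated on recording tableaux

valid-Um : ∀ {A} → All ValidFactor A → All (Um ∘ proj₂) A
valid-Um = All.map (Unimodal⇒Um ∘ proj₁)

KR′-SignedValid : ∀ {n w m A} → InU n w m A → SignedValid (proj₂ (KR' A))
KR′-SignedValid {A = A} (_ , vs , red) =
  KR′go-State 1 A ≤-refl State-[] (λ ()) (valid-Um vs) (reduced⇒Red red)

EF-zero : ∀ {n w m A} → InU n w m A → lowerRow (rowAt (DPR (proj₂ (KR' A))) 0) ≡ nothing → EF n w m A nothing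
EF-zero u e with HM-onto _ refl (DPR-Valid (KR′-SignedValid u))
... | b , h , pos = isZero b h (eOdd-nothing pos h e)

-- `KR'` must end in the same insertion tableau for `A` and `B`, and in recording tableaux that
-- agree below the first row; the first rows are related by `lowerRow` up to the prime of the
-- diagonal box.
EF-just : ∀ {n w m A B e R Rs R′ Q} → InU n w m A → InU n w m B →
  KR' A ≡ (Q , (e ∷ R) ∷ Rs) → lowerRow (unprime e ∷ R) ≡ just (plain 1 ∷ R′) →
  KR' B ≡ (Q , ((if isPrimed e then prime (plain 1) else plain 1) ∷ R′) ∷ Rs) →
  EF n w m A (just B)
EF-just {A = A} {B} {e} {R} {Rs} {R′} {Q} u v eqA l eqB
  with HM-onto _ refl (DPR-Valid {(e ∷ R) ∷ Rs} (subst (SignedValid ∘ proj₂) eqA (KR′-SignedValid u)))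
... | b , h , pos with eOdd-just pos h l
... | b′ , o , h′ = isJust B b b′ ((plain 1 ∷ R′) ∷ DPR Rs)
  (subst (λ z → HMfrom [] b (DPR (proj₂ z))) (sym eqA) h) o h′ v
  (trans eqB (trans
    (cong (λ U → Q , ((if isPrimed e then prime (plain 1) else plain 1) ∷ R′) ∷ U)
          (sym (PR-DPR Rs (λ p → fullˢ sv (s<s p)))))
    (cong (λ z → proj₁ z , PR (proj₂ z) ((plain 1 ∷ R′) ∷ DPR Rs)) (sym eqA))))
  where
  sv : SignedValid ((e ∷ R) ∷ Rs)
  sv = subst (SignedValid ∘ proj₂) eqA (KR′-SignedValid u)

-- The first two factors

KR′-two : ∀ s₁ s₂ {a₁ a₂ P₁ P₂ xs₁ xs₂} rest → krInsWord [] a₁ ≡ (P₁ , xs₁) → krInsWord P₁ a₂ ≡ (P₂ , xs₂) →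
  let T₁ = addLabels [] (peakLabels 1 s₁ xs₁) xs₁ in
  KR' ((s₁ , a₁) ∷ (s₂ , a₂) ∷ rest) ≡ KR'go 3 rest (P₂ , addLabels T₁ (peakLabels 2 s₂ xs₂) xs₂)
KR′-two s₁ s₂ {a₂ = a₂} {xs₁ = xs₁} rest e₁ e₂ =
  trans (KR′go-cons 1 s₁ [] ((s₂ , a₂) ∷ rest) e₁)
        (KR′go-cons 2 s₂ (addLabels [] (peakLabels 1 s₁ xs₁) xs₁) rest e₂)

signLabel₁-≤5 : ∀ s → code (signLabel 1 s) ≤ 5
signLabel₁-≤5 sminus = s≤s (s≤s z≤n)
signLabel₁-≤5 splus  = s≤s (s≤s (s≤s z≤n))
signLabel₁-≤5 szero  = s≤s (s≤s (s≤s z≤n))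

signLabel₂-≤5 : ∀ s → code (signLabel 2 s) ≤ 5
signLabel₂-≤5 sminus = m≤m+n 4 1
signLabel₂-≤5 splus  = ≤-refl
signLabel₂-≤5 szero  = ≤-refl

-- No 2′ in the first row, which contains a 1.
EF-zero-ones : ∀ {n w k} s₁ s₂ {a₁ a₂ P₁ P₂ m xs₂ rest} →
  InU n w k ((s₁ , a₁) ∷ (s₂ , a₂) ∷ rest) →
  krInsWord [] a₁ ≡ (P₁ , replicate (suc m) 0) → krInsWord P₁ a₂ ≡ (P₂ , xs₂) →
  Boxes 5 (peakLabels 2 s₂ xs₂) xs₂ →
  EF n w k ((s₁ , a₁) ∷ (s₂ , a₂) ∷ rest) nothing
EF-zero-ones s₁ s₂ {a₁} {a₂} {P₁} {P₂} {m} {xs₂} {rest} u e₁ e₂ bs = EF-zero u (trans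
    (cong (λ z → lowerRow (rowAt (DPR (proj₂ z)) 0)) (KR′-two s₁ s₂ rest e₁ e₂)) final)
  where
  q = signLabel 1 s₁ ∷ ones m
  small : All (λ x → code x ≤ 5) q
  small = signLabel₁-≤5 s₁ ∷ ones-≤5 m
  module W = Twins 5 q q refl small small
  module V = TwinRuns 5 q q refl small small
  T₁ = addLabels [] (peakLabels 1 s₁ (replicate (suc m) 0)) (replicate (suc m) 0)
  start : W.Twin T₁ T₁
  start = W.twin [] e e
    where e = trans (first-labels s₁ m) (cong (_∷ []) (sym (++-identityʳ q)))
  T₂ = addLabels T₁ (peakLabels 2 s₂ xs₂) xs₂
  final : lowerRow (rowAt (DPR (proj₂ (KR'go 3 rest (P₂ , T₂)))) 0) ≡ nothing
  -- 5 is below 6, the code of 3′, so the labels from the third factor on are large.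
  final with V.KR′go-twin 3 rest P₂ (n≤1+n 5) (V.addLabels-twin bs start)
  ... | _ , W.twin {S} big eq _ = trans (cong (λ T → lowerRow (rowAt (DPR T) 0)) eq)
    (trans (cong (λ x → lowerRow (x ∷ ones m ++ S)) (unprime-signLabel 1 s₁)) (lowerRow-ones m (lowerOnes-large big)))

-- The first box of the second factor lies in the first row and carries 2′; it becomes the last box of the first factor.
EF-just-ones : ∀ {n w k} s₁ s₂ s₂′ {a₁ a₂ a₁′ a₂′ P₁ P₁′ P₂ m xs L rest} →
  InU n w k ((s₁ , a₁) ∷ (s₂ , a₂) ∷ rest) → InU n w k ((s₁ , a₁′) ∷ (s₂′ , a₂′) ∷ rest) →
  krInsWord [] a₁ ≡ (P₁ , replicate (suc m) 0) → krInsWord P₁ a₂ ≡ (P₂ , 0 ∷ xs) →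
  krInsWord [] a₁′ ≡ (P₁′ , replicate (suc (suc m)) 0) → krInsWord P₁′ a₂′ ≡ (P₂ , xs) →
  peakLabels 2 s₂ (0 ∷ xs) ≡ primed 2 ∷ L → peakLabels 2 s₂′ xs ≡ L → Boxes 5 L xs →
  EF n w k ((s₁ , a₁) ∷ (s₂ , a₂) ∷ rest) (just ((s₁ , a₁′) ∷ (s₂′ , a₂′) ∷ rest))
EF-just-ones s₁ s₂ s₂′ {P₂ = P₂} {m} {xs} {L} {rest} u v e₁ e₂ e₁′ e₂′ l l′ bs
  with V.KR′go-twin 3 rest P₂ (n≤1+n 5) (V.addLabels-twin bs start)
  where
  q  = signLabel 1 s₁ ∷ ones m ∷ʳ primed 2
  q′ = signLabel 1 s₁ ∷ ones m ∷ʳ plain 1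
  len : length q ≡ length q′
  len = cong suc (trans (length-∷ʳ (ones m) (primed 2)) (sym (length-∷ʳ (ones m) (plain 1))))
  small : All (λ x → code x ≤ 5) q
  small = signLabel₁-≤5 s₁ ∷ All.∷ʳ⁺ (ones-≤5 m) (m≤m+n 4 1)
  small′ : All (λ x → code x ≤ 5) q′
  small′ = signLabel₁-≤5 s₁ ∷ All.∷ʳ⁺ (ones-≤5 m) (m≤m+n 3 2)
  module W = Twins 5 q q′ len small small′
  module V = TwinRuns 5 q q′ len small small′
  start : W.Twin (q ∷ []) (q′ ∷ [])
  start = W.twin [] (cong (_∷ []) (sym (++-identityʳ q))) (cong (_∷ []) (sym (++-identityʳ q′)))
... | sameP , Twins.twin {S} {Rs} big eq eq′ = EF-just u v
  (trans (KR′-two s₁ s₂ rest e₁ e₂) (trans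
    (cong (λ T → KR'go 3 rest (P₂ , T)) (trans
      (cong (λ ls → addLabels T₁ ls (0 ∷ xs)) l)
      (cong (λ T → addLabels (appendRow T 0 (primed 2)) L xs) (first-labels s₁ m))))
    (cong (proj₁ (KR'go 3 rest (P₂ , addLabels (q ∷ []) L xs)) ,_) eq)))
  (trans (cong (λ x → lowerRow (x ∷ (ones m ∷ʳ primed 2) ++ S)) (unprime-signLabel 1 s₁))
    (trans (cong (λ R → lowerRow (plain 1 ∷ R)) (++-assoc (ones m) (primed 2 ∷ []) S))
    (trans (lowerRow-ones m refl) (cong (λ R → just (plain 1 ∷ R)) (sym (++-assoc (ones m) (plain 1 ∷ []) S))))))
  (trans (KR′-two s₁ s₂′ rest e₁′ e₂′) (trans
    (cong (λ T → KR'go 3 rest (P₂ , T)) (trans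
      (cong (λ ls → addLabels T₁′ ls xs) l′)
      (cong (λ T → addLabels T L xs) (trans (first-labels s₁ (suc m)) (cong (λ R → (signLabel 1 s₁ ∷ R) ∷ []) (ones-∷ m))))))
    (cong₂ _,_ sameP (trans eq′ (cong (λ x → (x ∷ (ones m ∷ʳ plain 1) ++ S) ∷ Rs) (sym (restore-signLabel 0 s₁)))))))
  where
  q = signLabel 1 s₁ ∷ ones m ∷ʳ primed 2
  T₁  = addLabels [] (peakLabels 1 s₁ (replicate (suc m) 0)) (replicate (suc m) 0)
  T₁′ = addLabels [] (peakLabels 1 s₁ (replicate (suc (suc m)) 0)) (replicate (suc (suc m)) 0)
  ones-∷ : ∀ m → ones (suc m) ≡ ones m ∷ʳ plain 1
  ones-∷ zero    = refl
  ones-∷ (suc m) = cong (plain 1 ∷_) (ones-∷ m)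

EF-zero-empty : ∀ {n w k s₁ s₂ rest} → InU n w k ((s₁ , []) ∷ (s₂ , []) ∷ rest) →
  EF n w k ((s₁ , []) ∷ (s₂ , []) ∷ rest) nothing
EF-zero-empty {rest = rest} u = EF-zero u (lowerRow-Fresh (fresh (proj₂ (KR'go 3 rest ([] , [])))
    (KR′go-row0 {6} {[]} 3 rest [] ≤-refl [])))
  where
  fresh : ∀ T → All (λ x → 6 ≤ code x) (rowAt T 0) → All (λ x → 6 ≤ code x) (rowAt (DPR T) 0)
  fresh []             _        = []
  fresh ([] ∷ T)       _        = []
  fresh ((e ∷ es) ∷ T) (p ∷ ps) = ≤-trans p (≤-unprime e) ∷ ps

-- After the lowering all labels left to the second factor are 2, including the one at its peak,
-- which is now its first box. This forces its new sign to be `splus`.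
newLabels : ∀ a n → n ≡ length a → peakLabels 2 (newSign₂ a) (replicate n 0) ≡ map (λ _ → plain 2) (replicate n 0)
newLabels []      zero    _ = refl
newLabels (_ ∷ _) (suc n) _ = peakLabels-zeros 2 splus n

-- With an empty first factor, the word `x ∷ a` alone fills the first row. Unpriming makes the head
-- a 2 for either sign, so it is lowered, and the restored prime carries the sign `s₂` over to the
-- first factor.
EF-just-empty : ∀ {n w k s₁ s₂ x a rest} →
  InU n w k ((s₁ , []) ∷ (s₂ , x ∷ a) ∷ rest) → InU n w k ((s₂ , x ∷ []) ∷ (newSign₂ a , a) ∷ rest) →
  (∃ λ P → krInsWord [] (x ∷ a) ≡ (P , replicate (suc (length a)) 0)) →
  EF n w k ((s₁ , []) ∷ (s₂ , x ∷ a) ∷ rest) (just ((s₂ , x ∷ []) ∷ (newSign₂ a , a) ∷ rest))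
EF-just-empty {s₁ = s₁} {s₂} {x} {a} {rest} u v (P , e)
  with V.KR′go-twin 3 rest P (n≤1+n 5) (V.addLabels-twin (Boxes-plain xs ≤-refl) start)
  where
  xs = replicate (length a) 0
  q  = signLabel 2 s₂ ∷ []
  q′ = signLabel 1 s₂ ∷ []
  module W = Twins 5 q q′ refl (signLabel₂-≤5 s₂ ∷ []) (signLabel₁-≤5 s₂ ∷ [])
  module V = TwinRuns 5 q q′ refl (signLabel₂-≤5 s₂ ∷ []) (signLabel₁-≤5 s₂ ∷ [])
  start : W.Twin (q ∷ []) (q′ ∷ [])
  start = W.twin [] refl refl
... | sameP , Twins.twin {S} {Rs} big eq eq′ = EF-just u v
  (trans (KR′-two s₁ s₂ {a₁ = []} {x ∷ a} rest refl e) (trans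
    (cong (λ ls → KR'go 3 rest (P , addLabels [] ls (0 ∷ xs))) (peakLabels-zeros 2 s₂ (length a)))
    (cong (proj₁ (KR'go 3 rest (P , addLabels ((signLabel 2 s₂ ∷ []) ∷ []) (map (λ _ → plain 2) xs) xs)) ,_) eq)))
  (cong (λ y → lowerRow (y ∷ S)) (unprime-signLabel 2 s₂))
  (trans (KR′-two s₂ (newSign₂ a) {a₁ = x ∷ []} {a} rest refl tail≡) (trans
    (cong (λ ls → KR'go 3 rest (P , addLabels ((signLabel 1 s₂ ∷ []) ∷ []) ls xs)) (newLabels a (length a) refl))
    (cong₂ _,_ sameP (trans eq′ (cong (λ y → (y ∷ S) ∷ Rs) (sym (restore-signLabel 1 s₂)))))))
  where
  xs = replicate (length a) 0
  tail≡ : krInsWord ((x ∷ []) ∷ []) a ≡ (P , xs)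
  tail≡ = cong₂ _,_ (cong proj₁ e) (∷-injectiveʳ (cong proj₂ e))

-- Both factorizations insert the same letters in the same order; only the place where the list of
-- rows is cut differs.
move-letter : ∀ {a x b P₁ P₁′ P₂ r rs} → krInsWord [] a ≡ (P₁ , replicate (length a) 0) →
  krInsWord [] (a ∷ʳ x) ≡ (P₁′ , replicate (suc (length a)) 0) →
  krInsWord P₁ (x ∷ b) ≡ (P₂ , r ∷ rs) → r ≡ 0 × krInsWord P₁′ b ≡ (P₂ , rs)
move-letter {a} {x} {b} {P₁} {P₁′} {P₂} {r} {rs} e₁ e₁′ e₂ =
    trans (sym r≡) (proj₂ (All.∷ʳ⁻ (subst (All (_≡ 0)) (cong proj₂ both) (zero-All (suc (length a))))))
  , trans (cong (λ P → krInsWord P b) (cong proj₁ both)) (cong₂ _,_ (cong proj₁ e₂) (∷-injectiveʳ (cong proj₂ e₂)))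
  where
  both : (P₁′ , replicate (suc (length a)) 0) ≡
         (proj₁ (krIns P₁ x) , replicate (length a) 0 ∷ʳ proj₂ (krIns P₁ x))
  both = trans (sym e₁′) (trans (krInsWord-++ [] a (x ∷ []))
    (cong (λ z → proj₁ (krIns (proj₁ z) x) , proj₂ z ∷ʳ proj₂ (krIns (proj₁ z) x)) e₁))
  r≡ : proj₂ (krIns P₁ x) ≡ r
  r≡ = ∷-injectiveˡ (cong proj₂ e₂)

-- Factorizations with one letter moved

Um-tail : ∀ {x a} → Um (x ∷ a) → Um a
Um-tail (up [])      = tt
Um-tail (up (_ ∷ u)) = up u
Um-tail (_ ∷ d)      = d

Up-prefix : ∀ {x} a {b} → Up x (a ++ b) → Up x a
Up-prefix []      _       = []
Up-prefix (y ∷ a) (p ∷ u) = p ∷ Up-prefix a u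

Dn-prefix : ∀ {x} a {b} → Dn x (a ++ b) → Dn x a
Dn-prefix []      _       = up []
Dn-prefix (y ∷ a) (up u)  = up (Up-prefix (y ∷ a) u)
Dn-prefix (y ∷ a) (p ∷ d) = p ∷ Dn-prefix a d

Um-prefix : ∀ a {b} → Um (a ++ b) → Um a
Um-prefix []      _ = tt
Um-prefix (x ∷ a) u = Dn-prefix a u

moved : ∀ a x (b c : List ℕ) → (a ∷ʳ x) ++ b ++ c ≡ a ++ (x ∷ b) ++ c
moved a x b c = ++-assoc a (x ∷ []) (b ++ c)

InU-moved : ∀ {n w k s₁ s₂ s₁′ s₂′ a x b rest} → InU n w k ((s₁ , a) ∷ (s₂ , x ∷ b) ∷ rest) →
  Um (a ∷ʳ x) → s₁′ ≢ szero → (b ≡ [] × s₂′ ≡ szero) ⊎ (b ≢ [] × s₂′ ≢ szero) →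
  InU n w k ((s₁′ , a ∷ʳ x) ∷ (s₂′ , b) ∷ rest)
InU-moved {n} {w} {a = a} {x} {b} {rest} (l , v₁ ∷ v₂ ∷ vs , red) um s₁≢ s₂ok =
    l
  , (Um⇒Unimodal um , inj₂ ((λ e → ¬empty a e) , s₁≢)) ∷ (Um⇒Unimodal (Um-tail (Unimodal⇒Um (proj₁ v₂))) , s₂ok) ∷ vs
  , subst (IsReducedWord n w) (sym (moved a x b (concatMap proj₂ rest))) red
  where
  ¬empty : ∀ a → a ∷ʳ x ≢ []
  ¬empty []      ()
  ¬empty (_ ∷ _) ()

newSign₂-valid : ∀ a → (a ≡ [] × newSign₂ a ≡ szero) ⊎ (a ≢ [] × newSign₂ a ≢ szero)
newSign₂-valid []      = inj₁ (refl , refl)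
newSign₂-valid (_ ∷ _) = inj₂ ((λ ()) , λ ())

nonempty-sign : ∀ {s x a} → ValidFactor (s , x ∷ a) → s ≢ szero
nonempty-sign (_ , inj₂ (_ , p)) = p

sminus-only : ∀ {s} → s ≢ szero → s ≢ splus → s ≡ sminus
sminus-only {szero}  p q = contradiction refl p
sminus-only {splus}  p q = contradiction refl q
sminus-only {sminus} p q = refl

InU-Red : ∀ {n w k s₁ s₂ a₁ a₂ rest} → InU n w k ((s₁ , a₁) ∷ (s₂ , a₂) ∷ rest) → Red (a₁ ++ a₂)
InU-Red {a₁ = a₁} {a₂} {rest} (_ , _ , red) = Red-++ˡ (concatMap proj₂ rest)
  (Red-~ (~reflexive (sym (++-assoc a₁ a₂ (concatMap proj₂ rest)))) (reduced⇒Red red))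

-- The insertion of a nonempty second factor after a nonempty first one. `row0` and `rows0` lead
-- from boxes back to words: letters that stay in the first row extend its word, and a row is
-- unimodal.
record Second (a₁ : List ℕ) (x : ℕ) (b : List ℕ) : Set where
  field
    {X}    : Row
    {P₂}   : List (List ℕ)
    {r}    : ℕ
    {rs}   : List ℕ
    first≡ : krInsWord [] a₁ ≡ (word X ∷ [] , replicate (length a₁) 0)
    next≡  : krInsWord (word X ∷ []) (x ∷ b) ≡ (P₂ , r ∷ rs)
    peak   : Peak r rs
    row0   : r ≡ 0 → Um (a₁ ∷ʳ x)
    rows0  : All (_≡ 0) (r ∷ rs) → Um (a₁ ++ x ∷ b)

second : ∀ {y us x b} → Um (y ∷ us) → Um (x ∷ b) → Red ((y ∷ us) ++ x ∷ b) → Second (y ∷ us) x b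
second {y} {us} {x} {b} u₁ u₂ red with unimodal-krInsWord u₁ (Red-++ˡ (x ∷ b) red)
... | X , h , w , e with krInsWord-InsWord {X ∷ []} {x ∷ b} (h ∷ []) redX
  where redX = subst (λ v → Red (v ++ x ∷ b)) (sym w) red
... | Xs , r ∷ rs , is@(i ∷ _) , e′ , _ = record
  { X = X ; first≡ = e ; next≡ = e′ ; peak = rows-Peak (h ∷ []) redX u₂ is
  ; row0  = λ { refl → let _ , _ , h′ , v = zero-rows h (i ∷ []) (refl ∷ []) in
                subst Um (trans v (cong (_++ x ∷ []) w)) (Um-word h′) }
  ; rows0 = λ z → let _ , _ , h′ , v = zero-rows h is z in subst Um (trans v (cong (_++ x ∷ b) w)) (Um-word h′) }
  where redX = subst (λ v → Red (v ++ x ∷ b)) (sym w) red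

unimodal-zeros : ∀ {a b P₁ P₂ xs} → a ≢ [] → Um (a ++ b) → Red (a ++ b) → krInsWord [] a ≡ (P₁ , replicate (length a) 0) →
  krInsWord P₁ b ≡ (P₂ , xs) → xs ≡ replicate (length xs) 0
unimodal-zeros {[]} a≢ _ _ _ _ = contradiction refl a≢
unimodal-zeros {y ∷ us} {b} {xs = xs} _ um red e₁ e₂ with unimodal-krInsWord um red
... | _ , _ , _ , e = All-zero (All.++⁻ʳ (replicate (suc (length us)) 0) (subst (All (_≡ 0)) (cong proj₂ both) (zero-All _)))
  where
  both : _ ≡ (_ , replicate (suc (length us)) 0 ++ xs)
  both = trans (sym e) (trans (krInsWord-++ [] (y ∷ us) b)
    (trans (cong (λ z → proj₁ (krInsWord (proj₁ z) b) , proj₂ z ++ proj₂ (krInsWord (proj₁ z) b)) e₁)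
           (cong (λ z → proj₁ z , replicate (suc (length us)) 0 ++ proj₂ z) e₂)))

-- The first box of the second factor lies off the first row, so every box of this factor in the
-- first row comes after the peak and carries a 2.
nonUnimodal-zero : ∀ {n w k s₁ s₂ y us x b rest} → InU n w k ((s₁ , y ∷ us) ∷ (s₂ , x ∷ b) ∷ rest) →
  Second (y ∷ us) x b → ¬ Unimodal ((y ∷ us) ∷ʳ x) →
  EF n w k ((s₁ , y ∷ us) ∷ (s₂ , x ∷ b) ∷ rest) nothing
nonUnimodal-zero u record { r = zero ; row0 = row0 } ¬uni = contradiction (Um⇒Unimodal (row0 refl)) ¬uni
nonUnimodal-zero {s₁ = s₁} {s₂} u record { r = suc r ; first≡ = e₁ ; next≡ = e₂ ; peak = pk } ¬uni =
  EF-zero-ones s₁ s₂ u e₁ e₂ (Boxes-offrow 2 s₂ pk z<s ≤-refl)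

longer : ∀ {n w k s₁ s₂ y us x b rest} → InU n w k ((s₁ , y ∷ us) ∷ (s₂ , x ∷ b) ∷ rest) → Um ((y ∷ us) ∷ʳ x) →
  ∃ λ P → krInsWord [] ((y ∷ us) ∷ʳ x) ≡ (P , replicate (suc (suc (length us))) 0)
longer {y = y} {us} {x} {b} {rest} u um with unimodal-krInsWord um (Red-++ˡ b
    (Red-~ (~reflexive (sym (++-assoc (y ∷ us) (x ∷ []) b))) (InU-Red {a₁ = y ∷ us} {x ∷ b} {rest} u)))
... | X , _ , _ , e = word X ∷ [] , trans e (cong (λ k → word X ∷ [] , replicate (suc k) 0) (length-∷ʳ us x))

nonUnimodal-just : ∀ {n w k s₁ s₂ y us x b rest} → InU n w k ((s₁ , y ∷ us) ∷ (s₂ , x ∷ b) ∷ rest) →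
  Second (y ∷ us) x b → ¬ Unimodal ((y ∷ us) ++ x ∷ b) → Unimodal ((y ∷ us) ∷ʳ x) →
  EF n w k ((s₁ , y ∷ us) ∷ (s₂ , x ∷ b) ∷ rest) (just ((s₁ , (y ∷ us) ∷ʳ x) ∷ (s₂ , b) ∷ rest))
nonUnimodal-just {n} {w} {k} {s₁} {s₂} {y} {us} {x} {b} {rest} u@(_ , v₁ ∷ v₂ ∷ _ , _) d ¬uni uni =
  let P , e = longer {b = b} {rest} u (Unimodal⇒Um uni)
      z , e′ = move-letter {y ∷ us} {x} {b} (D.first≡) e (D.next≡)
  in go P D.rs z D.peak D.rows0 D.next≡ e e′
  where
  module D = Second d
  b≢[] : b ≢ []
  b≢[] refl = ¬uni uni
  go : ∀ {r} P rs → r ≡ 0 → Peak r rs → (All (_≡ 0) (r ∷ rs) → Um ((y ∷ us) ++ x ∷ b)) →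
    krInsWord (word D.X ∷ []) (x ∷ b) ≡ (D.P₂ , r ∷ rs) →
    krInsWord [] ((y ∷ us) ∷ʳ x) ≡ (P , replicate (suc (suc (length us))) 0) → krInsWord P b ≡ (D.P₂ , rs) →
    EF n w k ((s₁ , y ∷ us) ∷ (s₂ , x ∷ b) ∷ rest) (just ((s₁ , (y ∷ us) ∷ʳ x) ∷ (s₂ , b) ∷ rest))
  -- Row indices that start at 0 and never rise are all 0, and then the whole concatenation would be
  -- unimodal.
  go P rs refl (down wd) f _ _ _ = contradiction (Um⇒Unimodal (f (refl ∷ WeakDown-zero wd))) ¬uni
  -- The first box lies before the peak, so it is labelled 2′ for either sign `s₂`. The peak stays
  -- in the second factor, which therefore keeps its sign.
  go P (suc r ∷ rs) refl (_ ∷ pk) _ e₂ e e′ = EF-just-ones s₁ s₂ s₂ {y ∷ us} {x ∷ b} {(y ∷ us) ∷ʳ x} {b}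
    {word D.X ∷ []} {P} {D.P₂} {length us} {suc r ∷ rs} {peakLabels 2 s₂ (suc r ∷ rs)} {rest} u
    (InU-moved {a = y ∷ us} {x} {b} {rest} u (Unimodal⇒Um uni) (nonempty-sign v₁) (inj₂ (b≢[] , nonempty-sign v₂)))
    D.first≡ e₂ e e′ refl refl (Boxes-offrow 2 s₂ pk z<s ≤-refl)

-- All boxes lie in the first row, so the first one is the peak. With the sign `splus` it is
-- labelled 2, and no 2′ occurs.
unimodal-zero : ∀ {n w k s₁ y us x b rest} → InU n w k ((s₁ , y ∷ us) ∷ (splus , x ∷ b) ∷ rest) →
  Second (y ∷ us) x b → Unimodal ((y ∷ us) ++ x ∷ b) →
  EF n w k ((s₁ , y ∷ us) ∷ (splus , x ∷ b) ∷ rest) nothing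
unimodal-zero {s₁ = s₁} {y} {us} {x} {b} {rest} u record { r = r ; rs = rs ; first≡ = e₁ ; next≡ = e₂ } uni =
  EF-zero-ones s₁ splus u e₁ e₂ (subst (λ xs → Boxes 5 (peakLabels 2 splus xs) xs)
    (sym (unimodal-zeros {y ∷ us} {x ∷ b} (λ ()) (Unimodal⇒Um uni) (InU-Red {a₁ = y ∷ us} {x ∷ b} {rest} u) e₁ e₂)) plains)
  where
  zs = replicate (length rs) 0
  plains : Boxes 5 (peakLabels 2 splus (0 ∷ zs)) (0 ∷ zs)
  plains = subst (λ ls → Boxes 5 ls (0 ∷ zs)) (sym (peakLabels-zeros 2 splus (length rs)))
             ((λ _ → ≤-refl) ∷ Boxes-plain zs ≤-refl)

-- The first box is the peak, and the sign `sminus` labels it 2′. The labels behind it are all 2, as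
-- for a second factor with sign `splus`.
unimodal-just : ∀ {n w k s₁ y us x b rest} → InU n w k ((s₁ , y ∷ us) ∷ (sminus , x ∷ b) ∷ rest) →
  Second (y ∷ us) x b → Unimodal ((y ∷ us) ++ x ∷ b) →
  EF n w k ((s₁ , y ∷ us) ∷ (sminus , x ∷ b) ∷ rest) (just ((s₁ , (y ∷ us) ∷ʳ x) ∷ (newSign₂ b , b) ∷ rest))
unimodal-just {n} {w} {k} {s₁} {y} {us} {x} {b} {rest} u@(_ , v₁ ∷ v₂ ∷ _ , _) d uni =
  let P , e = longer {b = b} {rest} u um
      z , e′ = move-letter {y ∷ us} {x} {b} (D.first≡) e (D.next≡)
  in go P D.rs z D.next≡ e e′
  where
  module D = Second d
  um = Um-prefix ((y ∷ us) ∷ʳ x) (subst Um (sym (++-assoc (y ∷ us) (x ∷ []) b)) (Unimodal⇒Um uni))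
  go : ∀ {r} P rs → r ≡ 0 → krInsWord (word D.X ∷ []) (x ∷ b) ≡ (D.P₂ , r ∷ rs) →
    krInsWord [] ((y ∷ us) ∷ʳ x) ≡ (P , replicate (suc (suc (length us))) 0) → krInsWord P b ≡ (D.P₂ , rs) →
    EF n w k ((s₁ , y ∷ us) ∷ (sminus , x ∷ b) ∷ rest) (just ((s₁ , (y ∷ us) ∷ʳ x) ∷ (newSign₂ b , b) ∷ rest))
  go P rs refl e₂ e e′ = EF-just-ones s₁ sminus (newSign₂ b) {y ∷ us} {x ∷ b} {(y ∷ us) ∷ʳ x} {b}
    {word D.X ∷ []} {P} {D.P₂} {length us} {zs} {map (λ _ → plain 2) zs} {rest} u
    (InU-moved {a = y ∷ us} {x} {b} {rest} u um (nonempty-sign v₁) (newSign₂-valid b))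
    D.first≡ (trans e₂ (cong (λ l → D.P₂ , 0 ∷ l) rs≡)) e (trans e′ (cong (D.P₂ ,_) rs≡))
    (peakLabels-zeros 2 sminus (length rs)) (newLabels b (length rs) len≡) (Boxes-plain zs ≤-refl)
    where
    zs = replicate (length rs) 0
    rs≡ : rs ≡ zs
    rs≡ = ∷-injectiveʳ (unimodal-zeros {y ∷ us} {x ∷ b} (λ ()) (Unimodal⇒Um uni)
            (InU-Red {a₁ = y ∷ us} {x ∷ b} {rest} u) D.first≡ e₂)
    len≡ : length rs ≡ length b
    len≡ = trans (cong (length ∘ proj₂) (sym e′)) (krInsWord-length P b)

theorem4p17 : (n : ℕ) (w : List ℤ) (m : ℕ) → 2 ≤ m →
    (s₁ s₂ : Sign) (a₁ a₂ : List ℕ) (rest : List Factor) →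
    InU n w m ((s₁ , a₁) ∷ (s₂ , a₂) ∷ rest) →
    -- (1) a₁a₂ not unimodal
    (¬ Unimodal (a₁ ++ a₂) → (x : ℕ) (a₂' : List ℕ) → a₂ ≡ x ∷ a₂' →
       (Unimodal (a₁ ∷ʳ x) →
          EF n w m ((s₁ , a₁) ∷ (s₂ , a₂) ∷ rest)
             (just ((s₁ , a₁ ∷ʳ x) ∷ (s₂ , a₂') ∷ rest)))
     × (¬ Unimodal (a₁ ∷ʳ x) →
          EF n w m ((s₁ , a₁) ∷ (s₂ , a₂) ∷ rest) nothing))
    ×
    -- (2) a₁a₂ unimodal
    (Unimodal (a₁ ++ a₂) →
       ((a₂ ≡ [] ⊎ (s₁ ≢ szero × s₂ ≡ splus)) →
          EF n w m ((s₁ , a₁) ∷ (s₂ , a₂) ∷ rest) nothing)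
     × ((x : ℕ) (a₂' : List ℕ) → a₂ ≡ x ∷ a₂' → ¬ (s₁ ≢ szero × s₂ ≡ splus) →
          EF n w m ((s₁ , a₁) ∷ (s₂ , a₂) ∷ rest)
             (just ((newSign₁ a₁ s₁ s₂ , a₁ ∷ʳ x) ∷ (newSign₂ a₂' , a₂') ∷ rest))))
theorem4p17 n w m _ s₁ s₂ [] a₂ rest u@(_ , v₁ ∷ v₂ ∷ _ , _) =
    -- The concatenation is `a₂` itself, a factor and hence unimodal.
    (λ ¬uni → contradiction (proj₁ v₂) ¬uni)
  , λ _ → zeroCase u , justCase u
  where
  zeroCase : ∀ {a₂} → InU n w m ((s₁ , []) ∷ (s₂ , a₂) ∷ rest) → a₂ ≡ [] ⊎ (s₁ ≢ szero × s₂ ≡ splus) →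
    EF n w m ((s₁ , []) ∷ (s₂ , a₂) ∷ rest) nothing
  zeroCase u (inj₁ refl) = EF-zero-empty u
  zeroCase (_ , (_ , inj₁ (_ , s₁≡)) ∷ _ , _) (inj₂ (s₁≢ , _)) = contradiction s₁≡ s₁≢
  zeroCase (_ , (_ , inj₂ (¬[] , _)) ∷ _ , _) (inj₂ _)         = contradiction refl ¬[]
  justCase : ∀ {a₂} → InU n w m ((s₁ , []) ∷ (s₂ , a₂) ∷ rest) → (x : ℕ) (a₂' : List ℕ) → a₂ ≡ x ∷ a₂' →
    ¬ (s₁ ≢ szero × s₂ ≡ splus) →
    EF n w m ((s₁ , []) ∷ (s₂ , a₂) ∷ rest) (just ((s₂ , x ∷ []) ∷ (newSign₂ a₂' , a₂') ∷ rest))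
  justCase u@(_ , _ ∷ v₂ ∷ _ , _) x a₂' refl _ = EF-just-empty {s₁ = s₁} u
    (InU-moved u (up []) (nonempty-sign v₂) (newSign₂-valid a₂'))
    (let X , _ , _ , e = unimodal-krInsWord (Unimodal⇒Um (proj₁ v₂)) (InU-Red {a₁ = []} u) in word X ∷ [] , e)
theorem4p17 n w m _ s₁ s₂ (y ∷ us) [] rest u@(_ , v₁ ∷ v₂ ∷ _ , _) =
    (λ _ _ _ ())
  , λ _ → (λ _ → let _ , _ , _ , e = unimodal-krInsWord (Unimodal⇒Um (proj₁ v₁)) (Red-++ˡ [] (InU-Red {a₁ = y ∷ us} {[]} {rest} u)) in
                 EF-zero-ones s₁ s₂ u e refl []) ,
          λ _ _ ()
theorem4p17 n w m _ s₁ s₂ (y ∷ us) (x ∷ b) rest u@(_ , v₁ ∷ v₂ ∷ _ , _) =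
    (λ { ¬uni _ _ refl → nonUnimodal-just u second-factor ¬uni , nonUnimodal-zero u second-factor })
  , λ uni → (λ { (inj₂ (_ , refl)) → unimodal-zero u second-factor uni }) ,
            λ { _ _ refl ¬plus → minus uni u (sminus-only (nonempty-sign v₂) (λ s₂≡ → ¬plus (nonempty-sign v₁ , s₂≡))) }
  where
  second-factor : Second (y ∷ us) x b
  second-factor = second (Unimodal⇒Um (proj₁ v₁)) (Unimodal⇒Um (proj₁ v₂)) (InU-Red {a₁ = y ∷ us} {x ∷ b} {rest} u)
  minus : ∀ {s₂} → Unimodal ((y ∷ us) ++ x ∷ b) → InU n w m ((s₁ , y ∷ us) ∷ (s₂ , x ∷ b) ∷ rest) → s₂ ≡ sminus →
    EF n w m ((s₁ , y ∷ us) ∷ (s₂ , x ∷ b) ∷ rest) (just ((s₁ , (y ∷ us) ∷ʳ x) ∷ (newSign₂ b , b) ∷ rest))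
  minus uni u refl = unimodal-just u second-factor uni
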